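{- For all $n$, the $h^*$-vectors of $B_n(132,312)$ and $\widetilde B_n(123)$ are palindromic.
   Context: $M_\sigma$ is the permutation matrix of $\sigma$. $B_n(132,312)$ is the convex hull of $M_\sigma$ over $\sigma\in\mathfrak S_n$ avoiding $132$ and $312$; $\widetilde B_n(123)$ is the convex hull of $M_\sigma$ over alternating ($a_1<a_2>a_3<\cdots$) $123$-avoiding $\sigma=a_1\cdots a_n\in\mathfrak S_n$. The $h^*$-vector $(h^*_0,\dots,h^*_d)$ of a lattice polytope $P$ (with $h^*_d\ne0$) is the coefficient vector of the polynomial $h^*_P(t)$ satisfying $1+\sum_{m\ge1}|mP\cap\mathbb Z^{n\times n}|\,t^m=h^*_P(t)/(1-t)^{\dim P+1}$; it is palindromic if $h^*_i=h^*_{d-i}$ for all $i$. -}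

module Defs where

open import Data.Nat as ℕ using (ℕ; zero; suc; _<_; _≤_)
open import Data.Nat.Combinatorics using (_C_)
open import Data.Integer as ℤ using (ℤ; +_; -_)
open import Data.Rational as ℚ using (ℚ; 0ℚ; 1ℚ)
open import Data.Fin as Fin using (Fin; toℕ)
open import Data.Vec using (Vec; lookup; foldr; []; _∷_)
open import Data.List using (List; length)
open import Data.List.Relation.Unary.Unique.Propositional using (Unique)
open import Data.List.Membership.Propositional using (_∈_)
open import Data.Vec.Relation.Unary.All using (All)
open import Data.Product using (Σ; _×_; ∃; ∃-syntax)
open import Data.Empty using (⊥)
open import Relation.Nullary using (¬_)
open import Relation.Binary.PropositionalEquality using (_≡_; _≢_)
open import Function.Definitions using (Injective)

Perm : ℕ → Set
Perm n = Σ (Fin n → Fin n) (Injective _≡_ _≡_)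

_at_ : ∀ {n} → Perm n → Fin n → Fin n
σ at i = Data.Product.proj₁ σ i

Contains132 : ∀ {n} → Perm n → Set
Contains132 σ = ∃[ i ] ∃[ j ] ∃[ k ] (i Fin.< j × j Fin.< k ×
  (σ at i) Fin.< (σ at k) × (σ at k) Fin.< (σ at j))

Contains312 : ∀ {n} → Perm n → Set
Contains312 σ = ∃[ i ] ∃[ j ] ∃[ k ] (i Fin.< j × j Fin.< k ×
  (σ at j) Fin.< (σ at k) × (σ at k) Fin.< (σ at i))

Contains123 : ∀ {n} → Perm n → Set
Contains123 σ = ∃[ i ] ∃[ j ] ∃[ k ] (i Fin.< j × j Fin.< k ×
  (σ at i) Fin.< (σ at j) × (σ at j) Fin.< (σ at k))

-- alternating a₁ < a₂ > a₃ < ⋯  (1-indexed); with 0-indexed positions p,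
-- a_p < a_{p+1} when p is even and a_p > a_{p+1} when p is odd.
Even : ℕ → Set
Even zero = Data.Unit.⊤ where import Data.Unit
Even (suc zero) = ⊥
Even (suc (suc k)) = Even k

Alternating : ∀ {n} → Perm n → Set
Alternating {n} σ = ∀ (i j : Fin n) → toℕ j ≡ suc (toℕ i) →
  (Even (toℕ i) → (σ at i) Fin.< (σ at j)) ×
  (¬ Even (toℕ i) → (σ at j) Fin.< (σ at i))

-- vertex sets of the two polytopes
Av132-312 : ∀ {n} → Perm n → Set
Av132-312 σ = ¬ Contains132 σ × ¬ Contains312 σ

AltAv123 : ∀ {n} → Perm n → Set
AltAv123 σ = Alternating σ × ¬ Contains123 σ

PermMatrix : ∀ {n} → Perm n → Fin n → Fin n → ℚ
PermMatrix σ i j with (σ at i) Fin.≟ j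
... | Relation.Nullary.yes _ = 1ℚ
... | Relation.Nullary.no _ = 0ℚ

sumℚ : ∀ {k} → Vec ℚ k → ℚ
sumℚ = foldr _ ℚ._+_ 0ℚ

combo : ∀ {n k} → Vec ℚ k → Vec (Perm n) k → Fin n → Fin n → ℚ
combo [] [] i j = 0ℚ
combo (c ∷ cs) (σ ∷ σs) i j = c ℚ.* PermMatrix σ i j ℚ.+ combo cs σs i j

IntMat : ℕ → Set
IntMat n = Vec (Vec ℤ n) n

entryℚ : ∀ {n} → IntMat n → Fin n → Fin n → ℚ
entryℚ X i j = lookup (lookup X i) j ℚ./ 1

-- X ∈ m · conv{ M_σ : V σ }  (finite nonnegative rational combination
-- with total weight m)
InDilate : ∀ {n} → (Perm n → Set) → ℕ → IntMat n → Set
InDilate {n} V m X = ∃[ k ] Σ (Vec (Perm n) k) λ σs → Σ (Vec ℚ k) λ ws →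
  All V σs × All (ℚ._≤_ 0ℚ) ws × sumℚ ws ≡ (+ m) ℚ./ 1 ×
  (∀ i j → entryℚ X i j ≡ combo ws σs i j)

Counts : ∀ {n} → (IntMat n → Set) → ℕ → Set
Counts {n} A c = Σ (List (IntMat n)) λ xs →
  Unique xs × length xs ≡ c × (∀ X → (X ∈ xs → A X) × (A X → X ∈ xs))

-- Affine dimension of conv{ M_σ : V σ } (= that of its vertex set).

AffinelyIndependent : ∀ {n k} → Vec (Perm n) k → Set
AffinelyIndependent {n} {k} σs = ∀ (cs : Vec ℚ k) → sumℚ cs ≡ 0ℚ →
  (∀ i j → combo cs σs i j ≡ 0ℚ) → All (_≡ 0ℚ) cs

AffDim : ∀ {n} → (Perm n → Set) → ℕ → Set
AffDim {n} V d =
  (Σ (Vec (Perm n) (suc d)) λ σs → All V σs × AffinelyIndependent σs) ×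
  (∀ (σs : Vec (Perm n) (suc (suc d))) → All V σs → ¬ AffinelyIndependent σs)

-- h*-vector: coefficients of (1-t)^{d+1} · (1 + Σ_{m≥1} L(m) t^m)

Ehr : (ℕ → ℕ) → ℕ → ℤ
Ehr L zero = + 1
Ehr L (suc m) = + L (suc m)

hstarAux : ℕ → (ℕ → ℤ) → (k j : ℕ) → ℤ
hstarAux D E k zero = E k
hstarAux D E zero (suc j) = hstarAux D E zero j
hstarAux D E (suc k) (suc j) = hstarAux D E (suc k) j ℤ.+ term
  where
  sgn : ℤ
  sgn = ℤ._^_ (- + 1) (suc j)
  term = sgn ℤ.* (+ (D C suc j)) ℤ.* E (k ℕ.∸ j)

hstar : (d : ℕ) → (ℕ → ℕ) → ℕ → ℤ
hstar d L k = hstarAux (suc d) (Ehr L) k k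

Palindromic : (ℕ → ℤ) → Set
Palindromic h = ∃[ s ] (h s ≢ + 0 × (∀ k → s < k → h k ≡ + 0) ×
  (∀ i → i ≤ s → h i ≡ h (s ℕ.∸ i)))

HStarPalindromic : ∀ {n} → (Perm n → Set) → Set
HStarPalindromic {n} V = ∀ (L : ℕ → ℕ) →
  (∀ m → 1 ≤ m → Counts (InDilate V m) (L m)) →
  ∀ d → AffDim V d → Palindromic (hstar d L)

{-# OPTIONS --safe #-}

-- Both polytopes are order polytopes of graded posets. In either case the vertices correspond to lattice
-- paths α with steps 0 and 1 in a region of the grid, that is, to the order ideals of the poset of its cells;
-- the coordinates [j ≤ α t] and the entries of the permutation matrix determine each other by linear maps
-- with integer coefficients. So the lattice points of the m-th dilate are the order preserving maps f into
-- [0, m] (their level sets give the vertices), and the dimension is the number d of cells.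
--   Let Ω(m) and S(m) count the weakly order preserving maps into [0, m] and the strictly order preserving
-- maps into [1, m]. Deciding for one maximal element of an ideal after the other whether it takes the value m
-- shows, by induction on the size, that the numerators of Σ Ω(m) tᵐ and Σ S(m) tᵐ over (1 - t)ᵈ⁺¹ are
-- reversals of each other. As the poset is graded of height r, subtracting the rank from a strict map
-- gives S(m) = Ω(m - r), so the numerator h* of Σ Ω(m) tᵐ satisfies h*(t) = tᵈ⁻ʳ h*(1/t).

module Submission where

open import Defs
open import Data.Empty using (⊥-elim)
open import Data.Fin using (Fin; zero; suc; toℕ; fromℕ<; punchIn; punchOut)
open import Data.Fin.Properties as Finₚ using (all?; any?)
open import Data.Fin.Subset as Subset using (Subset; inside; outside; ∣_∣)
  renaming (_∈_ to _∈ˢ_; _∉_ to _∉ˢ_; _-_ to _─₁_)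
import Data.Fin.Subset.Properties as Subsetₚ
open import Data.Integer as ℤ using (ℤ; +_; -_; 0ℤ; 1ℤ)
open import Data.Integer.Divisibility.Signed using (_∣_; divides; ∣m∣n⇒∣m+n; ∣m∣n⇒∣m-n)
import Data.Integer.Properties as ℤₚ
open import Data.Integer.Tactic.RingSolver using (solve-∀)
open import Data.List as List
  using (List; []; _∷_; length; filter; upTo; allFin; map; cartesianProductWith; _++_)
open import Data.List.Membership.DecPropositional using () renaming (_∈?_ to mem?)
open import Data.List.Membership.Propositional using (_∈_; _∉_)
open import Data.List.Membership.Propositional.Properties
  using (∈-∃++; ∈-++⁻; ∈-++⁺ˡ; ∈-++⁺ʳ; ∈-filter⁺; ∈-filter⁻; ∈-upTo⁺; ∈-upTo⁻; ∈-allFin; ∈-map⁺; ∈-map⁻;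
         ∈-lookup; ∈-cartesianProduct⁺; ∈-cartesianProductWith⁺; ∈-cartesianProductWith⁻)
open import Data.List.Properties using (length-++; length-map)
open import Data.List.Relation.Unary.All as All using (All; []; _∷_)
open import Data.List.Relation.Unary.Any using (here; there; index)
open import Data.List.Relation.Unary.Any.Properties using (lookup-index)
open import Data.List.Relation.Unary.Unique.Propositional using (Unique; []; _∷_)
import Data.List.Relation.Unary.Unique.Propositional.Properties as Uniqueₚ
open import Data.Nat as ℕ
  using (ℕ; zero; suc; _+_; _*_; _∸_; _≤_; _<_; z≤n; s≤s; ⌊_/2⌋; ⌈_/2⌉)
open import Data.Nat.Combinatorics using (_C_; nCk+nC[k+1]≡[n+1]C[k+1]; k>n⇒nCk≡0)
import Data.Nat.Properties as ℕₚ
import Data.Nat.Tactic.RingSolver as ℕ-Solver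
open import Data.Product using (Σ; ∃; ∃-syntax; _×_; _,_; proj₁; proj₂)
open import Data.Rational as ℚ using (ℚ; 0ℚ; 1ℚ; mkℚ; toℚᵘ)
import Data.Rational.Properties as ℚₚ
open import Data.Rational.Unnormalised as ℚᵘ using (mkℚᵘ; *≡*; *≤*)
import Data.Rational.Unnormalised.Properties as ℚᵘₚ
open import Data.Sum using (_⊎_; inj₁; inj₂)
open import Data.Unit using (tt)
open import Data.Vec as Vec using (Vec; []; _∷_; lookup; tabulate; replicate; here; there)
open import Data.Vec.Properties using (lookup∘tabulate; tabulate∘lookup; tabulate-cong)
open import Data.Vec.Relation.Binary.Pointwise.Inductive using (Pointwise; []; _∷_)
open import Data.Vec.Relation.Unary.All as AllV using ([]; _∷_) renaming (All to AllV)
open import Function using (_∘_; id; case_of_)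
open import Function.Definitions using (Injective)
open import Relation.Binary.Definitions using (Tri; tri<; tri≈; tri>)
open import Relation.Binary.PropositionalEquality
  using (_≡_; _≢_; _≗_; refl; sym; trans; cong; cong₂; subst; subst₂; module ≡-Reasoning)
open import Relation.Nullary using (¬_; Dec; yes; no; contradiction)
open import Relation.Nullary.Decidable using (_×-dec_; _⊎-dec_; _→-dec_; ¬?)
open import Relation.Unary using (Decidable)

-- Sequences ℕ → ℤ stand for power series: τ is multiplication by t, δ by 1 - t.

-- A permutation avoiding 132 and 312 is read from the right: each entry is the least or the
-- greatest of the entries up to it, and α counts the least ones. An alternating 123-avoiding
-- permutation is read by decreasing value: the peaks, with the last valley when n is odd, form one
-- decreasing sequence, the other valleys form another, and α counts the values taken from the
-- first. Points of a dilate are rational combinations of vertices, so an injective change of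
-- coordinates is not enough: an integral matrix has to come from integral coordinates. `matrix-∣`
-- states this as a divisibility. In the reciprocity, treating one maximal element at a time leaves
-- conditions on those already treated; the list K of the series `W` and `H` records them, and the
-- induction is over pairs of I and K.

Seq : Set
Seq = ℕ → ℤ

τ : Seq → Seq
τ f zero    = 0ℤ
τ f (suc m) = f m

δ : Seq → Seq
δ f m = f m ℤ.- τ f m

δ^ : ℕ → Seq → Seq
δ^ zero    f = f
δ^ (suc k) f = δ (δ^ k f)

τ^ : ℕ → Seq → Seq
τ^ zero    f = f
τ^ (suc k) f = τ (τ^ k f)

infix 4 _≗[_,_]_,_
-- With free coefficients a single induction on the exponent serves sums, differences and, with b =
-- 0, pointwise congruence.
_≗[_,_]_,_ : Seq → ℤ → ℤ → Seq → Seq → Set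
f ≗[ a , b ] g , h = ∀ m → f m ≡ a ℤ.* g m ℤ.+ b ℤ.* h m

τ-comb : ∀ a b {f g h} → f ≗[ a , b ] g , h → τ f ≗[ a , b ] τ g , τ h
τ-comb a b e zero    = zero-comb a b
  where
  zero-comb : ∀ a b → 0ℤ ≡ a ℤ.* 0ℤ ℤ.+ b ℤ.* 0ℤ
  zero-comb = solve-∀
τ-comb a b e (suc m) = e m

δ-comb : ∀ a b {f g h} → f ≗[ a , b ] g , h → δ f ≗[ a , b ] δ g , δ h
δ-comb a b {f} {g} {h} e m
  rewrite e m | τ-comb a b {f} {g} {h} e m = rearrange a b (g m) (h m) (τ g m) (τ h m)
  where
  rearrange : ∀ a b x y z w → a ℤ.* x ℤ.+ b ℤ.* y ℤ.- (a ℤ.* z ℤ.+ b ℤ.* w)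
                            ≡ a ℤ.* (x ℤ.- z) ℤ.+ b ℤ.* (y ℤ.- w)
  rearrange = solve-∀

δ^-comb : ∀ k a b {f g h} → f ≗[ a , b ] g , h → δ^ k f ≗[ a , b ] δ^ k g , δ^ k h
δ^-comb zero    a b e = e
δ^-comb (suc k) a b {f} {g} {h} e = δ-comb a b {δ^ k f} {δ^ k g} {δ^ k h} (δ^-comb k a b e)

comb-10 : ∀ x y → 1ℤ ℤ.* x ℤ.+ 0ℤ ℤ.* y ≡ x
comb-10 = solve-∀

comb-11 : ∀ x y → 1ℤ ℤ.* x ℤ.+ 1ℤ ℤ.* y ≡ x ℤ.+ y
comb-11 = solve-∀

δ^-+ : ∀ k {f} g h → (∀ m → f m ≡ g m ℤ.+ h m) → ∀ m → δ^ k f m ≡ δ^ k g m ℤ.+ δ^ k h m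
δ^-+ k {f} g h e m = trans (δ^-comb k 1ℤ 1ℤ {f} {g} {h} (λ m → trans (e m) (sym (comb-11 (g m) (h m)))) m)
                           (comb-11 (δ^ k g m) (δ^ k h m))

δ^-minus : ∀ k {f} g h → (∀ m → f m ≡ g m ℤ.- h m) → ∀ m → δ^ k f m ≡ δ^ k g m ℤ.- δ^ k h m
δ^-minus k {f} g h e m =
  trans (δ^-comb k 1ℤ (- 1ℤ) {f} {g} {h} (λ m → trans (e m) (sym (comb-1-1 (g m) (h m)))) m)
        (comb-1-1 (δ^ k g m) (δ^ k h m))
  where
  comb-1-1 : ∀ x y → 1ℤ ℤ.* x ℤ.+ (- 1ℤ) ℤ.* y ≡ x ℤ.- y
  comb-1-1 = solve-∀

δ^-cong : ∀ k {f g} → f ≗ g → δ^ k f ≗ δ^ k g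
δ^-cong k {f} {g} e m =
  trans (δ^-comb k 1ℤ 0ℤ {f} {g} {g} (λ m → trans (e m) (sym (comb-10 (g m) (g m)))) m)
        (comb-10 (δ^ k g m) (δ^ k g m))

τ-cong : ∀ {f g} → f ≗ g → τ f ≗ τ g
τ-cong e zero    = refl
τ-cong e (suc m) = e m

δ-τ : ∀ f → δ (τ f) ≗ τ (δ f)
δ-τ f zero    = refl
δ-τ f (suc m) = refl

δ^-δ : ∀ k f → δ^ k (δ f) ≗ δ^ (suc k) f
δ^-δ zero    f m = refl
δ^-δ (suc k) f   = δ^-cong 1 (δ^-δ k f)

δ^-τ : ∀ k f → δ^ k (τ f) ≗ τ (δ^ k f)
δ^-τ zero    f m = refl
δ^-τ (suc k) f m = trans (δ^-cong 1 (δ^-τ k f) m) (δ-τ (δ^ k f) m)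

δ^-τ^ : ∀ k r f → δ^ k (τ^ r f) ≗ τ^ r (δ^ k f)
δ^-τ^ k zero    f m = refl
δ^-τ^ k (suc r) f m = trans (δ^-τ k (τ^ r f) m) (τ-cong (δ^-τ^ k r f) m)

τ^-< : ∀ r f m → m < r → τ^ r f m ≡ 0ℤ
τ^-< (suc r) f zero    _         = refl
τ^-< (suc r) f (suc m) (s≤s m<r) = τ^-< r f m m<r

τ^-+ : ∀ r f m → τ^ r f (r + m) ≡ f m
τ^-+ zero    f m = refl
τ^-+ (suc r) f m = τ^-+ r f m

-- g(t) = tᵉ f(1/t) for polynomials f and g of degree at most e.
record Rev (e : ℕ) (f g : Seq) : Set where
  field
    swap  : ∀ i j → i + j ≡ e → f i ≡ g j
    f-deg : ∀ i → e < i → f i ≡ 0ℤ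
    g-deg : ∀ i → e < i → g i ≡ 0ℤ
open Rev

Rev-comb : ∀ {e} a b {f f₁ f₂ g g₁ g₂} →
  f ≗[ a , b ] f₁ , f₂ → g ≗[ a , b ] g₁ , g₂ → Rev e f₁ g₁ → Rev e f₂ g₂ → Rev e f g
Rev-comb a b pf pg r₁ r₂ = record
  { swap  = λ i j ij → trans (pf i)
      (trans (cong₂ (λ x y → a ℤ.* x ℤ.+ b ℤ.* y) (swap r₁ i j ij) (swap r₂ i j ij)) (sym (pg j)))
  ; f-deg = λ i lt → trans (pf i) (vanish (f-deg r₁ i lt) (f-deg r₂ i lt))
  ; g-deg = λ i lt → trans (pg i) (vanish (g-deg r₁ i lt) (g-deg r₂ i lt))
  }
  where
  zero-comb : ∀ a b → a ℤ.* 0ℤ ℤ.+ b ℤ.* 0ℤ ≡ 0ℤ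
  zero-comb = solve-∀
  vanish : ∀ {x y} → x ≡ 0ℤ → y ≡ 0ℤ → a ℤ.* x ℤ.+ b ℤ.* y ≡ 0ℤ
  vanish refl refl = zero-comb a b

Rev-+ : ∀ {e f f₁ f₂ g g₁ g₂} → (∀ m → f m ≡ f₁ m ℤ.+ f₂ m) → (∀ m → g m ≡ g₁ m ℤ.+ g₂ m) →
  Rev e f₁ g₁ → Rev e f₂ g₂ → Rev e f g
Rev-+ {f₁ = f₁} {f₂} {_} {g₁} {g₂} pf pg = Rev-comb 1ℤ 1ℤ
  (λ m → trans (pf m) (sym (comb-11 (f₁ m) (f₂ m))))
  (λ m → trans (pg m) (sym (comb-11 (g₁ m) (g₂ m))))

Rev-cong : ∀ {e f f′ g g′} → f ≗ f′ → g ≗ g′ → Rev e f′ g′ → Rev e f g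
Rev-cong pf pg r = record
  { swap  = λ i j ij → trans (pf i) (trans (swap r i j ij) (sym (pg j)))
  ; f-deg = λ i lt → trans (pf i) (f-deg r i lt)
  ; g-deg = λ i lt → trans (pg i) (g-deg r i lt)
  }

-- Raising the degree bound by one multiplies the reversal by t and leaves f as it is; the boundary
-- case j = 0 says that f has no coefficient at e + 1.
Rev-τ : ∀ {e f g} → Rev e f g → Rev (suc e) f (τ g)
Rev-τ {e} {f} {g} r = record
  { swap  = λ { i zero    ij → f-deg r i (ℕₚ.≤-reflexive (trans (sym ij) (ℕₚ.+-identityʳ i)))
              ; i (suc j) ij → swap r i j (ℕₚ.suc-injective (trans (sym (ℕₚ.+-suc i j)) ij)) }
  ; f-deg = λ i lt → f-deg r i (ℕₚ.<-trans (ℕₚ.n<1+n e) lt)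
  ; g-deg = λ { (suc i) (s≤s lt) → g-deg r i lt }
  }

-- In degree 1 the reversal of t - 1 is 1 - t; this is the origin of the sign on the side of f.
Rev-δ : ∀ {e f g} → Rev e f g → Rev (suc e) (λ m → - δ f m) (δ g)
Rev-δ {e} {f} {g} r = record
  { swap  = λ i j ij → trans (flip (f i) (τ f i))
                              (cong₂ ℤ._-_ (τ-swap i j ij) (f-swap i j ij))
  ; f-deg = λ { (suc i) (s≤s lt) →
                  cong -_ (cong₂ ℤ._-_ (f-deg r (suc i) (ℕₚ.m<n⇒m<1+n lt)) (f-deg r i lt)) }
  ; g-deg = λ { (suc i) (s≤s lt) → cong₂ ℤ._-_ (g-deg r (suc i) (ℕₚ.m<n⇒m<1+n lt)) (g-deg r i lt) }
  }
  where
  flip : ∀ x y → - (x ℤ.- y) ≡ y ℤ.- x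
  flip = solve-∀
  τ-swap : ∀ i j → i + j ≡ suc e → τ f i ≡ g j
  τ-swap zero    j ij = sym (g-deg r j (ℕₚ.≤-reflexive (sym ij)))
  τ-swap (suc i) j ij = swap r i j (ℕₚ.suc-injective ij)
  f-swap : ∀ i j → i + j ≡ suc e → f i ≡ τ g j
  f-swap = swap (Rev-τ r)

Rev-zero : ∀ e {f g} → (∀ m → f m ≡ 0ℤ) → (∀ m → g m ≡ 0ℤ) → Rev e f g
Rev-zero e pf pg = record
  { swap = λ i j _ → trans (pf i) (sym (pg j)) ; f-deg = λ i _ → pf i ; g-deg = λ i _ → pg i }

Rev-one : ∀ {f g} → (∀ m → f m ≡ 1ℤ) → (∀ m → g m ≡ 1ℤ) → Rev 0 (δ f) (δ g)
Rev-one {f} {g} pf pg = record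
  { swap  = λ { zero zero _ → cong (ℤ._- 0ℤ) (trans (pf 0) (sym (pg 0))) }
  ; f-deg = λ { (suc i) _ → cong₂ ℤ._-_ (pf (suc i)) (pf i) }
  ; g-deg = λ { (suc i) _ → cong₂ ℤ._-_ (pg (suc i)) (pg i) }
  }

-- `hstarAux D E k j` is the partial sum over i ≤ j of (-1)^i C(D, i) E(k - i). Pascal's rule splits
-- the sum for D + 1 into the one for D minus its shift, which is multiplication by 1 - t.
hstarAux-suc : ∀ D E k j → j ≤ k →
  hstarAux (suc D) E (suc k) (suc j) ≡ hstarAux D E (suc k) (suc j) ℤ.- hstarAux D E k j
hstarAux-suc D E k zero j≤k
  rewrite sym (nCk+nC[k+1]≡[n+1]C[k+1] D 0) | ℤₚ.pos-+ (D C 0) (D C 1) =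
  rearrange (E (suc k)) (E k) (+ (D C 1))
  where
  rearrange : ∀ x y z → x ℤ.+ (- 1ℤ) ℤ.* (1ℤ ℤ.+ z) ℤ.* y
                      ≡ x ℤ.+ (- 1ℤ) ℤ.* z ℤ.* y ℤ.- y
  rearrange = solve-∀
hstarAux-suc D E (suc k) (suc j) (s≤s j≤k)
  rewrite hstarAux-suc D E (suc k) j (ℕₚ.m≤n⇒m≤1+n j≤k)
        | sym (nCk+nC[k+1]≡[n+1]C[k+1] D (suc j)) | ℤₚ.pos-+ (D C suc j) (D C suc (suc j)) =
  rearrange (hstarAux D E (suc (suc k)) (suc j)) (hstarAux D E (suc k) j)
            ((- 1ℤ) ℤ.^ j) (+ (D C suc j)) (+ (D C suc (suc j))) (E (k ∸ j))
  where
  rearrange : ∀ x y s b c e →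
    x ℤ.- y ℤ.+ (- 1ℤ) ℤ.* ((- 1ℤ) ℤ.* s) ℤ.* (b ℤ.+ c) ℤ.* e ≡
    x ℤ.+ (- 1ℤ) ℤ.* ((- 1ℤ) ℤ.* s) ℤ.* c ℤ.* e ℤ.- (y ℤ.+ ((- 1ℤ) ℤ.* s) ℤ.* b ℤ.* e)
  rearrange = solve-∀

hstarAux-zero : ∀ E k j → hstarAux 0 E k j ≡ E k
hstarAux-zero E k zero = refl
hstarAux-zero E zero (suc j) = hstarAux-zero E zero j
hstarAux-zero E (suc k) (suc j)
  rewrite hstarAux-zero E (suc k) j | k>n⇒nCk≡0 {0} {suc j} (s≤s z≤n) =
  drop (E (suc k)) ((- 1ℤ) ℤ.^ suc j) (E (k ∸ j))
  where
  drop : ∀ x s e → x ℤ.+ s ℤ.* 0ℤ ℤ.* e ≡ x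
  drop = solve-∀

hstarAux-δ^ : ∀ D E k → hstarAux D E k k ≡ δ^ D E k
hstarAux-δ^ zero    E k = hstarAux-zero E k k
hstarAux-δ^ (suc D) E zero = trans (hstarAux-δ^ D E zero) (sym (ℤₚ.+-identityʳ _))
hstarAux-δ^ (suc D) E (suc k) =
  trans (hstarAux-suc D E k k ℕₚ.≤-refl) (cong₂ ℤ._-_ (hstarAux-δ^ D E (suc k)) (hstarAux-δ^ D E k))

δ^-0 : ∀ k f → δ^ k f 0 ≡ f 0
δ^-0 zero    f = refl
δ^-0 (suc k) f = trans (ℤₚ.+-identityʳ _) (δ^-0 k f)

-- A polynomial f of degree ≤ d with f(t) = tᵈ f(1/t) / tʳ.
Rev-τ^⇒Palindromic : ∀ d r {f} → f 0 ≡ 1ℤ → Rev d f (τ^ r f) → Palindromic f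
Rev-τ^⇒Palindromic d r {f} f₀≡1 rev with r ℕ.≤? d
... | no r≰d = case trans (sym f₀≡1) (trans (swap rev 0 d refl) (τ^-< r f d (ℕₚ.≰⇒> r≰d))) of λ ()
... | yes r≤d = d ∸ r , (λ f≡0 → case trans (sym f₀≡1) (trans (symm 0 z≤n) f≡0) of λ ())
              , vanish , symm
  where
  symm : ∀ i → i ≤ d ∸ r → f i ≡ f (d ∸ r ∸ i)
  symm i i≤ = trans (swap rev i (r + (d ∸ r ∸ i)) eq) (τ^-+ r f (d ∸ r ∸ i))
    where
    open ≡-Reasoning
    eq : i + (r + (d ∸ r ∸ i)) ≡ d
    eq = begin
      i + (r + (d ∸ r ∸ i)) ≡⟨ ℕₚ.+-comm i _ ⟩
      r + (d ∸ r ∸ i) + i   ≡⟨ ℕₚ.+-assoc r _ i ⟩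
      r + (d ∸ r ∸ i + i)   ≡⟨ cong (r ℕ.+_) (ℕₚ.m∸n+n≡m i≤) ⟩
      r + (d ∸ r)           ≡⟨ ℕₚ.m+[n∸m]≡n r≤d ⟩
      d ∎
  vanish : ∀ k → d ∸ r < k → f k ≡ 0ℤ
  vanish k lt with k ℕ.≤? d
  ... | no k≰d = f-deg rev k (ℕₚ.≰⇒> k≰d)
  ... | yes k≤d = trans (swap rev k (d ∸ k) (ℕₚ.m+[n∸m]≡n k≤d))
    (τ^-< r f (d ∸ k) (ℕₚ.+-cancelʳ-< k (d ∸ k) r
      (subst (_< r + k) (sym (ℕₚ.m∸n+n≡m k≤d))
        (subst (_< r + k) (ℕₚ.m+[n∸m]≡n r≤d) (ℕₚ.+-monoʳ-< r lt)))))

-- Counting lattice points in boxes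

-- Induction on xs: the image of the head is cut out of ys, and by injectivity the images of the
-- tail survive. Equalities of counts come from one such injection in each direction.
length-≤-injection : ∀ {A B : Set} {xs : List A} {ys : List B} (f : A → B) → Unique xs →
  (∀ {x} → x ∈ xs → f x ∈ ys) → (∀ {x y} → x ∈ xs → y ∈ xs → f x ≡ f y → x ≡ y) →
  length xs ≤ length ys
length-≤-injection {xs = []} f uniq into inj = z≤n
length-≤-injection {xs = x ∷ xs} f (x∉xs ∷ uniq) into inj with ∈-∃++ (into (here refl))
... | as , bs , refl = ℕₚ.≤-trans (s≤s (length-≤-injection f uniq into′ λ p q → inj (there p) (there q)))
                                   (ℕₚ.≤-reflexive length-eq)
  where
  open ≡-Reasoning
  length-eq : suc (length (as ++ bs)) ≡ length (as ++ f x ∷ bs)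
  length-eq = begin
    suc (length (as ++ bs))         ≡⟨ cong suc (length-++ as) ⟩
    suc (length as + length bs)     ≡⟨ ℕₚ.+-suc (length as) (length bs) ⟨
    length as + suc (length bs)     ≡⟨ length-++ as ⟨
    length (as ++ f x ∷ bs)         ∎
  into′ : ∀ {y} → y ∈ xs → f y ∈ as ++ bs
  into′ {y} y∈ with ∈-++⁻ as (into (there y∈))
  ... | inj₁ p           = ∈-++⁺ˡ p
  ... | inj₂ (here eq)   = contradiction (sym (inj (there y∈) (here refl) eq)) (All.lookup x∉xs y∈)
  ... | inj₂ (there p)   = ∈-++⁺ʳ as p

length-filter-⊎ : ∀ {A : Set} {P Q R : A → Set}
  (P? : Decidable P) (Q? : Decidable Q) (R? : Decidable R) (xs : List A) →
  (∀ {x} → x ∈ xs → P x → Q x ⊎ R x) → (∀ {x} → x ∈ xs → Q x ⊎ R x → P x) →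
  (∀ {x} → Q x → ¬ R x) →
  length (filter P? xs) ≡ length (filter Q? xs) + length (filter R? xs)
length-filter-⊎ P? Q? R? [] to from disj = refl
length-filter-⊎ P? Q? R? (x ∷ xs) to from disj
  with ih ← length-filter-⊎ P? Q? R? xs (to ∘ there) (from ∘ there) disj | P? x | Q? x | R? x
... | yes p | yes q | yes r = contradiction r (disj q)
... | yes p | yes q | no ¬r = cong suc ih
... | yes p | no ¬q | yes r = trans (cong suc ih) (sym (ℕₚ.+-suc _ _))
... | yes p | no ¬q | no ¬r = case to (here refl) p of λ
  { (inj₁ q) → contradiction q ¬q ; (inj₂ r) → contradiction r ¬r }
... | no ¬p | yes q | _     = contradiction (from (here refl) (inj₁ q)) ¬p
... | no ¬p | no ¬q | yes r = contradiction (from (here refl) (inj₂ r)) ¬p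
... | no ¬p | no ¬q | no ¬r = ih

vecsUpTo : ∀ d → ℕ → List (Vec ℕ d)
vecsUpTo zero    m = [] ∷ []
vecsUpTo (suc d) m = cartesianProductWith _∷_ (upTo (suc m)) (vecsUpTo d m)

vecsUpTo-unique : ∀ d m → Unique (vecsUpTo d m)
vecsUpTo-unique zero    m = [] ∷ []
vecsUpTo-unique (suc d) m =
  Uniqueₚ.cartesianProductWith⁺ _∷_ (λ { refl → refl , refl })
    (Uniqueₚ.upTo⁺ (suc m)) (vecsUpTo-unique d m)

∈-vecsUpTo⁺ : ∀ {d m} (v : Vec ℕ d) → (∀ x → lookup v x ≤ m) → v ∈ vecsUpTo d m
∈-vecsUpTo⁺ [] _ = here refl
∈-vecsUpTo⁺ (a ∷ v) ≤m =
  ∈-cartesianProductWith⁺ _∷_ (∈-upTo⁺ (s≤s (≤m zero))) (∈-vecsUpTo⁺ v (≤m ∘ suc))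

∈-vecsUpTo⁻ : ∀ {d m} (v : Vec ℕ d) → v ∈ vecsUpTo d m → ∀ x → lookup v x ≤ m
∈-vecsUpTo⁻ {suc d} {m} (a ∷ v) v∈ x
  with ∈-cartesianProductWith⁻ _∷_ (upTo (suc m)) (vecsUpTo d m) v∈
∈-vecsUpTo⁻ (a ∷ v) v∈ zero    | _ , _ , a∈ , v∈′ , refl = ℕ.s≤s⁻¹ (∈-upTo⁻ a∈)
∈-vecsUpTo⁻ (a ∷ v) v∈ (suc x) | _ , _ , a∈ , v∈′ , refl = ∈-vecsUpTo⁻ v v∈′ x

lookup-injective : ∀ {A : Set} {d} (v w : Vec A d) → lookup v ≗ lookup w → v ≡ w
lookup-injective v w eq =
  trans (sym (tabulate∘lookup v)) (trans (tabulate-cong eq) (tabulate∘lookup w))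

module Counting {d : ℕ} where

  Fun : Set
  Fun = Fin d → ℕ

  -- Maps are listed as vectors, and tabulating a map returns it only up to pointwise equality,
  -- which the counted predicates must therefore respect.
  Resp : (Fun → Set) → Set
  Resp P = ∀ {f g} → f ≗ g → P f → P g

  count : {P : Fun → Set} → Decidable P → ℕ → ℕ
  count P? m = length (filter (λ v → P? (lookup v)) (vecsUpTo d m))

  count-≤ : ∀ {P Q : Fun → Set} (P? : Decidable P) (Q? : Decidable Q) m m′ → Resp Q →
    (F : Fun → Fun) →
    (∀ f → (∀ x → f x ≤ m) → P f → (∀ x → F f x ≤ m′) × Q (F f)) →
    (∀ f g → P f → P g → (∀ x → f x ≤ m) → (∀ x → g x ≤ m) → F f ≗ F g → f ≗ g) →
    count P? m ≤ count Q? m′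
  count-≤ P? Q? m m′ resp F into inj =
    length-≤-injection (tabulate ∘ F ∘ lookup)
      (Uniqueₚ.filter⁺ (λ v → P? (lookup v)) (vecsUpTo-unique d m)) into′ inj′
    where
    into′ : ∀ {v} → v ∈ filter (λ v → P? (lookup v)) (vecsUpTo d m) →
            tabulate (F (lookup v)) ∈ filter (λ v → Q? (lookup v)) (vecsUpTo d m′)
    into′ {v} v∈ =
      let v∈′ , Pv = ∈-filter⁻ (λ v → P? (lookup v)) {xs = vecsUpTo d m} v∈
          ≤m′ , QF = into (lookup v) (∈-vecsUpTo⁻ v v∈′) Pv
          eq       = lookup∘tabulate (F (lookup v))
      in ∈-filter⁺ (λ v → Q? (lookup v))
           (∈-vecsUpTo⁺ _ λ x → subst (_≤ m′) (sym (eq x)) (≤m′ x))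
           (resp (sym ∘ eq) QF)
    inj′ : ∀ {v w} → v ∈ filter (λ v → P? (lookup v)) (vecsUpTo d m) →
           w ∈ filter (λ v → P? (lookup v)) (vecsUpTo d m) →
           tabulate (F (lookup v)) ≡ tabulate (F (lookup w)) → v ≡ w
    inj′ {v} {w} v∈ w∈ eq =
      let v∈′ , Pv = ∈-filter⁻ (λ v → P? (lookup v)) {xs = vecsUpTo d m} v∈
          w∈′ , Pw = ∈-filter⁻ (λ v → P? (lookup v)) w∈
      in lookup-injective v w (inj (lookup v) (lookup w) Pv Pw (∈-vecsUpTo⁻ v v∈′) (∈-vecsUpTo⁻ w w∈′)
           λ x → trans (sym (lookup∘tabulate (F (lookup v)) x))
                   (trans (cong (λ u → lookup u x) eq) (lookup∘tabulate (F (lookup w)) x)))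

  count-⊎ : ∀ {P Q R : Fun → Set} (P? : Decidable P) (Q? : Decidable Q) (R? : Decidable R) m →
    (∀ f → (∀ x → f x ≤ m) → P f → Q f ⊎ R f) → (∀ f → (∀ x → f x ≤ m) → Q f ⊎ R f → P f) →
    (∀ f → Q f → ¬ R f) → count P? m ≡ count Q? m + count R? m
  count-⊎ P? Q? R? m to from disj = length-filter-⊎ _ _ _ (vecsUpTo d m)
    (λ v∈ → to _ (∈-vecsUpTo⁻ _ v∈)) (λ v∈ → from _ (∈-vecsUpTo⁻ _ v∈)) (disj _)

  count-≡0 : ∀ {P : Fun → Set} (P? : Decidable P) m →
    (∀ f → (∀ x → f x ≤ m) → ¬ P f) → count P? m ≡ 0
  count-≡0 P? m none = ℕₚ.n≤0⇒n≡0 (length-≤-injection {ys = []} id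
    (Uniqueₚ.filter⁺ _ (vecsUpTo-unique d m))
    (λ {v} v∈ → let v∈′ , Pv = ∈-filter⁻ (λ v → P? (lookup v)) {xs = vecsUpTo d m} v∈
                in contradiction Pv (none (lookup v) (∈-vecsUpTo⁻ v v∈′)))
    (λ _ _ → id))

  count-≡1 : ∀ {P : Fun → Set} (P? : Decidable P) m → Resp P →
    P (λ _ → m) → (∀ f → (∀ x → f x ≤ m) → P f → ∀ x → f x ≡ m) → count P? m ≡ 1
  count-≡1 {P} P? m resp Pm all-m = ℕₚ.≤-antisym
    (length-≤-injection {ys = const ∷ []} id
      (Uniqueₚ.filter⁺ _ (vecsUpTo-unique d m))
      (λ {v} v∈ → here (lookup-injective v const λ x →
          let v∈′ , Pv = ∈-filter⁻ (λ v → P? (lookup v)) {xs = vecsUpTo d m} v∈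
          in trans (all-m _ (∈-vecsUpTo⁻ v v∈′) Pv x) (sym (const-m x))))
      (λ _ _ → id))
    (length-≤-injection {xs = const ∷ []} id ([] ∷ [])
      (λ { (here refl) → ∈-filter⁺ (λ v → P? (lookup v))
             (∈-vecsUpTo⁺ const (ℕₚ.≤-reflexive ∘ const-m))
             (resp (sym ∘ const-m) Pm) })
      (λ _ _ → id))
    where
    const : Vec ℕ d
    const = tabulate (λ _ → m)
    const-m : ∀ x → lookup const x ≡ m
    const-m = lookup∘tabulate _

x∉p-x : ∀ {n} (p : Subset n) x → x ∉ˢ (p ─₁ x)
x∉p-x (inside  ∷ p) zero    ()
x∉p-x (outside ∷ p) zero    ()
x∉p-x (inside  ∷ p) (suc x) (there x∈) = x∉p-x p x x∈
x∉p-x (outside ∷ p) (suc x) (there x∈) = x∉p-x p x x∈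

∣p-x∣ : ∀ {n} (p : Subset n) {x} → x ∈ˢ p → ∣ p ∣ ≡ suc ∣ p ─₁ x ∣
∣p-x∣ (inside ∷ p) here = cong (suc ∘ ∣_∣) (sym (Subsetₚ.p─⊥≡p p))
∣p-x∣ (inside ∷ p) (there x∈) = cong suc (∣p-x∣ p x∈)
∣p-x∣ (outside ∷ p) (there x∈) = ∣p-x∣ p x∈

-- Reciprocity for order polytopes of graded posets

-- `_⋖_` holds generating relations rather than the whole order. By `up` and `down` every maximal
-- chain runs from rank 1 to rank `height`, and `top` makes the height of the empty poset 0.
record GradedPoset (d : ℕ) : Set₁ where
  infix 4 _⋖_ _⋖?_
  field
    _⋖_      : Fin d → Fin d → Set
    _⋖?_     : ∀ x y → Dec (x ⋖ y)
    rank     : Fin d → ℕ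
    height   : ℕ
    rank-⋖   : ∀ {x y} → x ⋖ y → rank y ≡ suc (rank x)
    rank-pos : ∀ x → 1 ≤ rank x
    rank-≤   : ∀ x → rank x ≤ height
    up       : ∀ x → rank x < height → ∃[ y ] x ⋖ y
    down     : ∀ x → 1 < rank x → ∃[ y ] y ⋖ x
    top      : height ≡ 0 ⊎ ∃[ x ] rank x ≡ height

module OrderPolytope {d : ℕ} (P : GradedPoset d) where
  open GradedPoset P
  open Counting {d}

  Weak : Fun → Set
  Weak f = ∀ x y → x ⋖ y → f x ≤ f y

  -- Maps on an ideal are stored as maps on the whole poset, so that the counts for all ideals take
  -- place in one box. The filling value m is the greatest one, so a weak map stays weak.
  Off : Subset d → ℕ → Fun → Set
  Off I m f = ∀ x → x ∉ˢ I → f x ≡ m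

  -- Order preserving maps I → [0, m], taking a value < m on K; they are extended by m outside I.
  WeakOn : Subset d → List (Fin d) → ℕ → Fun → Set
  WeakOn I K m f = Weak f × Off I m f × All (λ x → f x < m) K

  -- Strictly order preserving maps I → [1, m], extended by m outside I.
  StrictOn : Subset d → ℕ → Fun → Set
  StrictOn I m f = (∀ x → x ∈ˢ I → 1 ≤ f x) × (∀ x y → x ⋖ y → y ∈ˢ I → f x < f y) × Off I m f

  -- Those taking the value m on I only at elements of K.
  StrictIn : Subset d → List (Fin d) → ℕ → Fun → Set
  StrictIn I K m f = StrictOn I m f × (∀ x → x ∈ˢ I → x ∉ K → f x < m) × 1 ≤ m

  Weak? : Decidable Weak
  Weak? f = all? λ x → all? λ y → (x ⋖? y) →-dec (f x ℕ.≤? f y)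

  Off? : ∀ I m → Decidable (Off I m)
  Off? I m f = all? λ x → ¬? (x Subsetₚ.∈? I) →-dec (f x ℕ.≟ m)

  WeakOn? : ∀ I K m → Decidable (WeakOn I K m)
  WeakOn? I K m f = Weak? f ×-dec Off? I m f ×-dec All.all? (λ x → f x ℕ.<? m) K

  StrictOn? : ∀ I m → Decidable (StrictOn I m)
  StrictOn? I m f =
    (all? λ x → (x Subsetₚ.∈? I) →-dec (1 ℕ.≤? f x)) ×-dec
    (all? λ x → all? λ y → (x ⋖? y) →-dec ((y Subsetₚ.∈? I) →-dec (f x ℕ.<? f y))) ×-dec
    Off? I m f

  StrictIn? : ∀ I K m → Decidable (StrictIn I K m)
  StrictIn? I K m f =
    StrictOn? I m f ×-dec
    (all? λ x → (x Subsetₚ.∈? I) →-dec (¬? (mem? Finₚ._≟_ x K) →-dec (f x ℕ.<? m))) ×-dec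
    (1 ℕ.≤? m)

  Weak-resp : Resp Weak
  Weak-resp eq w x y x⋖y = subst₂ _≤_ (eq x) (eq y) (w x y x⋖y)

  Off-resp : ∀ {I m} → Resp (Off I m)
  Off-resp eq off x x∉ = trans (sym (eq x)) (off x x∉)

  WeakOn-resp : ∀ {I K m} → Resp (WeakOn I K m)
  WeakOn-resp eq (w , off , lt) =
    Weak-resp eq w , Off-resp eq off , All.map (λ {x} → subst (_< _) (eq x)) lt

  StrictOn-resp : ∀ {I m} → Resp (StrictOn I m)
  StrictOn-resp eq (pos , st , off) =
    (λ x x∈ → subst (1 ≤_) (eq x) (pos x x∈)) ,
    (λ x y x⋖y y∈ → subst₂ _<_ (eq x) (eq y) (st x y x⋖y y∈)) , Off-resp eq off

  StrictIn-resp : ∀ {I K m} → Resp (StrictIn I K m)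
  StrictIn-resp eq (st , lt , m≥1) =
    StrictOn-resp eq st , (λ x x∈ x∉ → subst (_< _) (eq x) (lt x x∈ x∉)) , m≥1

  W : Subset d → List (Fin d) → Seq
  W I K m = + count (WeakOn? I K m) m

  S : Subset d → Seq
  S I m = + count (StrictOn? I m) m

  H : Subset d → List (Fin d) → Seq
  H I K m = + count (StrictIn? I K m) m

  Ideal : Subset d → Set
  Ideal I = ∀ x y → x ⋖ y → y ∈ˢ I → x ∈ˢ I

  Maximal : Subset d → Fin d → Set
  Maximal I x = x ∈ˢ I × (∀ y → y ∈ˢ I → ¬ (x ⋖ y))

  Maximal? : ∀ I → Decidable (Maximal I)
  Maximal? I x = (x Subsetₚ.∈? I) ×-dec all? λ y → (y Subsetₚ.∈? I) →-dec ¬? (x ⋖? y)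

  ⋖-irrefl : ∀ {x} → ¬ (x ⋖ x)
  ⋖-irrefl {x} x⋖x = ℕₚ.1+n≢n (sym (rank-⋖ x⋖x))

  ideal-remove : ∀ {I x} → Ideal I → Maximal I x → Ideal (I ─₁ x)
  ideal-remove {I} {x} id-I (x∈I , max) z y z⋖y y∈ =
    Subsetₚ.x∈p∧x≢y⇒x∈p-y (id-I z y z⋖y y∈I) λ { refl → max y y∈I z⋖y }
    where y∈I = Subsetₚ.p─q⊆p I _ y∈

  maximal-remove : ∀ {I x y} → y ≢ x → Maximal I y → Maximal (I ─₁ x) y
  maximal-remove y≢x (y∈I , max) =
    Subsetₚ.x∈p∧x≢y⇒x∈p-y y∈I y≢x , λ z z∈ → max z (Subsetₚ.p─q⊆p _ _ z∈)

  maximal-or-below : ∀ I x → x ∈ˢ I → Maximal I x ⊎ (∃[ y ] (y ∈ˢ I × x ⋖ y))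
  maximal-or-below I x x∈I with any? (λ y → (y Subsetₚ.∈? I) ×-dec (x ⋖? y))
  ... | yes (y , y∈ , x⋖y) = inj₂ (y , y∈ , x⋖y)
  ... | no none = inj₁ (x∈I , λ y y∈ x⋖y → none (y , y∈ , x⋖y))

  -- Induction downwards from the maximal elements. The fuel k bounds the number of steps up, as
  -- each step raises the rank and no rank exceeds `height`.
  climb : ∀ I (Q : Fin d → Set) → (∀ x → Maximal I x → Q x) →
    (∀ x y → x ⋖ y → Q y → Q x) → ∀ x → x ∈ˢ I → Q x
  climb I Q max step x = go height x (ℕₚ.m≤n+m height (rank x))
    where
    go : ∀ k x → height ≤ rank x + k → x ∈ˢ I → Q x
    go k x h≤ x∈ with maximal-or-below I x x∈
    ... | inj₁ mx = max x mx
    go zero x h≤ x∈ | inj₂ (y , y∈ , x⋖y) = contradiction (rank-≤ y)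
      (ℕₚ.<⇒≱ (subst (height <_) (sym (rank-⋖ x⋖y)) (s≤s (subst (height ≤_) (ℕₚ.+-identityʳ _) h≤))))
    go (suc k) x h≤ x∈ | inj₂ (y , y∈ , x⋖y) = step x y x⋖y
      (go k y (subst (height ≤_) (trans (ℕₚ.+-suc _ k) (cong (_+ k) (sym (rank-⋖ x⋖y)))) h≤) y∈)

  exists-maximal : ∀ I x → x ∈ˢ I → ∃ (Maximal I)
  exists-maximal I = climb I (λ _ → ∃ (Maximal I)) (λ x mx → x , mx) (λ _ _ _ → id)

  maxima : Subset d → List (Fin d)
  maxima I = filter (Maximal? I) (allFin d)

  maxima-unique : ∀ I → Unique (maxima I)
  maxima-unique I = Uniqueₚ.filter⁺ (Maximal? I) (Uniqueₚ.allFin⁺ d)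

  maxima-maximal : ∀ I → All (Maximal I) (maxima I)
  maxima-maximal I = All.tabulate λ x∈ → proj₂ (∈-filter⁻ (Maximal? I) {xs = allFin d} x∈)

  ∈-maxima : ∀ I {x} → Maximal I x → x ∈ maxima I
  ∈-maxima I {x} = ∈-filter⁺ (Maximal? I) (∈-allFin x)

  W-split : ∀ I K x m → W I K m ≡ W I (x ∷ K) m ℤ.+ W (I ─₁ x) K m
  W-split I K x m = cong +_ (count-⊎ (WeakOn? I K m) (WeakOn? I (x ∷ K) m) (WeakOn? (I ─₁ x) K m) m
    to from λ { f (_ , _ , fx<m ∷ _) (_ , off , _) → ℕₚ.<⇒≢ fx<m (off x (x∉p-x I x)) })
    where
    to : ∀ f → (∀ y → f y ≤ m) → WeakOn I K m f → WeakOn I (x ∷ K) m f ⊎ WeakOn (I ─₁ x) K m f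
    to f ≤m (w , off , lt) with f x ℕ.<? m
    ... | yes fx<m = inj₁ (w , off , fx<m ∷ lt)
    ... | no fx≮m = inj₂ (w , off′ , lt)
      where
      off′ : Off (I ─₁ x) m f
      off′ y y∉ with y Finₚ.≟ x
      ... | yes refl = ℕₚ.≤-antisym (≤m x) (ℕₚ.≮⇒≥ fx≮m)
      ... | no y≢x = off y λ y∈ → y∉ (Subsetₚ.x∈p∧x≢y⇒x∈p-y y∈ y≢x)
    from : ∀ f → (∀ y → f y ≤ m) → WeakOn I (x ∷ K) m f ⊎ WeakOn (I ─₁ x) K m f → WeakOn I K m f
    from f ≤m (inj₁ (w , off , _ ∷ lt)) = w , off , lt
    from f ≤m (inj₂ (w , off , lt)) = w , (λ y y∉ → off y (y∉ ∘ Subsetₚ.p─q⊆p I _)) , lt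

  H-split : ∀ I K x m → Ideal I → Maximal I x → All (Maximal I) K → x ∉ K →
    H I (x ∷ K) m ≡ H I K m ℤ.+ H (I ─₁ x) K m
  H-split I K x m id-I max-x max-K x∉K = cong +_ (count-⊎ (StrictIn? I (x ∷ K) m) (StrictIn? I K m)
    (StrictIn? (I ─₁ x) K m) m to from disj)
    where
    p─x⊆p : ∀ {y} → y ∈ˢ (I ─₁ x) → y ∈ˢ I
    p─x⊆p = Subsetₚ.p─q⊆p I _
    disj : ∀ f → StrictIn I K m f → ¬ StrictIn (I ─₁ x) K m f
    disj f (_ , lt , _) ((_ , _ , off) , _) =
      ℕₚ.<⇒≢ (lt x (proj₁ max-x) x∉K) (off x (x∉p-x I x))
    to : ∀ f → (∀ y → f y ≤ m) → StrictIn I (x ∷ K) m f → StrictIn I K m f ⊎ StrictIn (I ─₁ x) K m f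
    to f ≤m ((pos , st , off) , lt , m≥1) with f x ℕ.<? m
    ... | yes fx<m = inj₁ ((pos , st , off) , lt′ , m≥1)
      where
      lt′ : ∀ y → y ∈ˢ I → y ∉ K → f y < m
      lt′ y y∈ y∉K with y Finₚ.≟ x
      ... | yes refl = fx<m
      ... | no y≢x = lt y y∈ λ { (here e) → y≢x e ; (there y∈K) → y∉K y∈K }
    ... | no fx≮m = inj₂ (((λ y → pos y ∘ p─x⊆p) , (λ y z y⋖z → st y z y⋖z ∘ p─x⊆p) , off′) , lt′ , m≥1)
      where
      off′ : Off (I ─₁ x) m f
      off′ y y∉ with y Finₚ.≟ x
      ... | yes refl = ℕₚ.≤-antisym (≤m x) (ℕₚ.≮⇒≥ fx≮m)
      ... | no y≢x = off y λ y∈ → y∉ (Subsetₚ.x∈p∧x≢y⇒x∈p-y y∈ y≢x)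
      lt′ : ∀ y → y ∈ˢ (I ─₁ x) → y ∉ K → f y < m
      lt′ y y∈ y∉K = lt y (p─x⊆p y∈) λ { (here refl) → x∉p-x I x y∈ ; (there y∈K) → y∉K y∈K }
    from : ∀ f → (∀ y → f y ≤ m) → StrictIn I K m f ⊎ StrictIn (I ─₁ x) K m f → StrictIn I (x ∷ K) m f
    from f ≤m (inj₁ (st , lt , m≥1)) = st , (λ y y∈ y∉ → lt y y∈ (y∉ ∘ there)) , m≥1
    from f ≤m (inj₂ ((pos , st , off) , lt , m≥1)) =
      (pos′ , st′ , λ y y∉ → off y (y∉ ∘ p─x⊆p)) , lt′ , m≥1
      where
      fx≡m = off x (x∉p-x I x)
      pos′ : ∀ y → y ∈ˢ I → 1 ≤ f y
      pos′ y y∈ with y Finₚ.≟ x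
      ... | yes refl = subst (1 ≤_) (sym fx≡m) m≥1
      ... | no y≢x = pos y (Subsetₚ.x∈p∧x≢y⇒x∈p-y y∈ y≢x)
      st′ : ∀ z y → z ⋖ y → y ∈ˢ I → f z < f y
      st′ z y z⋖y y∈ with y Finₚ.≟ x
      ... | no y≢x = st z y z⋖y (Subsetₚ.x∈p∧x≢y⇒x∈p-y y∈ y≢x)
      -- As z lies below x it is not maximal, hence not in K, and its value is already less than m =
      -- f x.
      ... | yes refl = subst (f z <_) (sym fx≡m)
        (lt z (Subsetₚ.x∈p∧x≢y⇒x∈p-y (id-I z y z⋖y y∈) λ { refl → ⋖-irrefl z⋖y })
          λ z∈K → proj₂ (All.lookup max-K z∈K) y y∈ z⋖y)
      lt′ : ∀ y → y ∈ˢ I → y ∉ x ∷ K → f y < m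
      lt′ y y∈ y∉ = lt y (Subsetₚ.x∈p∧x≢y⇒x∈p-y y∈ (y∉ ∘ here)) (y∉ ∘ there)

  extend : Subset d → ℕ → Fun → Fun
  extend I m f x with x Subsetₚ.∈? I
  ... | yes _ = f x
  ... | no  _ = m

  extend-∈ : ∀ {I m f x} → x ∈ˢ I → extend I m f x ≡ f x
  extend-∈ {I} {x = x} x∈ with x Subsetₚ.∈? I
  ... | yes _ = refl
  ... | no x∉ = contradiction x∈ x∉

  extend-∉ : ∀ {I m f x} → x ∉ˢ I → extend I m f x ≡ m
  extend-∉ {I} {x = x} x∉ with x Subsetₚ.∈? I
  ... | yes x∈ = contradiction x∈ x∉
  ... | no _ = refl

  extend-≤ : ∀ I m f → (∀ x → f x ≤ m) → ∀ x → extend I m f x ≤ m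
  extend-≤ I m f ≤m x with x Subsetₚ.∈? I
  ... | yes _ = ≤m x
  ... | no  _ = ℕₚ.≤-refl

  clamp-injective : ∀ I m f g → Off I (suc m) f → Off I (suc m) g →
    (∀ x → x ∈ˢ I → f x < suc m) → (∀ x → x ∈ˢ I → g x < suc m) →
    (λ x → f x ℕ.⊓ m) ≗ (λ x → g x ℕ.⊓ m) → f ≗ g
  clamp-injective I m f g off-f off-g f≤ g≤ eq x with x Subsetₚ.∈? I
  ... | no x∉ = trans (off-f x x∉) (sym (off-g x x∉))
  ... | yes x∈ = trans (sym (ℕₚ.m≤n⇒m⊓n≡m (ℕ.s≤s⁻¹ (f≤ x x∈))))
                   (trans (eq x) (ℕₚ.m≤n⇒m⊓n≡m (ℕ.s≤s⁻¹ (g≤ x x∈))))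

  extend-injective : ∀ I m m′ f g → Off I m f → Off I m g →
    extend I m′ f ≗ extend I m′ g → f ≗ g
  extend-injective I m m′ f g off-f off-g eq x with x Subsetₚ.∈? I
  ... | no x∉ = trans (off-f x x∉) (sym (off-g x x∉))
  ... | yes x∈ = trans (sym (extend-∈ x∈)) (trans (eq x) (extend-∈ x∈))

  clamp-off : ∀ {m n} → n ≡ suc m → n ℕ.⊓ m ≡ m
  clamp-off {m} refl = ℕₚ.m≥n⇒m⊓n≡n (ℕₚ.n≤1+n m)

  -- A bound on the maximal elements is a bound on all of I, so the values on I lie in [0, m - 1]
  -- and only the filling value changes between m and m - 1. For empty I the constant map would be
  -- counted at m = 0, hence the witness x.
  W-maxima : ∀ I x → Ideal I → x ∈ˢ I → W I (maxima I) ≗ τ (W I [])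
  W-maxima I x id-I x∈I m = by-cases m
    where
    below : ∀ {f m} → WeakOn I (maxima I) m f → ∀ y → y ∈ˢ I → f y < m
    below {f} {m} (w , _ , lt) = climb I (λ y → f y < m)
      (λ y mx → All.lookup lt (∈-maxima I mx)) (λ y z y⋖z → ℕₚ.≤-<-trans (w y z y⋖z))
    by-cases : ∀ m → W I (maxima I) m ≡ τ (W I []) m
    by-cases zero = cong +_ (count-≡0 (WeakOn? I (maxima I) 0) 0 λ f _ p → ℕₚ.n≮0 (below p x x∈I))
    by-cases (suc m) = cong +_ (ℕₚ.≤-antisym
      (count-≤ (WeakOn? I (maxima I) (suc m)) (WeakOn? I [] m) (suc m) m WeakOn-resp (λ f y → f y ℕ.⊓ m)
        (λ f _ (w , off , _) → (λ y → ℕₚ.m⊓n≤n (f y) m) ,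
          (λ y z y⋖z → ℕₚ.⊓-monoˡ-≤ m (w y z y⋖z)) , (λ y → clamp-off ∘ off y) , [])
        λ f g p q _ _ → clamp-injective I m f g (proj₁ (proj₂ p)) (proj₁ (proj₂ q)) (below p) (below q))
      (count-≤ (WeakOn? I [] m) (WeakOn? I (maxima I) (suc m)) m (suc m) WeakOn-resp (extend I (suc m))
        (λ f ≤m (w , _ , _) → extend-≤ I (suc m) f (ℕₚ.m≤n⇒m≤1+n ∘ ≤m) ,
          weak f ≤m w , (λ y → extend-∉) ,
          All.map (λ (y∈ , _) → s≤s (subst (_≤ m) (sym (extend-∈ y∈)) (≤m _))) (maxima-maximal I))
        λ f g p q _ _ → extend-injective I m (suc m) f g (proj₁ (proj₂ p)) (proj₁ (proj₂ q))))
      where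
      weak : ∀ f → (∀ y → f y ≤ m) → Weak f → Weak (extend I (suc m) f)
      weak f ≤m w y z y⋖z with z Subsetₚ.∈? I
      ... | no z∉ = extend-≤ I (suc m) f (ℕₚ.m≤n⇒m≤1+n ∘ ≤m) y
      ... | yes z∈ = subst (_≤ f z) (sym (extend-∈ (id-I y z y⋖z z∈))) (w y z y⋖z)

  -- The shift of `W-maxima` for strict maps. The clause `1 ≤ m` of `StrictIn` makes the count at m
  -- = 0 vanish for empty I too, as the factor t demands.
  H-[] : ∀ I → Ideal I → H I [] ≗ τ (S I)
  H-[] I id-I zero = cong +_ (count-≡0 (StrictIn? I [] 0) 0 λ f _ (_ , _ , m≥1) → ℕₚ.n≮0 m≥1)
  H-[] I id-I (suc m) = cong +_ (ℕₚ.≤-antisym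
    (count-≤ (StrictIn? I [] (suc m)) (StrictOn? I m) (suc m) m StrictOn-resp (λ f y → f y ℕ.⊓ m)
      (λ f _ ((pos , st , off) , lt , _) → (λ y → ℕₚ.m⊓n≤n (f y) m) ,
        (λ y y∈ → subst (1 ≤_) (sym (small lt y∈)) (pos y y∈)) ,
        (λ y z y⋖z z∈ → subst₂ _<_ (sym (small lt (id-I y z y⋖z z∈))) (sym (small lt z∈)) (st y z y⋖z z∈)) ,
        (λ y → clamp-off ∘ off y))
      λ f g ((_ , _ , off-f) , lt-f , _) ((_ , _ , off-g) , lt-g , _) _ _ →
        clamp-injective I m f g off-f off-g (λ y y∈ → lt-f y y∈ λ ()) (λ y y∈ → lt-g y y∈ λ ()))
    (count-≤ (StrictOn? I m) (StrictIn? I [] (suc m)) m (suc m) StrictIn-resp (extend I (suc m))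
      (λ f ≤m (pos , st , off) → extend-≤ I (suc m) f (ℕₚ.m≤n⇒m≤1+n ∘ ≤m) ,
        ((λ y y∈ → subst (1 ≤_) (sym (extend-∈ y∈)) (pos y y∈)) ,
         (λ y z y⋖z z∈ → subst₂ _<_ (sym (extend-∈ (id-I y z y⋖z z∈))) (sym (extend-∈ z∈)) (st y z y⋖z z∈)) ,
         (λ y → extend-∉)) ,
        (λ y y∈ _ → s≤s (subst (_≤ m) (sym (extend-∈ y∈)) (≤m y))) , s≤s z≤n)
      λ f g (_ , _ , off-f) (_ , _ , off-g) _ _ → extend-injective I m (suc m) f g off-f off-g))
    where
    small : ∀ {f : Fun} → (∀ x → x ∈ˢ I → x ∉ [] → f x < suc m) → ∀ {y} → y ∈ˢ I → f y ℕ.⊓ m ≡ f y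
    small lt {y} y∈ = ℕₚ.m≤n⇒m⊓n≡m (ℕ.s≤s⁻¹ (lt y y∈ λ ()))

  -- A strict map can reach the greatest value m only at maximal elements; its value at x shows that
  -- m is positive.
  H-maxima : ∀ I x → x ∈ˢ I → H I (maxima I) ≗ S I
  H-maxima I x x∈I m = cong +_ (ℕₚ.≤-antisym
    (count-≤ (StrictIn? I (maxima I) m) (StrictOn? I m) m m StrictOn-resp id
      (λ f ≤m (st , _) → ≤m , st) (λ _ _ _ _ _ _ → id))
    (count-≤ (StrictOn? I m) (StrictIn? I (maxima I) m) m m StrictIn-resp id
      (λ f ≤m st → ≤m , st , lt f ≤m st , ℕₚ.≤-trans (proj₁ st x x∈I) (≤m x)) (λ _ _ _ _ _ _ → id)))
    where
    lt : ∀ f → (∀ y → f y ≤ m) → StrictOn I m f → ∀ y → y ∈ˢ I → y ∉ maxima I → f y < m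
    lt f ≤m (_ , st , _) y y∈ y∉ with maximal-or-below I y y∈
    ... | inj₁ mx = contradiction (∈-maxima I mx) y∉
    ... | inj₂ (z , z∈ , y⋖z) = ℕₚ.<-≤-trans (st y z y⋖z z∈) (≤m z)

  ReciprocalOn : ℕ → Subset d → Set
  ReciprocalOn n I = Rev n (δ^ (suc n) (W I [])) (δ^ (suc n) (S I))

  -- Both differences count maps taking the value m somewhere on K. For K = `maxima I` they are 1 -
  -- t times the series of `ReciprocalOn`, whence the exponent n in place of n + 1.
  ReciprocalIn : ℕ → Subset d → List (Fin d) → Set
  ReciprocalIn n I K = Rev n (δ^ n (λ m → W I [] m ℤ.- W I K m)) (δ^ n (λ m → H I K m ℤ.- H I [] m))

  reciprocity-empty : ∀ I → (∀ x → x ∉ˢ I) → ReciprocalOn 0 I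
  reciprocity-empty I empty = Rev-one
    (λ m → cong +_ (count-≡1 (WeakOn? I [] m) m WeakOn-resp
      ((λ _ _ _ → ℕₚ.≤-refl) , (λ _ _ → refl) , []) λ f _ (_ , off , _) x → off x (empty x)))
    (λ m → cong +_ (count-≡1 (StrictOn? I m) m StrictOn-resp
      ((λ x x∈ → contradiction x∈ (empty x)) , (λ x y _ y∈ → contradiction y∈ (empty y)) , λ _ _ → refl)
      λ f _ (_ , _ , off) x → off x (empty x)))

  -- Adding a maximal element x to K moves the maps with value m at x, which are maps on I - x.
  mutual
    reciprocity : ∀ n I → Ideal I → ∣ I ∣ ≡ n → ReciprocalOn n I
    reciprocity n I id-I size with Subsetₚ.nonempty? I
    reciprocity zero I id-I size | no empty = reciprocity-empty I λ x x∈ → empty (x , x∈)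
    reciprocity (suc n) I id-I size | no empty =
      case trans (sym size) (trans (cong ∣_∣ (Subsetₚ.Empty-unique empty)) (Subsetₚ.∣⊥∣≡0 d)) of λ ()
    reciprocity n I id-I size | yes (x , x∈) =
      Rev-cong (δ-form (W I []) λ m → cong (λ z → W I [] m ℤ.- z) (sym (W-maxima I x id-I x∈ m)))
               (δ-form (S I) λ m → cong₂ ℤ._-_ (sym (H-maxima I x x∈ m)) (sym (H-[] I id-I m)))
               (reciprocityK n I (maxima I) id-I size (maxima-unique I) (maxima-maximal I))
      where
      δ-form : ∀ f {g} → δ f ≗ g → δ^ (suc n) f ≗ δ^ n g
      δ-form f eq m = trans (sym (δ^-δ n f m)) (δ^-cong n eq m)

    reciprocityK : ∀ n I K → Ideal I → ∣ I ∣ ≡ n → Unique K → All (Maximal I) K → ReciprocalIn n I K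
    reciprocityK n I [] id-I size _ _ =
      Rev-cong (δ^-cong n λ m → ℤₚ.+-inverseʳ (W I [] m)) (δ^-cong n λ m → ℤₚ.+-inverseʳ (H I [] m))
        (Rev-zero n (δ^-zero n) (δ^-zero n))
      where
      δ^-zero : ∀ n m → δ^ n (λ _ → 0ℤ) m ≡ 0ℤ
      δ^-zero zero    m       = refl
      δ^-zero (suc n) zero    = cong (ℤ._- 0ℤ) (δ^-zero n 0)
      δ^-zero (suc n) (suc m) = cong₂ ℤ._-_ (δ^-zero n (suc m)) (δ^-zero n m)
    reciprocityK zero I (x ∷ K) id-I size _ (mx ∷ _) =
      case trans (sym size) (∣p-x∣ I (proj₁ mx)) of λ ()
    reciprocityK (suc n) I (x ∷ K) id-I size (x∉K ∷ uniq) (mx ∷ max) =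
      Rev-+ (δ^-+ (suc n) (W I [] -ˢ W I K) (W I′ K) W-eq)
            (δ^-+ (suc n) (H I K -ˢ H I []) (H I′ K) H-eq)
        (reciprocityK (suc n) I K id-I size uniq max)
        -- These are the maps with value m at x, expressed on I′. The sign produced by `Rev-δ` is
        -- that of the inner difference in `W′-eq`.
        (Rev-+ (δ^-minus (suc n) (W I′ []) (W I′ [] -ˢ W I′ K) W′-eq)
               (λ m → trans (δ^-+ (suc n) (τ (S I′)) (H I′ K -ˢ H I′ []) H′-eq m)
                            (cong (ℤ._+ δ^ (suc n) (H I′ K -ˢ H I′ []) m) (δ^-τ (suc n) (S I′) m)))
          (Rev-τ (reciprocity n I′ id-I′ size′))
          (Rev-δ (reciprocityK n I′ K id-I′ size′ uniq max′)))
      where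
      I′ = I ─₁ x
      id-I′ = ideal-remove id-I mx
      size′ : ∣ I′ ∣ ≡ n
      size′ = ℕₚ.suc-injective (trans (sym (∣p-x∣ I (proj₁ mx))) size)
      max′ : All (Maximal I′) K
      max′ = All.tabulate λ y∈ → maximal-remove (λ { refl → All.lookup x∉K y∈ refl }) (All.lookup max y∈)
      _-ˢ_ : Seq → Seq → Seq
      (f -ˢ g) m = f m ℤ.- g m
      W-eq : ∀ m → W I [] m ℤ.- W I (x ∷ K) m ≡ (W I [] m ℤ.- W I K m) ℤ.+ W I′ K m
      W-eq m rewrite W-split I K x m = arith (W I [] m) (W I (x ∷ K) m) (W I′ K m)
        where
        arith : ∀ a b c → a ℤ.- b ≡ (a ℤ.- (b ℤ.+ c)) ℤ.+ c
        arith = solve-∀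
      H-eq : ∀ m → H I (x ∷ K) m ℤ.- H I [] m ≡ (H I K m ℤ.- H I [] m) ℤ.+ H I′ K m
      H-eq m rewrite H-split I K x m id-I mx max (λ x∈ → All.lookup x∉K x∈ refl) =
        arith (H I K m) (H I′ K m) (H I [] m)
        where
        arith : ∀ a b c → a ℤ.+ b ℤ.- c ≡ (a ℤ.- c) ℤ.+ b
        arith = solve-∀
      W′-eq : ∀ m → W I′ K m ≡ W I′ [] m ℤ.- (W I′ [] m ℤ.- W I′ K m)
      W′-eq m = arith (W I′ [] m) (W I′ K m)
        where
        arith : ∀ a b → b ≡ a ℤ.- (a ℤ.- b)
        arith = solve-∀
      H′-eq : ∀ m → H I′ K m ≡ τ (S I′) m ℤ.+ (H I′ K m ℤ.- H I′ [] m)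
      H′-eq m rewrite sym (H-[] I′ id-I′ m) = arith (H I′ [] m) (H I′ K m)
        where
        arith : ∀ a b → b ≡ a ℤ.+ (b ℤ.- a)
        arith = solve-∀

-- Symmetry of the numerator for graded posets

module Palindromicity {d : ℕ} (P : GradedPoset d) where
  open GradedPoset P
  open Counting {d}
  open OrderPolytope P

  Ω : ℕ → ℕ
  Ω = count Weak?

  W-⊤ : ∀ m → W Subset.⊤ [] m ≡ + Ω m
  W-⊤ m = cong +_ (ℕₚ.≤-antisym
    (count-≤ (WeakOn? Subset.⊤ [] m) Weak? m m Weak-resp id
      (λ f ≤m (w , _) → ≤m , w) (λ _ _ _ _ _ _ → id))
    (count-≤ Weak? (WeakOn? Subset.⊤ [] m) m m WeakOn-resp id
      (λ f ≤m w → ≤m , w , (λ x x∉ → contradiction Subsetₚ.∈⊤ x∉) , []) (λ _ _ _ _ _ _ → id)))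

  Ω-0 : Ω 0 ≡ 1
  Ω-0 = count-≡1 Weak? 0 Weak-resp (λ _ _ _ → z≤n) λ f ≤0 _ x → ℕₚ.n≤0⇒n≡0 (≤0 x)

  Strict : ℕ → Fun → Set
  Strict = StrictOn Subset.⊤

  -- A chain leads from x down to rank 1; along it f drops by at least one at each step and stays
  -- positive.
  rank-≤-strict : ∀ m f → Strict m f → ∀ x → rank x ≤ f x
  rank-≤-strict m f (pos , st , _) x = go (rank x) x refl
    where
    go : ∀ r x → rank x ≡ r → r ≤ f x
    go zero          x _ = z≤n
    go (suc zero)    x _ = pos x Subsetₚ.∈⊤
    go (suc (suc r)) x eq =
      let y , y⋖x = down x (subst (1 <_) (sym eq) (s≤s (s≤s z≤n)))
      in ℕₚ.≤-trans (s≤s (go (suc r) y (ℕₚ.suc-injective (trans (sym (rank-⋖ y⋖x)) eq))))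
                    (st y x y⋖x Subsetₚ.∈⊤)

  -- A chain leads from x up to rank `height`, and f has to rise along it without exceeding m.
  corank-≤-strict : ∀ m f → (∀ x → f x ≤ m) → Strict m f → ∀ x → f x + (height ∸ rank x) ≤ m
  corank-≤-strict m f ≤m (_ , st , _) x = go (height ∸ rank x) x refl
    where
    go : ∀ k x → height ∸ rank x ≡ k → f x + k ≤ m
    go zero    x _ = subst (_≤ m) (sym (ℕₚ.+-identityʳ (f x))) (≤m x)
    go (suc k) x eq with up x (ℕₚ.≰⇒> λ h≤ → case trans (sym eq) (ℕₚ.m≤n⇒m∸n≡0 h≤) of λ ())
    ... | y , x⋖y = ℕₚ.≤-trans (ℕₚ.≤-reflexive (ℕₚ.+-suc (f x) k))
      (ℕₚ.≤-trans (ℕₚ.+-monoˡ-≤ k (st x y x⋖y Subsetₚ.∈⊤)) (go k y (begin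
        height ∸ rank y         ≡⟨ cong (height ∸_) (rank-⋖ x⋖y) ⟩
        height ∸ suc (rank x)   ≡⟨ ℕₚ.pred[m∸n]≡m∸[1+n] height (rank x) ⟨
        ℕ.pred (height ∸ rank x) ≡⟨ cong ℕ.pred eq ⟩
        k ∎)))
      where open ≡-Reasoning

  -- Since P is graded, subtracting the rank turns strict maps into weak ones.
  S-shift : ∀ m → S Subset.⊤ (height + m) ≡ + Ω m
  S-shift m = cong +_ (ℕₚ.≤-antisym
    (count-≤ (StrictOn? Subset.⊤ (height + m)) Weak? (height + m) m Weak-resp (λ f x → f x ∸ rank x)
      (λ f ≤h+m st → bound f ≤h+m st , weak f st)
      λ f g st-f st-g _ _ eq x → ℕₚ.∸-cancelʳ-≡ (rank-≤-strict _ f st-f x) (rank-≤-strict _ g st-g x) (eq x))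
    (count-≤ Weak? (StrictOn? Subset.⊤ (height + m)) m (height + m) StrictOn-resp (λ f x → rank x + f x)
      (λ f ≤m w → (λ x → ℕₚ.+-mono-≤ (rank-≤ x) (≤m x)) ,
        (λ x _ → ℕₚ.≤-trans (rank-pos x) (ℕₚ.m≤m+n _ _)) ,
        (λ x y x⋖y _ → ℕₚ.+-mono-<-≤ (ℕₚ.≤-reflexive (sym (rank-⋖ x⋖y))) (w x y x⋖y)) ,
        λ x x∉ → contradiction Subsetₚ.∈⊤ x∉)
      λ f g _ _ _ _ eq x → ℕₚ.+-cancelˡ-≡ (rank x) _ _ (eq x)))
    where
    bound : ∀ f → (∀ x → f x ≤ height + m) → Strict (height + m) f → ∀ x → f x ∸ rank x ≤ m
    bound f ≤h+m st x = ℕₚ.m≤n+o⇒m∸n≤o (f x) (rank x) (ℕₚ.+-cancelʳ-≤ (height ∸ rank x) (f x) (rank x + m)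
      (ℕₚ.≤-trans (corank-≤-strict _ f ≤h+m st x) (ℕₚ.≤-reflexive (begin
        height + m                       ≡⟨ cong (_+ m) (ℕₚ.m+[n∸m]≡n (rank-≤ x)) ⟨
        rank x + (height ∸ rank x) + m   ≡⟨ ℕₚ.+-assoc (rank x) _ m ⟩
        rank x + (height ∸ rank x + m)   ≡⟨ cong (rank x ℕ.+_) (ℕₚ.+-comm _ m) ⟩
        rank x + (m + (height ∸ rank x)) ≡⟨ ℕₚ.+-assoc (rank x) m _ ⟨
        rank x + m + (height ∸ rank x)   ∎))))
      where open ≡-Reasoning
    weak : ∀ f → Strict (height + m) f → Weak (λ x → f x ∸ rank x)
    weak f (_ , st , _) x y x⋖y = subst (λ r → f x ∸ rank x ≤ f y ∸ r) (sym (rank-⋖ x⋖y))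
      (ℕₚ.∸-monoˡ-≤ (suc (rank x)) (st x y x⋖y Subsetₚ.∈⊤))

  S-small : ∀ m → m < height → S Subset.⊤ m ≡ 0ℤ
  S-small m m<h = cong +_ (count-≡0 (StrictOn? Subset.⊤ m) m none)
    where
    none : ∀ f → (∀ x → f x ≤ m) → ¬ Strict m f
    none f ≤m st with top
    ... | inj₁ h≡0 = ℕₚ.n≮0 (subst (m <_) h≡0 m<h)
    ... | inj₂ (x , eq) = ℕₚ.<⇒≱ m<h (subst (_≤ m) eq (ℕₚ.≤-trans (rank-≤-strict m f st x) (≤m x)))

  S-τ^ : S Subset.⊤ ≗ τ^ height (+_ ∘ Ω)
  S-τ^ m with height ℕ.≤? m
  ... | no h≰m = trans (S-small m (ℕₚ.≰⇒> h≰m)) (sym (τ^-< height _ m (ℕₚ.≰⇒> h≰m)))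
  ... | yes h≤m = subst (λ k → S Subset.⊤ k ≡ τ^ height (+_ ∘ Ω) k) (ℕₚ.m+[n∸m]≡n h≤m)
    (trans (S-shift (m ∸ height)) (sym (τ^-+ height (+_ ∘ Ω) (m ∸ height))))

  palindromic : ∀ L → (∀ m → 1 ≤ m → L m ≡ Ω m) → Palindromic (hstar d L)
  palindromic L L≡Ω = Rev-τ^⇒Palindromic d height
    (trans (h≗ 0) (trans (δ^-0 (suc d) (+_ ∘ Ω)) (cong +_ Ω-0)))
    (Rev-cong (λ m → trans (h≗ m) (δ^-cong (suc d) (sym ∘ W-⊤) m)) (λ m → begin
        τ^ height (hstar d L) m            ≡⟨ τ^-cong height h≗ m ⟩
        τ^ height (δ^ (suc d) (+_ ∘ Ω)) m  ≡⟨ δ^-τ^ (suc d) height (+_ ∘ Ω) m ⟨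
        δ^ (suc d) (τ^ height (+_ ∘ Ω)) m  ≡⟨ δ^-cong (suc d) (sym ∘ S-τ^) m ⟩
        δ^ (suc d) (S Subset.⊤) m          ∎)
      (reciprocity d Subset.⊤ (λ _ _ _ _ → Subsetₚ.∈⊤) (Subsetₚ.∣⊤∣≡n d)))
    where
    open ≡-Reasoning
    Ehr≗ : Ehr L ≗ +_ ∘ Ω
    Ehr≗ zero    = cong +_ (sym Ω-0)
    Ehr≗ (suc m) = cong +_ (L≡Ω (suc m) (s≤s z≤n))
    h≗ : hstar d L ≗ δ^ (suc d) (+_ ∘ Ω)
    h≗ m = trans (hstarAux-δ^ (suc d) (Ehr L) m) (δ^-cong (suc d) Ehr≗ m)
    τ^-cong : ∀ r {f g} → f ≗ g → τ^ r f ≗ τ^ r g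
    τ^-cong zero    e = e
    τ^-cong (suc r) e = τ-cong (τ^-cong r e)

-- Rational and integral combinations

ι : ℤ → ℚ
ι z = z ℚ./ 1

toℚᵘ-ι : ∀ z → toℚᵘ (ι z) ℚᵘ.≃ mkℚᵘ z 0
toℚᵘ-ι z = ℚₚ.toℚᵘ-fromℚᵘ (mkℚᵘ z 0)

ι-+ : ∀ a b → ι (a ℤ.+ b) ≡ ι a ℚ.+ ι b
ι-+ a b = ℚₚ.toℚᵘ-injective (begin
  toℚᵘ (ι (a ℤ.+ b))           ≈⟨ toℚᵘ-ι (a ℤ.+ b) ⟩
  mkℚᵘ (a ℤ.+ b) 0             ≈⟨ *≡* (arith a b) ⟩
  mkℚᵘ a 0 ℚᵘ.+ mkℚᵘ b 0       ≈⟨ ℚᵘₚ.+-cong (toℚᵘ-ι a) (toℚᵘ-ι b) ⟨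
  toℚᵘ (ι a) ℚᵘ.+ toℚᵘ (ι b)   ≈⟨ ℚₚ.toℚᵘ-homo-+ (ι a) (ι b) ⟨
  toℚᵘ (ι a ℚ.+ ι b)           ∎)
  where
  open ℚᵘₚ.≃-Reasoning
  arith : ∀ a b → (a ℤ.+ b) ℤ.* 1ℤ ≡ (a ℤ.* 1ℤ ℤ.+ b ℤ.* 1ℤ) ℤ.* 1ℤ
  arith = solve-∀

ι-* : ∀ a b → ι (a ℤ.* b) ≡ ι a ℚ.* ι b
ι-* a b = ℚₚ.toℚᵘ-injective (begin
  toℚᵘ (ι (a ℤ.* b))           ≈⟨ toℚᵘ-ι (a ℤ.* b) ⟩
  mkℚᵘ a 0 ℚᵘ.* mkℚᵘ b 0       ≈⟨ ℚᵘₚ.*-cong (toℚᵘ-ι a) (toℚᵘ-ι b) ⟨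
  toℚᵘ (ι a) ℚᵘ.* toℚᵘ (ι b)   ≈⟨ ℚₚ.toℚᵘ-homo-* (ι a) (ι b) ⟨
  toℚᵘ (ι a ℚ.* ι b)           ∎)
  where open ℚᵘₚ.≃-Reasoning

ι-injective : ∀ {a b} → ι a ≡ ι b → a ≡ b
ι-injective {a} {b} eq with ℚₚ.fromℚᵘ-injective {mkℚᵘ a 0} {mkℚᵘ b 0} eq
... | *≡* e = ℤₚ.*-cancelʳ-≡ a b 1ℤ e

ι-nonNeg⁻ : ∀ {a} → 0ℚ ℚ.≤ ι a → 0ℤ ℤ.≤ a
ι-nonNeg⁻ {a} 0≤ with ℚᵘₚ.≤-respʳ-≃ (toℚᵘ-ι a) (ℚₚ.toℚᵘ-mono-≤ 0≤)
... | *≤* le = subst (0ℤ ℤ.≤_) (ℤₚ.*-identityʳ a) le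

ι-denominator : ∀ q → ι (ℚ.↧ q) ℚ.* q ≡ ι (ℚ.↥ q)
ι-denominator q@(mkℚ n d-1 _) = ℚₚ.toℚᵘ-injective (begin
  toℚᵘ (ι (ℚ.↧ q) ℚ.* q)           ≈⟨ ℚₚ.toℚᵘ-homo-* (ι (ℚ.↧ q)) q ⟩
  toℚᵘ (ι (ℚ.↧ q)) ℚᵘ.* toℚᵘ q     ≈⟨ ℚᵘₚ.*-cong (toℚᵘ-ι (ℚ.↧ q)) ℚᵘₚ.≃-refl ⟩
  mkℚᵘ (ℚ.↧ q) 0 ℚᵘ.* mkℚᵘ n d-1   ≈⟨ *≡* (trans (arith (ℚ.↧ q) n)
                                        (cong (λ k → n ℤ.* + suc k) (sym (ℕₚ.+-identityʳ d-1)))) ⟩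
  mkℚᵘ n 0                         ≈⟨ toℚᵘ-ι n ⟨
  toℚᵘ (ι n)                       ∎)
  where
  open ℚᵘₚ.≃-Reasoning
  arith : ∀ d n → (d ℤ.* n) ℤ.* 1ℤ ≡ n ℤ.* d
  arith = solve-∀

data Scaled (N : ℕ) : ∀ {k} → Vec ℚ k → Vec ℤ k → Set where
  []  : Scaled N [] []
  _∷_ : ∀ {k w a} {ws : Vec ℚ k} {as} → ι (+ suc N) ℚ.* w ≡ ι a → Scaled N ws as →
        Scaled N (w ∷ ws) (a ∷ as)

clear-denominators : ∀ {k} (ws : Vec ℚ k) → ∃[ N ] Σ (Vec ℤ k) (Scaled N ws)
clear-denominators [] = 0 , [] , []
clear-denominators {suc k} (w ∷ ws) with clear-denominators ws
... | N , as , ok = N′ , ℚ.↥ w ℤ.* + suc N ∷ Vec.map (D ℤ.*_) as , head-ok ∷ tail-ok ok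
  where
  D = ℚ.↧ w
  -- Chosen so that `suc N′` is, by computation, `suc N` times the denominator of w.
  N′ = ℚ.denominator-1 w + N * suc (ℚ.denominator-1 w)
  N′≡ : ι (+ suc N′) ≡ ι (+ suc N) ℚ.* ι D
  N′≡ = trans (cong ι (ℤₚ.pos-* (suc N) (suc (ℚ.denominator-1 w)))) (ι-* (+ suc N) D)
  open ≡-Reasoning
  head-ok : ι (+ suc N′) ℚ.* w ≡ ι (ℚ.↥ w ℤ.* + suc N)
  head-ok = begin
    ι (+ suc N′) ℚ.* w             ≡⟨ cong (ℚ._* w) N′≡ ⟩
    ι (+ suc N) ℚ.* ι D ℚ.* w      ≡⟨ ℚₚ.*-assoc (ι (+ suc N)) (ι D) w ⟩
    ι (+ suc N) ℚ.* (ι D ℚ.* w)    ≡⟨ cong (ι (+ suc N) ℚ.*_) (ι-denominator w) ⟩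
    ι (+ suc N) ℚ.* ι (ℚ.↥ w)      ≡⟨ ℚₚ.*-comm (ι (+ suc N)) (ι (ℚ.↥ w)) ⟩
    ι (ℚ.↥ w) ℚ.* ι (+ suc N)      ≡⟨ ι-* (ℚ.↥ w) (+ suc N) ⟨
    ι (ℚ.↥ w ℤ.* + suc N)          ∎
  tail-ok : ∀ {l} {vs : Vec ℚ l} {bs} → Scaled N vs bs → Scaled N′ vs (Vec.map (D ℤ.*_) bs)
  tail-ok [] = []
  tail-ok {vs = v ∷ _} {b ∷ _} (e ∷ es) = (begin
    ι (+ suc N′) ℚ.* v             ≡⟨ cong (ℚ._* v) (trans N′≡ (ℚₚ.*-comm (ι (+ suc N)) (ι D))) ⟩
    ι D ℚ.* ι (+ suc N) ℚ.* v      ≡⟨ ℚₚ.*-assoc (ι D) (ι (+ suc N)) v ⟩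
    ι D ℚ.* (ι (+ suc N) ℚ.* v)    ≡⟨ cong (ι D ℚ.*_) e ⟩
    ι D ℚ.* ι b                    ≡⟨ ι-* D b ⟨
    ι (D ℤ.* b)                    ∎) ∷ tail-ok es

sumℤ : ∀ {k} → Vec ℤ k → ℤ
sumℤ []       = 0ℤ
sumℤ (a ∷ as) = a ℤ.+ sumℤ as

permMatrix : ∀ {n} → Perm n → Fin n → Fin n → ℤ
permMatrix σ i j with (σ at i) Finₚ.≟ j
... | yes _ = 1ℤ
... | no  _ = 0ℤ

PermMatrix-ι : ∀ {n} (σ : Perm n) i j → PermMatrix σ i j ≡ ι (permMatrix σ i j)
PermMatrix-ι σ i j with (σ at i) Finₚ.≟ j
... | yes _ = refl
... | no  _ = refl

comboℤ : ∀ {n k} → Vec ℤ k → Vec (Perm n) k → Fin n → Fin n → ℤ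
comboℤ []       []       i j = 0ℤ
comboℤ (a ∷ as) (σ ∷ σs) i j = a ℤ.* permMatrix σ i j ℤ.+ comboℤ as σs i j

sumℚ-scaled : ∀ {k N} {ws : Vec ℚ k} {as} → Scaled N ws as → ι (+ suc N) ℚ.* sumℚ ws ≡ ι (sumℤ as)
sumℚ-scaled {N = N} [] = ℚₚ.*-zeroʳ (ι (+ suc N))
sumℚ-scaled {N = N} {w ∷ ws} {a ∷ as} (e ∷ es) =
  trans (ℚₚ.*-distribˡ-+ (ι (+ suc N)) w (sumℚ ws))
    (trans (cong₂ ℚ._+_ e (sumℚ-scaled es)) (sym (ι-+ a (sumℤ as))))

combo-scaled : ∀ {n k N} {ws : Vec ℚ k} {as} → Scaled N ws as → ∀ (σs : Vec (Perm n) k) i j →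
  ι (+ suc N) ℚ.* combo ws σs i j ≡ ι (comboℤ as σs i j)
combo-scaled {N = N} [] [] i j = ℚₚ.*-zeroʳ (ι (+ suc N))
combo-scaled {N = N} {w ∷ ws} {a ∷ as} (e ∷ es) (σ ∷ σs) i j = begin
  c ℚ.* (w ℚ.* M ℚ.+ combo ws σs i j)              ≡⟨ ℚₚ.*-distribˡ-+ c (w ℚ.* M) _ ⟩
  c ℚ.* (w ℚ.* M) ℚ.+ c ℚ.* combo ws σs i j        ≡⟨ cong₂ ℚ._+_ (sym (ℚₚ.*-assoc c w M)) (combo-scaled es σs i j) ⟩
  c ℚ.* w ℚ.* M ℚ.+ ι (comboℤ as σs i j)           ≡⟨ cong (ℚ._+ ι (comboℤ as σs i j)) (cong₂ ℚ._*_ e (PermMatrix-ι σ i j)) ⟩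
  ι a ℚ.* ι (permMatrix σ i j) ℚ.+ ι (comboℤ as σs i j) ≡⟨ cong (ℚ._+ ι (comboℤ as σs i j)) (ι-* a (permMatrix σ i j)) ⟨
  ι (a ℤ.* permMatrix σ i j) ℚ.+ ι (comboℤ as σs i j)   ≡⟨ ι-+ (a ℤ.* permMatrix σ i j) (comboℤ as σs i j) ⟨
  ι (comboℤ (a ∷ as) (σ ∷ σs) i j)                 ∎
  where
  open ≡-Reasoning
  c = ι (+ suc N)
  M = PermMatrix σ i j

scaled-ι : ∀ {k} (as : Vec ℤ k) → Scaled 0 (Vec.map ι as) as
scaled-ι []       = []
scaled-ι (a ∷ as) = ℚₚ.*-identityˡ (ι a) ∷ scaled-ι as

scaled-zero : ∀ {k N} {ws : Vec ℚ k} {as} → Scaled N ws as → AllV (_≡ 0ℤ) as → AllV (_≡ 0ℚ) ws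
scaled-zero [] [] = []
scaled-zero {N = N} {w ∷ _} (e ∷ es) (refl ∷ zs) =
  ℚₚ.≤-antisym (cancel w 0ℚ (trans e (sym c0≡0))) (cancel 0ℚ w (trans c0≡0 (sym e))) ∷ scaled-zero es zs
  where
  c = ι (+ suc N)
  c0≡0 : c ℚ.* 0ℚ ≡ ι 0ℤ
  c0≡0 = ℚₚ.*-zeroʳ c
  cancel : ∀ p q → c ℚ.* p ≡ c ℚ.* q → p ℚ.≤ q
  cancel p q eq = ℚₚ.*-cancelˡ-≤-pos c {{ℚₚ.normalize-pos (suc N) 1}} (ℚₚ.≤-reflexive eq)

scaled-nonNeg : ∀ {k N} {ws : Vec ℚ k} {as} → Scaled N ws as → AllV (0ℚ ℚ.≤_) ws → AllV (0ℤ ℤ.≤_) as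
scaled-nonNeg [] [] = []
scaled-nonNeg {N = N} (e ∷ es) (p ∷ ps) =
  ι-nonNeg⁻ (subst₂ ℚ._≤_ (ℚₚ.*-zeroʳ c) e
    (ℚₚ.*-monoˡ-≤-nonNeg c {{ℚₚ.normalize-nonNeg (suc N) 1}} p)) ∷ scaled-nonNeg es ps
  where c = ι (+ suc N)

-- Integral linear dependence

comb : ∀ {r k} → Vec ℤ k → Vec (Fin r → ℤ) k → Fin r → ℤ
comb []       []       p = 0ℤ
comb (c ∷ cs) (y ∷ ys) p = c ℤ.* y p ℤ.+ comb cs ys p

zeros : ∀ k → Vec ℤ k
zeros k = replicate k 0ℤ

comb-zeros : ∀ {r k} (ys : Vec (Fin r → ℤ) k) p → comb (zeros k) ys p ≡ 0ℤ
comb-zeros []       p = refl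
comb-zeros (y ∷ ys) p = trans (ℤₚ.+-identityˡ _) (comb-zeros ys p)

-- One step of fraction-free elimination of the coordinate p by the row v.
module Elimination {r} (v : Fin (suc r) → ℤ) (p : Fin (suc r)) where

  eliminate : (Fin (suc r) → ℤ) → Fin r → ℤ
  eliminate w q = v p ℤ.* w (punchIn p q) ℤ.- w p ℤ.* v (punchIn p q)

  comb-eliminate : ∀ {k} (cs : Vec ℤ k) ys q →
    comb cs (Vec.map eliminate ys) q ≡ v p ℤ.* comb cs ys (punchIn p q) ℤ.- comb cs ys p ℤ.* v (punchIn p q)
  comb-eliminate [] [] q = arith (v p) (v (punchIn p q))
    where
    arith : ∀ a b → 0ℤ ≡ a ℤ.* 0ℤ ℤ.- 0ℤ ℤ.* b
    arith = solve-∀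
  comb-eliminate (c ∷ cs) (y ∷ ys) q rewrite comb-eliminate cs ys q =
    arith c (v p) (y (punchIn p q)) (y p) (v (punchIn p q)) (comb cs ys (punchIn p q)) (comb cs ys p)
    where
    arith : ∀ c a y z b s t → c ℤ.* (a ℤ.* y ℤ.- z ℤ.* b) ℤ.+ (a ℤ.* s ℤ.- t ℤ.* b)
                            ≡ a ℤ.* (c ℤ.* y ℤ.+ s) ℤ.- (c ℤ.* z ℤ.+ t) ℤ.* b
    arith = solve-∀

comb-scale : ∀ {r k} a (cs : Vec ℤ k) (ys : Vec (Fin r → ℤ) k) p →
  comb (Vec.map (a ℤ.*_) cs) ys p ≡ a ℤ.* comb cs ys p
comb-scale a [] [] p = sym (ℤₚ.*-zeroʳ a)
comb-scale a (c ∷ cs) (y ∷ ys) p rewrite comb-scale a cs ys p = arith a c (y p) (comb cs ys p)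
  where
  arith : ∀ a c y s → a ℤ.* c ℤ.* y ℤ.+ a ℤ.* s ≡ a ℤ.* (c ℤ.* y ℤ.+ s)
  arith = solve-∀

-- Fraction-free Gaussian elimination. If v p ≠ 0, each row y becomes v p · y - y p · v, which has
-- no coordinate p. A dependence cs of the new rows gives the coefficients v p · cs for the old ones
-- and, for v, minus the p-th coordinate of their combination by cs.
linearly-dependent : ∀ {r k} → r < k → (ys : Vec (Fin r → ℤ) k) →
  Σ (Vec ℤ k) λ cs → ¬ AllV (_≡ 0ℤ) cs × (∀ p → comb cs ys p ≡ 0ℤ)
linearly-dependent {r} {suc k} r<k (v ∷ ys) with all? (λ p → v p ℤ.≟ 0ℤ)
... | yes v≡0 = 1ℤ ∷ zeros k , (λ { (() ∷ _) }) ,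
  λ p → trans (cong₂ ℤ._+_ (cong (1ℤ ℤ.*_) (v≡0 p)) (comb-zeros ys p)) refl
linearly-dependent {zero} {suc k} r<k (v ∷ ys) | no v≢0 = contradiction (λ ()) v≢0
linearly-dependent {suc r} {suc k} (s≤s r<k) (v ∷ ys) | no v≢0
  with p , vp≢0 ← Finₚ.¬∀⟶∃¬ (suc r) _ (λ p → v p ℤ.≟ 0ℤ) v≢0
  with cs , cs≢0 , dep ← linearly-dependent r<k (Vec.map (Elimination.eliminate v p) ys) =
  - comb cs ys p ∷ Vec.map (v p ℤ.*_) cs , (λ { (_ ∷ zs) → cs≢0 (unscale cs zs) }) , dependent
  where
  unscale : ∀ {l} (bs : Vec ℤ l) → AllV (_≡ 0ℤ) (Vec.map (v p ℤ.*_) bs) → AllV (_≡ 0ℤ) bs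
  unscale [] [] = []
  unscale (b ∷ bs) (z ∷ zs) with ℤₚ.i*j≡0⇒i≡0∨j≡0 (v p) z
  ... | inj₁ vp≡0 = contradiction vp≡0 vp≢0
  ... | inj₂ b≡0  = b≡0 ∷ unscale bs zs
  dependent : ∀ q → (- comb cs ys p) ℤ.* v q ℤ.+ comb (Vec.map (v p ℤ.*_) cs) ys q ≡ 0ℤ
  dependent q rewrite comb-scale (v p) cs ys q with p Finₚ.≟ q
  ... | yes refl = arith (comb cs ys p) (v p)
    where
    arith : ∀ s a → (- s) ℤ.* a ℤ.+ a ℤ.* s ≡ 0ℤ
    arith = solve-∀
  ... | no p≢q = subst (λ q → (- comb cs ys p) ℤ.* v q ℤ.+ v p ℤ.* comb cs ys q ≡ 0ℤ)
    (Finₚ.punchIn-punchOut p≢q)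
    (trans (arith (comb cs ys p) (v (punchIn p q′)) (v p) (comb cs ys (punchIn p q′)))
      (trans (sym (Elimination.comb-eliminate v p cs ys q′)) (dep q′)))
    where
    q′ = Data.Fin.punchOut p≢q
    arith : ∀ s b a t → (- s) ℤ.* b ℤ.+ a ℤ.* t ≡ a ℤ.* t ℤ.- s ℤ.* b
    arith = solve-∀

-- Polytopes of permutation matrices that are order polytopes in linear coordinates

-- Additivity and homogeneity in one clause, with m as a further coordinate. As the arguments enter
-- through pointwise equations, the clause also yields invariance under pointwise equality.
Linear : ∀ {d} → ((Fin d → ℤ) → ℤ → ℤ) → Set
Linear {d} F = ∀ c {y y′ y″ : Fin d → ℤ} {m m′ m″} →
  (∀ p → y″ p ≡ c ℤ.* y p ℤ.+ y′ p) → m″ ≡ c ℤ.* m ℤ.+ m′ → F y″ m″ ≡ c ℤ.* F y m ℤ.+ F y′ m′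

Linear-zero : ∀ {d} {F : (Fin d → ℤ) → ℤ → ℤ} → Linear F →
  ∀ {y m} → (∀ p → y p ≡ 0ℤ) → m ≡ 0ℤ → F y m ≡ 0ℤ
Linear-zero {F = F} lin {y} {m} y≡0 m≡0 =
  -- The zero vector is -1 times itself plus itself, so its image is minus itself plus itself.
  trans (lin (- 1ℤ) (λ p → zero-eq (y≡0 p)) (zero-eq m≡0)) (arith (F y m))
  where
  zero-eq : ∀ {a} → a ≡ 0ℤ → a ≡ (- 1ℤ) ℤ.* a ℤ.+ a
  zero-eq refl = refl
  arith : ∀ a → (- 1ℤ) ℤ.* a ℤ.+ a ≡ 0ℤ
  arith = solve-∀

Linear-scale : ∀ {d} {F : (Fin d → ℤ) → ℤ → ℤ} → Linear F → ∀ c {y y′ m m′} →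
  (∀ p → y′ p ≡ c ℤ.* y p) → m′ ≡ c ℤ.* m → F y′ m′ ≡ c ℤ.* F y m
Linear-scale {F = F} lin c {y} {m = m} y′≡ m′≡ =
  trans (lin c {y′ = λ _ → 0ℤ} {m′ = 0ℤ} (λ p → trans (y′≡ p) (sym (ℤₚ.+-identityʳ _)))
                                          (trans m′≡ (sym (ℤₚ.+-identityʳ _))))
    (trans (cong (λ z → c ℤ.* F y m ℤ.+ z) (Linear-zero lin (λ _ → refl) refl)) (ℤₚ.+-identityʳ _))

-- The affine map from the order polytope to the matrices is homogenised by the dilation factor m:
-- vertices have m = 1, and combinations of vertices add these factors up.
record OrderModel {n d : ℕ} (V : Perm n → Set) (P : GradedPoset d) : Set where
  open OrderPolytope P using (Weak)
  UnitMap : (Fin d → ℕ) → Set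
  UnitMap f = Weak f × (∀ p → f p ≤ 1)
  field
    matrix        : Fin n → Fin n → (Fin d → ℤ) → ℤ → ℤ
    matrix-linear : ∀ i j → Linear (matrix i j)
    -- For N = 0 this is injectivity; for N > 0 it says that y/N is a lattice point if its matrix is.
    matrix-∣      : ∀ N y m → N ∣ m → (∀ i j → N ∣ matrix i j y m) → ∀ p → N ∣ y p
  Represents : Perm n → (Fin d → ℕ) → Set
  Represents σ f = UnitMap f × (∀ i j → permMatrix σ i j ≡ matrix i j (+_ ∘ f) 1ℤ)
  field
    ideal  : ∀ σ → V σ → ∃[ f ] Represents σ f
    vertex : ∀ f → UnitMap f → ∃[ σ ] (V σ × Represents σ f)

-- Lattice points, dimension and h*-vector from a model

module ModelProperties {n d : ℕ} {V : Perm n → Set} {P : GradedPoset d} (M : OrderModel V P) where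
  open OrderModel M
  open GradedPoset P using (_⋖_)
  open Counting {d} using (Fun; count)
  open OrderPolytope P
  open Palindromicity P using (Ω; palindromic)

  embed : ∀ {k} → Vec Fun k → Vec (Fin d → ℤ) k
  embed = Vec.map (+_ ∘_)

  combo-matrix : ∀ {k} {σs : Vec (Perm n) k} {fs : Vec Fun k} → Pointwise Represents σs fs → ∀ as i j →
    comboℤ as σs i j ≡ matrix i j (comb as (embed fs)) (sumℤ as)
  combo-matrix [] [] i j = sym (Linear-zero (matrix-linear i j) (λ _ → refl) refl)
  combo-matrix {σs = σ ∷ σs} {f ∷ fs} ((_ , eq) ∷ reps) (a ∷ as) i j = trans
    (cong₂ (λ x y → a ℤ.* x ℤ.+ y) (eq i j) (combo-matrix reps as i j))
    (sym (matrix-linear i j a (λ _ → refl) (cong (ℤ._+ sumℤ as) (sym (ℤₚ.*-identityʳ a)))))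

  ideals : ∀ {k} {σs : Vec (Perm n) k} → AllV V σs →
    Σ (Vec Fun k) (Pointwise Represents σs)
  ideals [] = [] , []
  ideals {σs = σ ∷ _} (v ∷ vs) =
    let f , rep = ideal σ v ; fs , reps = ideals vs in f ∷ fs , rep ∷ reps

  vertices : ∀ {k} {fs : Vec Fun k} → AllV UnitMap fs →
    Σ (Vec (Perm n) k) λ σs → AllV V σs × Pointwise Represents σs fs
  vertices [] = [] , [] , []
  vertices {fs = f ∷ _} (u ∷ us) =
    let σ , v , rep = vertex f u ; σs , vs , reps = vertices us in σ ∷ σs , v ∷ vs , rep ∷ reps

  comb-weak : ∀ {k} {σs : Vec (Perm n) k} {fs : Vec Fun k} {as} → Pointwise Represents σs fs → AllV (0ℤ ℤ.≤_) as →
    ∀ x y → x ⋖ y → comb as (embed fs) x ℤ.≤ comb as (embed fs) y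
  comb-weak {as = []} [] [] x y x⋖y = ℤₚ.≤-refl
  comb-weak {as = a ∷ _} (((w , _) , _) ∷ reps) (0≤a ∷ 0≤as) x y x⋖y =
    ℤₚ.+-mono-≤ (ℤₚ.*-monoˡ-≤-nonNeg a {{ℤ.nonNegative 0≤a}} (ℤ.+≤+ (w x y x⋖y)))
                (comb-weak reps 0≤as x y x⋖y)

  comb-nonNeg : ∀ {k} (fs : Vec Fun k) {as} → AllV (0ℤ ℤ.≤_) as → ∀ x → 0ℤ ℤ.≤ comb as (embed fs) x
  comb-nonNeg [] [] x = ℤₚ.≤-refl
  comb-nonNeg (f ∷ fs) {a ∷ _} (0≤a ∷ 0≤as) x = ℤₚ.+-mono-≤
    (subst (ℤ._≤ a ℤ.* + f x) (ℤₚ.*-zeroʳ a) (ℤₚ.*-monoˡ-≤-nonNeg a {{ℤ.nonNegative 0≤a}} (ℤ.+≤+ z≤n)))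
    (comb-nonNeg fs 0≤as x)

  comb-≤ : ∀ {k} {σs : Vec (Perm n) k} {fs : Vec Fun k} {as} → Pointwise Represents σs fs → AllV (0ℤ ℤ.≤_) as →
    ∀ x → comb as (embed fs) x ℤ.≤ sumℤ as
  comb-≤ {as = []} [] [] x = ℤₚ.≤-refl
  comb-≤ {fs = f ∷ _} {a ∷ _} (((_ , f≤1) , _) ∷ reps) (0≤a ∷ 0≤as) x = ℤₚ.+-mono-≤
    (subst (a ℤ.* + f x ℤ.≤_) (ℤₚ.*-identityʳ a)
      (ℤₚ.*-monoˡ-≤-nonNeg a {{ℤ.nonNegative 0≤a}} (ℤ.+≤+ (f≤1 x))))
    (comb-≤ reps 0≤as x)

  LatticePoint : ℕ → IntMat n → Fun → Set
  LatticePoint m X f = (∀ x → f x ≤ m) × Weak f ×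
    (∀ i j → lookup (lookup X i) j ≡ matrix i j (+_ ∘ f) (+ m))

  -- With denominators cleared, D times X is the matrix of an integral combination Y of 0/1 maps.
  -- `matrix-∣` makes Y divisible by D, and the quotient inherits the inequalities of Y.
  dilate⇒weak : ∀ m X → InDilate V m X → ∃ (LatticePoint m X)
  dilate⇒weak m X (k , σs , ws , vs , 0≤ws , sum-ws , entries)
    with N , as , scaled ← clear-denominators ws | fs , reps ← ideals vs =
    f , (λ x → ℤₚ.drop‿+≤+ (subst (ℤ._≤ + m) (sym (f≡q x)) (q≤m x)))
      , (λ x y x⋖y → ℤₚ.drop‿+≤+ (subst₂ ℤ._≤_ (sym (f≡q x)) (sym (f≡q y)) (q-weak x y x⋖y)))
      , entry-eq
    where
    open ≡-Reasoning
    D = + suc N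
    Y = comb as (embed fs)
    0≤as : AllV (0ℤ ℤ.≤_) as
    0≤as = scaled-nonNeg scaled 0≤ws
    sum-as : sumℤ as ≡ D ℤ.* + m
    sum-as = ι-injective (begin
      ι (sumℤ as)       ≡⟨ sumℚ-scaled scaled ⟨
      ι D ℚ.* sumℚ ws   ≡⟨ cong (ι D ℚ.*_) sum-ws ⟩
      ι D ℚ.* ι (+ m)   ≡⟨ ι-* D (+ m) ⟨
      ι (D ℤ.* + m)     ∎)
    scaled-entry : ∀ i j → D ℤ.* lookup (lookup X i) j ≡ matrix i j Y (sumℤ as)
    scaled-entry i j = trans (ι-injective (begin
      ι (D ℤ.* lookup (lookup X i) j)  ≡⟨ ι-* D (lookup (lookup X i) j) ⟩
      ι D ℚ.* entryℚ X i j             ≡⟨ cong (ι D ℚ.*_) (entries i j) ⟩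
      ι D ℚ.* combo ws σs i j          ≡⟨ combo-scaled scaled σs i j ⟩
      ι (comboℤ as σs i j)             ∎)) (combo-matrix reps as i j)
    D∣Y : ∀ p → D ∣ Y p
    D∣Y = matrix-∣ D Y (sumℤ as) (divides (+ m) (trans sum-as (ℤₚ.*-comm D (+ m))))
      λ i j → divides (lookup (lookup X i) j)
        (trans (sym (scaled-entry i j)) (ℤₚ.*-comm D (lookup (lookup X i) j)))
    q : Fin d → ℤ
    q p = _∣_.quotient (D∣Y p)
    Y≡ : ∀ p → Y p ≡ q p ℤ.* D
    Y≡ p = _∣_.equality (D∣Y p)
    cancel : ∀ {a b a′ b′} → a′ ≡ a ℤ.* D → b′ ≡ b ℤ.* D → a′ ℤ.≤ b′ → a ℤ.≤ b
    cancel {a} {b} ea eb le = ℤₚ.*-cancelʳ-≤-pos a b D (subst₂ ℤ._≤_ ea eb le)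
    0≤q : ∀ x → 0ℤ ℤ.≤ q x
    0≤q x = cancel refl (Y≡ x) (comb-nonNeg fs 0≤as x)
    q≤m : ∀ x → q x ℤ.≤ + m
    q≤m x = cancel (Y≡ x) (trans sum-as (ℤₚ.*-comm D (+ m))) (comb-≤ reps 0≤as x)
    q-weak : ∀ x y → x ⋖ y → q x ℤ.≤ q y
    q-weak x y x⋖y = cancel (Y≡ x) (Y≡ y) (comb-weak reps 0≤as x y x⋖y)
    f : Fun
    f x = ℤ.∣ q x ∣
    f≡q : ∀ x → + f x ≡ q x
    f≡q x = ℤₚ.0≤i⇒+∣i∣≡i (0≤q x)
    entry-eq : ∀ i j → lookup (lookup X i) j ≡ matrix i j (+_ ∘ f) (+ m)
    entry-eq i j = ℤₚ.*-cancelˡ-≡ D _ _ (trans (scaled-entry i j)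
      (Linear-scale (matrix-linear i j) D
        (λ p → trans (Y≡ p) (trans (ℤₚ.*-comm (q p) D) (cong (D ℤ.*_) (sym (f≡q p))))) sum-as))

  -- A weak map is the sum of the indicators of its level sets.
  level-vertices : ∀ m f → (∀ x → f x ≤ m) → Weak f → Σ (Vec (Perm n) m) λ σs →
    AllV V σs × (∀ i j → matrix i j (+_ ∘ f) (+ m) ≡ comboℤ (replicate m 1ℤ) σs i j)
  level-vertices zero f f≤0 w = [] , [] ,
    λ i j → Linear-zero (matrix-linear i j) (λ p → cong +_ (ℕₚ.n≤0⇒n≡0 (f≤0 p))) refl
  level-vertices (suc m) f f≤ w =
    let σ , v , _ , eq = vertex (λ x → f x ℕ.⊓ 1)
          ((λ x y x⋖y → ℕₚ.⊓-monoˡ-≤ 1 (w x y x⋖y)) , λ x → ℕₚ.m⊓n≤n (f x) 1)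
        σs , vs , eqs = level-vertices m (λ x → f x ∸ 1)
          (λ x → ℕₚ.∸-monoˡ-≤ 1 (f≤ x)) (λ x y x⋖y → ℕₚ.∸-monoˡ-≤ 1 (w x y x⋖y))
    in σ ∷ σs , v ∷ vs , λ i j →
      trans (matrix-linear i j 1ℤ (λ p → split (f p)) refl)
            (cong₂ (λ a b → 1ℤ ℤ.* a ℤ.+ b) (sym (eq i j)) (eqs i j))
    where
    split : ∀ a → + a ≡ 1ℤ ℤ.* + (a ℕ.⊓ 1) ℤ.+ + (a ∸ 1)
    split zero = refl
    split (suc a) rewrite ℕₚ.⊓-zeroʳ a = refl

  weak⇒dilate : ∀ m X f → LatticePoint m X f → InDilate V m X
  weak⇒dilate m X f (f≤m , w , eq) with σs , vs , eqs ← level-vertices m f f≤m w =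
    m , σs , Vec.map ι (replicate m 1ℤ) , vs , nonNeg m , sum-eq ,
    λ i j → trans (cong ι (trans (eq i j) (eqs i j)))
      (trans (sym (combo-scaled (scaled-ι (replicate m 1ℤ)) σs i j)) (ℚₚ.*-identityˡ _))
    where
    nonNeg : ∀ m → AllV (0ℚ ℚ.≤_) (Vec.map ι (replicate m 1ℤ))
    nonNeg zero    = []
    nonNeg (suc m) = ℚₚ.nonNegative⁻¹ 1ℚ ∷ nonNeg m
    sum-ones : ∀ m → sumℤ (replicate m 1ℤ) ≡ + m
    sum-ones zero    = refl
    sum-ones (suc m) = cong (λ z → 1ℤ ℤ.+ z) (sum-ones m)
    sum-eq : sumℚ (Vec.map ι (replicate m 1ℤ)) ≡ ι (+ m)
    sum-eq = trans (sym (ℚₚ.*-identityˡ _))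
      (trans (sumℚ-scaled (scaled-ι (replicate m 1ℤ))) (cong ι (sum-ones m)))

  toMatrix : ℕ → Vec ℕ d → IntMat n
  toMatrix m v = tabulate λ i → tabulate λ j → matrix i j (+_ ∘ lookup v) (+ m)

  lookup-toMatrix : ∀ m v i j → lookup (lookup (toMatrix m v) i) j ≡ matrix i j (+_ ∘ lookup v) (+ m)
  lookup-toMatrix m v i j = trans (cong (λ r → lookup r j) (lookup∘tabulate _ i)) (lookup∘tabulate _ j)

  matrix-injective : ∀ (y y′ : Fin d → ℤ) m → (∀ i j → matrix i j y m ≡ matrix i j y′ m) → y ≗ y′
  matrix-injective y y′ m eq p with matrix-∣ 0ℤ diff 0ℤ (divides 0ℤ refl) (λ i j → divides 0ℤ (zero-diff i j)) p
    where
    diff : Fin d → ℤ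
    diff p = (- 1ℤ) ℤ.* y p ℤ.+ y′ p
    zero-diff : ∀ i j → matrix i j diff 0ℤ ≡ 0ℤ
    zero-diff i j = trans (matrix-linear i j (- 1ℤ) {m = m} {m} (λ _ → refl) (cancel m))
      (trans (cong (λ a → (- 1ℤ) ℤ.* a ℤ.+ matrix i j y′ m) (eq i j)) (sym (cancel (matrix i j y′ m))))
      where
      cancel : ∀ a → 0ℤ ≡ (- 1ℤ) ℤ.* a ℤ.+ a
      cancel = solve-∀
  ... | divides q e = sym (ℤₚ.i-j≡0⇒i≡j (y′ p) (y p)
    (trans (arith (y p) (y′ p)) (trans e (ℤₚ.*-zeroʳ q))))
    where
    arith : ∀ a b → b ℤ.- a ≡ (- 1ℤ) ℤ.* a ℤ.+ b
    arith = solve-∀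

  toMatrix-injective : ∀ m v w → toMatrix m v ≡ toMatrix m w → v ≡ w
  toMatrix-injective m v w eq = lookup-injective v w λ x → ℤₚ.+-injective
    (matrix-injective (+_ ∘ lookup v) (+_ ∘ lookup w) (+ m)
      (λ i j → trans (sym (lookup-toMatrix m v i j))
        (trans (cong (λ X → lookup (lookup X i) j) eq) (lookup-toMatrix m w i j))) x)

  weak-vecs : ℕ → List (Vec ℕ d)
  weak-vecs m = filter (λ v → Weak? (lookup v)) (vecsUpTo d m)

  ∈-toMatrix⁻ : ∀ m X → X ∈ map (toMatrix m) (weak-vecs m) → InDilate V m X
  ∈-toMatrix⁻ m X X∈ with v , v∈ , refl ← ∈-map⁻ (toMatrix m) X∈
    with v∈′ , w ← ∈-filter⁻ (λ v → Weak? (lookup v)) {xs = vecsUpTo d m} v∈ =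
    weak⇒dilate m X (lookup v) (∈-vecsUpTo⁻ v v∈′ , w , lookup-toMatrix m v)

  latticePoint-∈ : ∀ m X f → LatticePoint m X f → X ∈ map (toMatrix m) (weak-vecs m)
  latticePoint-∈ m X f (f≤m , w , eq) =
    subst (_∈ map (toMatrix m) (weak-vecs m)) (lookup-injective _ X λ i → lookup-injective _ _ λ j → entry-eq i j)
      (∈-map⁺ (toMatrix m) (∈-filter⁺ (λ v → Weak? (lookup v))
        (∈-vecsUpTo⁺ v λ x → subst (_≤ m) (sym (v≡f x)) (f≤m x)) (Weak-resp (sym ∘ v≡f) w)))
    where
    v = tabulate f
    v≡f : lookup v ≗ f
    v≡f = lookup∘tabulate f
    entry-eq : ∀ i j → lookup (lookup (toMatrix m v) i) j ≡ lookup (lookup X i) j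
    entry-eq i j = trans (lookup-toMatrix m v i j) (trans
      (trans (matrix-linear i j 1ℤ {y′ = λ _ → 0ℤ} {m′ = 0ℤ}
               (λ p → trans (cong +_ (v≡f p)) (sym (arith _))) (sym (arith (+ m))))
             (trans (cong (λ z → 1ℤ ℤ.* matrix i j (+_ ∘ f) (+ m) ℤ.+ z)
                      (Linear-zero (matrix-linear i j) (λ _ → refl) refl)) (arith _)))
      (sym (eq i j)))
      where
      arith : ∀ a → 1ℤ ℤ.* a ℤ.+ 0ℤ ≡ a
      arith = solve-∀

  ∈-toMatrix⁺ : ∀ m X → InDilate V m X → X ∈ map (toMatrix m) (weak-vecs m)
  ∈-toMatrix⁺ m X X∈P = let f , point = dilate⇒weak m X X∈P in latticePoint-∈ m X f point

  counts⇒Ω : ∀ m c → Counts (InDilate V m) c → c ≡ Ω m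
  counts⇒Ω m c (xs , uniq , refl , spec) = ℕₚ.≤-antisym
    (subst (length xs ≤_) (length-map (toMatrix m) (weak-vecs m))
      (length-≤-injection id uniq (λ {X} X∈ → ∈-toMatrix⁺ m X (proj₁ (spec X) X∈)) (λ _ _ → id)))
    (length-≤-injection (toMatrix m) (Uniqueₚ.filter⁺ _ (vecsUpTo-unique d m))
      (λ {v} v∈ → proj₂ (spec _) (∈-toMatrix⁻ m (toMatrix m v) (∈-map⁺ (toMatrix m) v∈)))
      (λ {v} {w} _ _ → toMatrix-injective m v w))

  -- The extra coordinate 1 records the coefficient sum, so that linear dependence of these vectors
  -- is affine dependence of the maps.
  homogenise : Fun → Fin (suc d) → ℤ
  homogenise f zero    = 1ℤ
  homogenise f (suc p) = + f p

  affinely-dependent : ∀ {k} (σs : Vec (Perm n) k) → suc d < k → AllV V σs → ¬ AffinelyIndependent σs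
  affinely-dependent {k} σs d<k vs indep
    with fs , reps ← ideals vs
    with cs , cs≢0 , dep ← linearly-dependent d<k (Vec.map homogenise fs) =
    cs≢0 (unscale cs (indep (Vec.map ι cs)
      (trans (sym (ℚₚ.*-identityˡ _)) (trans (sumℚ-scaled (scaled-ι cs)) (cong ι sum≡0)))
      λ i j → trans (sym (ℚₚ.*-identityˡ _)) (trans (combo-scaled (scaled-ι cs) σs i j)
        (cong ι (trans (combo-matrix reps cs i j) (Linear-zero (matrix-linear i j) comb≡0 sum≡0))))))
    where
    comb-zero : ∀ {l} (cs : Vec ℤ l) fs → comb cs (Vec.map homogenise fs) zero ≡ sumℤ cs
    comb-zero [] [] = refl
    comb-zero (c ∷ cs) (f ∷ fs) = cong₂ ℤ._+_ (ℤₚ.*-identityʳ c) (comb-zero cs fs)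
    comb-suc : ∀ {l} (cs : Vec ℤ l) fs p → comb cs (Vec.map homogenise fs) (suc p) ≡ comb cs (embed fs) p
    comb-suc [] [] p = refl
    comb-suc (c ∷ cs) (f ∷ fs) p = cong (λ z → c ℤ.* + f p ℤ.+ z) (comb-suc cs fs p)
    sum≡0 : sumℤ cs ≡ 0ℤ
    sum≡0 = trans (sym (comb-zero cs fs)) (dep zero)
    comb≡0 : ∀ p → comb cs (embed fs) p ≡ 0ℤ
    comb≡0 p = trans (sym (comb-suc cs fs p)) (dep (suc p))
    unscale : ∀ {l} (cs : Vec ℤ l) → AllV (_≡ 0ℚ) (Vec.map ι cs) → AllV (_≡ 0ℤ) cs
    unscale [] [] = []
    unscale (c ∷ cs) (z ∷ zs) = ι-injective z ∷ unscale cs zs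

  Independent : ∀ {k} → Vec Fun k → Set
  Independent {k} fs = ∀ cs → sumℤ cs ≡ 0ℤ → (∀ p → comb cs (embed fs) p ≡ 0ℤ) → AllV (_≡ 0ℤ) cs

  affinely-independent : ∀ {k} {σs : Vec (Perm n) k} {fs : Vec Fun k} → Pointwise Represents σs fs →
    Independent fs → AffinelyIndependent σs
  affinely-independent {σs = σs} {fs} reps indep cs sum≡0 combo≡0
    with N , as , scaled ← clear-denominators cs =
    scaled-zero scaled (indep as sum-as λ p → zero-∣ (matrix-∣ 0ℤ (comb as (embed fs)) 0ℤ
      (divides 0ℤ refl) (λ i j → divides 0ℤ (entry i j)) p))
    where
    c = ι (+ suc N)
    sum-as : sumℤ as ≡ 0ℤ
    sum-as = ι-injective (trans (sym (sumℚ-scaled scaled)) (trans (cong (c ℚ.*_) sum≡0) (ℚₚ.*-zeroʳ c)))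
    entry : ∀ i j → matrix i j (comb as (embed fs)) 0ℤ ≡ 0ℤ
    entry i j = trans (cong (matrix i j (comb as (embed fs))) (sym sum-as))
      (trans (sym (combo-matrix reps as i j)) (ι-injective (trans (sym (combo-scaled scaled σs i j))
        (trans (cong (c ℚ.*_) (combo≡0 i j)) (ℚₚ.*-zeroʳ c)))))
    zero-∣ : ∀ {a} → 0ℤ ∣ a → a ≡ 0ℤ
    zero-∣ (divides q e) = trans e (ℤₚ.*-zeroʳ q)

  -- An order preserving map into {0, 1} is 0 on an ideal and 1 elsewhere, so ideals enter through
  -- their complements.
  coindicator : Subset d → Fun
  coindicator I x with x Subsetₚ.∈? I
  ... | yes _ = 0
  ... | no  _ = 1

  coindicator-∈ : ∀ {I x} → x ∈ˢ I → coindicator I x ≡ 0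
  coindicator-∈ {I} {x} x∈ with x Subsetₚ.∈? I
  ... | yes _ = refl
  ... | no x∉ = contradiction x∈ x∉

  coindicator-∉ : ∀ {I x} → x ∉ˢ I → coindicator I x ≡ 1
  coindicator-∉ {I} {x} x∉ with x Subsetₚ.∈? I
  ... | yes x∈ = contradiction x∈ x∉
  ... | no _ = refl

  coindicator-unit : ∀ I → Ideal I → UnitMap (coindicator I)
  coindicator-unit I id-I = weak , bounded
    where
    bounded : ∀ x → coindicator I x ≤ 1
    bounded x with x Subsetₚ.∈? I
    ... | yes _ = z≤n
    ... | no  _ = ℕₚ.≤-refl
    weak : Weak (coindicator I)
    weak x y x⋖y with y Subsetₚ.∈? I
    ... | yes y∈ = ℕₚ.≤-reflexive (coindicator-∈ (id-I x y x⋖y y∈))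
    ... | no _ = bounded x

  nonempty : ∀ (I : Subset d) e → ∣ I ∣ ≡ suc e → Σ (Fin d) (_∈ˢ I)
  nonempty I e size with Subsetₚ.nonempty? I
  ... | yes ne = ne
  ... | no empty =
    case trans (sym size) (trans (cong ∣_∣ (Subsetₚ.Empty-unique empty)) (Subsetₚ.∣⊥∣≡0 d)) of λ ()

  removable : ∀ I e → ∣ I ∣ ≡ suc e → Σ (Fin d) λ x → (Maximal I x × ∣ I ─₁ x ∣ ≡ e)
  removable I e size with x , x∈ ← nonempty I e size with y , mx ← exists-maximal I x x∈ =
    y , mx , ℕₚ.suc-injective (trans (sym (∣p-x∣ I (proj₁ mx))) size)

  -- At the removed element x the first map is 0 and all later ones are 1. So the combination at x
  -- is the sum of the later coefficients; with the total sum zero, the first coefficient vanishes.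
  chain : ∀ e I → Ideal I → ∣ I ∣ ≡ e → Σ (Vec Fun (suc e)) λ fs →
    AllV UnitMap fs × AllV (λ f → ∀ x → x ∉ˢ I → f x ≡ 1) fs × Independent fs
  chain zero I id-I size = coindicator I ∷ [] , coindicator-unit I id-I ∷ [] ,
    (λ x → coindicator-∉) ∷ [] , λ { (c ∷ []) sum≡0 _ → trans (sym (ℤₚ.+-identityʳ c)) sum≡0 ∷ [] }
  chain (suc e) I id-I size
    with x , mx , size′ ← removable I e size
    with fs , us , ones , indep ← chain e (I ─₁ x) (ideal-remove id-I mx) size′ =
    coindicator I ∷ fs , coindicator-unit I id-I ∷ us ,
    (λ y → coindicator-∉) ∷ AllV.map (λ one y y∉ → one y (y∉ ∘ Subsetₚ.p─q⊆p I _)) ones , independent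
    where
    comb-at-x : ∀ {l} {fs : Vec Fun l} cs → AllV (λ f → ∀ y → y ∉ˢ (I ─₁ x) → f y ≡ 1) fs →
      comb cs (embed fs) x ≡ sumℤ cs
    comb-at-x [] [] = refl
    comb-at-x (c ∷ cs) (one ∷ ones) = cong₂ ℤ._+_
      (trans (cong (λ a → c ℤ.* + a) (one x (x∉p-x I x))) (ℤₚ.*-identityʳ c)) (comb-at-x cs ones)
    independent : Independent (coindicator I ∷ fs)
    independent (c ∷ cs) sum≡0 comb≡0 = c≡0 ∷ indep cs sum-cs λ p →
      trans (sym (ℤₚ.+-identityˡ _)) (trans (cong (λ a → a ℤ.* + coindicator I p ℤ.+ comb cs (embed fs) p) (sym c≡0)) (comb≡0 p))
      where
      sum-cs : sumℤ cs ≡ 0ℤ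
      sum-cs = trans (sym (comb-at-x cs ones)) (trans (sym (ℤₚ.+-identityˡ _))
        (trans (cong (ℤ._+ comb cs (embed fs) x) (sym (trans (cong (λ a → c ℤ.* + a) (coindicator-∈ (proj₁ mx))) (ℤₚ.*-zeroʳ c))))
          (comb≡0 x)))
      c≡0 : c ≡ 0ℤ
      c≡0 = trans (sym (ℤₚ.+-identityʳ c)) (trans (cong (λ z → c ℤ.+ z) (sym sum-cs)) sum≡0)

  ideal-of-size : ∀ k e I → Ideal I → ∣ I ∣ ≡ k + e → ∃[ J ] (Ideal J × ∣ J ∣ ≡ e)
  ideal-of-size zero    e I id-I size = I , id-I , size
  ideal-of-size (suc k) e I id-I size with x , mx , size′ ← removable I (k + e) size =
    ideal-of-size k e (I ─₁ x) (ideal-remove id-I mx) size′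

  dimension : ∀ d′ → AffDim V d′ → d′ ≡ d
  dimension d′ ((σs , vs , indep) , maximal) = ℕₚ.≤-antisym
    (ℕₚ.≮⇒≥ λ d<d′ → affinely-dependent σs (s≤s d<d′) vs indep)
    -- An ideal of d′ + 1 elements starts a chain of d′ + 2 ideals, one vertex more than the
    -- dimension d′ allows.
    (ℕₚ.≮⇒≥ λ d′<d → case ideal-of-size (d ∸ suc d′) (suc d′) Subset.⊤ (λ _ _ _ _ → Subsetₚ.∈⊤)
                          (trans (Subsetₚ.∣⊤∣≡n d) (sym (ℕₚ.m∸n+n≡m d′<d))) of λ
      { (I , id-I , size) → case chain (suc d′) I id-I size of λ
        { (fs , us , _ , ind) → case vertices us of λ
          { (σs′ , vs′ , reps) → maximal σs′ vs′ (affinely-independent reps ind) } } })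

  h*-palindromic : HStarPalindromic V
  h*-palindromic L counts d′ dim =
    subst (λ e → Palindromic (hstar e L)) (sym (dimension d′ dim))
      (palindromic L λ m 1≤m → counts⇒Ω m (L m) (counts m 1≤m))

-- Regions of the grid and their lattice paths

χ : ∀ {A : Set} → Dec A → ℕ
χ (yes _) = 1
χ (no  _) = 0

χ-yes : ∀ {A : Set} (a? : Dec A) → A → χ a? ≡ 1
χ-yes (yes _) a = refl
χ-yes (no ¬a) a = contradiction a ¬a

χ-no : ∀ {A : Set} (a? : Dec A) → ¬ A → χ a? ≡ 0
χ-no (yes a) ¬a = contradiction a ¬a
χ-no (no _)  ¬a = refl

χ-≤1 : ∀ {A : Set} (a? : Dec A) → χ a? ≤ 1
χ-≤1 (yes _) = ℕₚ.≤-refl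
χ-≤1 (no _)  = z≤n

χ-mono : ∀ {A B : Set} (a? : Dec A) (b? : Dec B) → (A → B) → χ a? ≤ χ b?
χ-mono (no _)  b? f = z≤n
χ-mono (yes a) b? f = ℕₚ.≤-reflexive (sym (χ-yes b? (f a)))

χ-mono⁻ : ∀ {A B : Set} (a? : Dec A) (b? : Dec B) → χ a? ≤ χ b? → A → B
χ-mono⁻ a?      (yes b) le a = b
χ-mono⁻ (yes _) (no _)  () a
χ-mono⁻ (no ¬a) (no _)  le a = contradiction a ¬a

χ-cong : ∀ {A B : Set} (a? : Dec A) (b? : Dec B) → (A → B) → (B → A) → χ a? ≡ χ b?
χ-cong a? b? f g = ℕₚ.≤-antisym (χ-mono a? b? f) (χ-mono b? a? g)

χ-diff : ∀ a v → + χ (v ℕ.≤? a) ℤ.- + χ (suc v ℕ.≤? a) ≡ + χ (a ℕ.≟ v)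
χ-diff a v with v ℕ.≤? a | suc v ℕ.≤? a | a ℕ.≟ v
... | yes _   | yes _   | no _    = refl
... | yes _   | no _    | yes _   = refl
... | no _    | no _    | no _    = refl
... | _       | yes v<a | yes a≡v = contradiction (sym a≡v) (ℕₚ.<⇒≢ v<a)
... | yes v≤a | no v≮a  | no a≢v  = contradiction (ℕₚ.≤-antisym (ℕₚ.≮⇒≥ v≮a) v≤a) a≢v
... | no v≰a  | _       | yes a≡v = contradiction (ℕₚ.≤-reflexive (sym a≡v)) v≰a
... | no v≰a  | yes v<a | no _    = contradiction (ℕₚ.<⇒≤ v<a) v≰a

-- Truncation is harmless: for v < k both conditions hold.
χ-∸ : ∀ a k v → χ (v ∸ k ℕ.≤? a) ≡ χ (v ℕ.≤? a + k)
χ-∸ a k v = χ-cong (v ∸ k ℕ.≤? a) (v ℕ.≤? a + k)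
  (λ le → subst (v ≤_) (ℕₚ.+-comm k a) (ℕₚ.≤-trans (ℕₚ.m≤n+m∸n v k) (ℕₚ.+-monoʳ-≤ k le)))
  (λ le → ℕₚ.m≤n+o⇒m∸n≤o v k (subst (v ≤_) (ℕₚ.+-comm a k) le))

threshold : (ℕ → ℕ) → ℕ → ℕ
threshold g zero = zero
threshold g (suc U) with g (suc U) ℕ.≟ 0
... | yes _ = threshold g U
... | no  _ = suc U

antitone : ∀ {g : ℕ → ℕ} → (∀ j → g (suc j) ≤ g j) → ∀ {i j} → i ≤ j → g j ≤ g i
antitone {g} anti {i} {j} i≤j = subst (λ k → g k ≤ g i) (ℕₚ.m∸n+n≡m i≤j) (go (j ∸ i))
  where
  go : ∀ k → g (k + i) ≤ g i
  go zero    = ℕₚ.≤-refl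
  go (suc k) = ℕₚ.≤-trans (anti (k + i)) (go k)

threshold-χ : ∀ g U → (∀ j → g (suc j) ≤ g j) → (∀ j → g j ≤ 1) → g 0 ≡ 1 → (∀ j → U < j → g j ≡ 0) →
  ∀ j → g j ≡ χ (j ℕ.≤? threshold g U)
threshold-χ g zero anti ≤1 g0 gU zero = g0
threshold-χ g zero anti ≤1 g0 gU (suc j) = gU (suc j) (s≤s z≤n)
threshold-χ g (suc U) anti ≤1 g0 gU j with g (suc U) ℕ.≟ 0
... | yes gU≡0 = threshold-χ g U anti ≤1 g0
  (λ j U<j → ℕₚ.n≤0⇒n≡0 (subst (g j ≤_) gU≡0 (antitone anti U<j))) j
... | no gU≢0 with j ℕ.≤? suc U
...   | yes j≤ = ℕₚ.≤-antisym (≤1 j) (ℕₚ.≤-trans (ℕₚ.n≢0⇒n>0 gU≢0) (antitone anti j≤))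
...   | no j≰  = gU j (ℕₚ.≰⇒> j≰)

-- Implications between the conditions j ≤ α t: a path rises by at most one, so j + 1 ≤ α (t + 1)
-- gives j ≤ α t, and it never falls, so j ≤ α t gives j ≤ α (t + 1).
Below : ℕ × ℕ → ℕ × ℕ → Set
Below (t , j) (t′ , j′) = (t ≡ suc t′ × j ≡ suc j′) ⊎ (t′ ≡ suc t × j′ ≡ j)

-- The cells (t, j) with t ≤ T and l t < j ≤ u t. A path with heights α t ∈ [l t, u t] is the order ideal
-- of the cells with j ≤ α t. The poset is graded by t - 2j, shifted by offset.
record Region : Set where
  field
    T   : ℕ
    l u : ℕ → ℕ
    u≤  : ∀ t → u t ≤ t
    l≤u : ∀ t → t ≤ T → l t ≤ u t
    l-mono : ∀ t → l t ≤ l (suc t)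
    l-step : ∀ t → l (suc t) ≤ suc (l t)
    u-mono : ∀ t → u t ≤ u (suc t)
    u-step : ∀ t → u (suc t) ≤ suc (u t)
  Cell : ℕ × ℕ → Set
  Cell (t , j) = t ≤ T × l t < j × j ≤ u t
  field
    offset height : ℕ
    -- The rank of a cell is t + offset - 2j; from here on its bounds are stated with 2j on the
    -- other side, free of truncated subtraction.
    offset-pos   : ∀ {t j} → Cell (t , j) → j + j < t + offset
    height-bound : ∀ {t j} → Cell (t , j) → t + offset ≤ height + (j + j)
    cell-up   : ∀ {t j} → Cell (t , j) → t + offset < height + (j + j) → ∃[ c ] (Cell c × Below (t , j) c)
    cell-down : ∀ {t j} → Cell (t , j) → suc (j + j) < t + offset → ∃[ c ] (Cell c × Below c (t , j))
    cell-top  : height ≡ 0 ⊎ (∃[ t ] ∃[ j ] (Cell (t , j) × t + offset ≡ height + (j + j)))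

module RegionPoset (ℛ : Region) where
  open Region ℛ

  cell? : Decidable Cell
  cell? (t , j) = (t ℕ.≤? T) ×-dec (l t ℕ.<? j) ×-dec (j ℕ.≤? u t)

  cells : List (ℕ × ℕ)
  cells = filter cell? (List.cartesianProduct (upTo (suc T)) (upTo (suc T)))

  d : ℕ
  d = length cells

  cell : Fin d → ℕ × ℕ
  cell = List.lookup cells

  col row : Fin d → ℕ
  col = proj₁ ∘ cell
  row = proj₂ ∘ cell

  cell-Cell : ∀ p → Cell (cell p)
  cell-Cell p = proj₂ (∈-filter⁻ cell? {xs = List.cartesianProduct (upTo (suc T)) (upTo (suc T))}
                         (∈-lookup {xs = cells} p))

  Cell-∈ : ∀ {c} → Cell c → c ∈ cells
  Cell-∈ {t , j} c@(t≤T , _ , j≤u) = ∈-filter⁺ cell?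
    (∈-cartesianProduct⁺ (∈-upTo⁺ (s≤s t≤T)) (∈-upTo⁺ (s≤s (ℕₚ.≤-trans j≤u (ℕₚ.≤-trans (u≤ t) t≤T))))) c

  at : ∀ {c} → Cell c → Fin d
  at c = index (Cell-∈ c)

  cell-at : ∀ {c} (cc : Cell c) → cell (at cc) ≡ c
  cell-at cc = sym (lookup-index (Cell-∈ cc))

  cell-injective : ∀ {p q} → cell p ≡ cell q → p ≡ q
  cell-injective = lookup-Unique (Uniqueₚ.filter⁺ cell?
    (Uniqueₚ.cartesianProduct⁺ (Uniqueₚ.upTo⁺ (suc T)) (Uniqueₚ.upTo⁺ (suc T)))) _ _
    where
    lookup-Unique : ∀ {A : Set} {xs : List A} → Unique xs → ∀ i j →
      List.lookup xs i ≡ List.lookup xs j → i ≡ j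
    lookup-Unique (_ ∷ _) zero zero _ = refl
    lookup-Unique {xs = _ ∷ xs} (x∉ ∷ _) zero (suc j) eq = contradiction eq (All.lookup x∉ (∈-lookup {xs = xs} j))
    lookup-Unique {xs = _ ∷ xs} (x∉ ∷ _) (suc i) zero eq = contradiction (sym eq) (All.lookup x∉ (∈-lookup {xs = xs} i))
    lookup-Unique (_ ∷ u) (suc i) (suc j) eq = cong suc (lookup-Unique u i j eq)

  below? : ∀ c c′ → Dec (Below c c′)
  below? (t , j) (t′ , j′) = ((t ℕ.≟ suc t′) ×-dec (j ℕ.≟ suc j′)) ⊎-dec ((t′ ℕ.≟ suc t) ×-dec (j′ ℕ.≟ j))

  cell-rank : ℕ × ℕ → ℕ
  cell-rank (t , j) = t + offset ∸ (j + j)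

  rank-below : ∀ {c c′} → Cell c → Below c c′ → cell-rank c′ ≡ suc (cell-rank c)
  rank-below {suc t , suc j} cc (inj₁ (refl , refl)) = begin
    t + offset ∸ (j + j)                ≡⟨ ℕₚ.+-∸-assoc 1 {t + offset} {suc (j + j)} (ℕ.s≤s⁻¹ lt) ⟩
    suc (t + offset ∸ suc (j + j))      ≡⟨ cong (λ k → suc (t + offset ∸ k)) (ℕₚ.+-suc j j) ⟨
    suc (t + offset ∸ (j + suc j))      ∎
    where
    open ≡-Reasoning
    lt : suc (suc (j + j)) ≤ suc (t + offset)
    lt = ℕₚ.≤-trans (ℕₚ.≤-reflexive (cong suc (sym (ℕₚ.+-suc j j)))) (ℕₚ.<⇒≤ (offset-pos cc))
  rank-below {t , j} cc (inj₂ (refl , refl)) = ℕₚ.+-∸-assoc 1 (ℕₚ.<⇒≤ (offset-pos cc))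

  poset : GradedPoset d
  poset = record
    { _⋖_      = λ p q → Below (cell p) (cell q)
    ; _⋖?_     = λ p q → below? (cell p) (cell q)
    ; rank     = cell-rank ∘ cell
    ; height   = height
    ; rank-⋖   = λ {p} → rank-below (cell-Cell p)
    ; rank-pos = λ p → ℕₚ.m<n⇒0<n∸m (offset-pos (cell-Cell p))
    ; rank-≤   = λ p → ℕₚ.m≤n+o⇒m∸n≤o (col p + offset) (row p + row p)
        (subst (col p + offset ≤_) (ℕₚ.+-comm height _) (height-bound (cell-Cell p)))
    ; up       = λ p lt → let c , cc , below = cell-up (cell-Cell p) (rank-< p lt)
                          in at cc , subst (Below (cell p)) (sym (cell-at cc)) below
    ; down     = λ p lt → let c , cc , below = cell-down (cell-Cell p) (<-rank p lt)
                          in at cc , subst (λ c → Below c (cell p)) (sym (cell-at cc)) below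
    ; top      = case cell-top of λ
        { (inj₁ h≡0) → inj₁ h≡0
        ; (inj₂ (t , j , cc , eq)) → inj₂ (at cc , trans (cong cell-rank (cell-at cc))
            (trans (cong (_∸ (j + j)) eq) (ℕₚ.m+n∸n≡m height (j + j)))) }
    }
    where
    rank-< : ∀ p → cell-rank (cell p) < height → col p + offset < height + (row p + row p)
    rank-< p lt = subst (_< height + (row p + row p))
      (ℕₚ.m∸n+n≡m (ℕₚ.<⇒≤ (offset-pos (cell-Cell p)))) (ℕₚ.+-monoˡ-< (row p + row p) lt)
    <-rank : ∀ p → 1 < cell-rank (cell p) → suc (row p + row p) < col p + offset
    <-rank p lt = subst (suc (row p + row p) <_)
      (ℕₚ.m∸n+n≡m (ℕₚ.<⇒≤ (offset-pos (cell-Cell p)))) (ℕₚ.+-monoˡ-< (row p + row p) lt)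

  -- The homogenised condition j ≤ α t on the whole grid: rows up to l t lie under every path and
  -- carry the constant m in place of 1, all other positions off the region carry 0.
  grid : (Fin d → ℤ) → ℤ → ℕ → ℕ → ℤ
  grid y m t j with cell? (t , j)
  ... | yes c = y (at c)
  ... | no _ with j ℕ.≤? l t
  ...   | yes _ = m
  ...   | no  _ = 0ℤ

  grid-linear : ∀ t j → Linear (λ y m → grid y m t j)
  grid-linear t j c y≡ m≡ with cell? (t , j)
  ... | yes cc = y≡ (at cc)
  ... | no _ with j ℕ.≤? l t
  ...   | yes _ = m≡
  ...   | no  _ = trans (sym (ℤₚ.*-zeroʳ c)) (sym (ℤₚ.+-identityʳ _))

  grid-cell : ∀ y m p → grid y m (col p) (row p) ≡ y p
  grid-cell y m p with cell? (col p , row p)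
  ... | yes c = cong y (cell-injective (cell-at c))
  ... | no ¬c = contradiction (cell-Cell p) ¬c

  grid-low : ∀ y m t j → j ≤ l t → grid y m t j ≡ m
  grid-low y m t j j≤l with cell? (t , j)
  ... | yes (_ , l<j , _) = contradiction j≤l (ℕₚ.<⇒≱ l<j)
  ... | no _ with j ℕ.≤? l t
  ...   | yes _ = refl
  ...   | no j≰l = contradiction j≤l j≰l

  grid-high : ∀ y m t j → l t < j → u t < j → grid y m t j ≡ 0ℤ
  grid-high y m t j l<j u<j with cell? (t , j)
  ... | yes (_ , _ , j≤u) = contradiction j≤u (ℕₚ.<⇒≱ u<j)
  ... | no _ with j ℕ.≤? l t
  ...   | yes j≤l = contradiction j≤l (ℕₚ.<⇒≱ l<j)
  ...   | no _ = refl

  record Path (α : ℕ → ℕ) : Set where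
    field
      lower : ∀ t → t ≤ T → l t ≤ α t
      upper : ∀ t → t ≤ T → α t ≤ u t
      mono  : ∀ t → t < T → α t ≤ α (suc t)
      step  : ∀ t → t < T → α (suc t) ≤ suc (α t)

  open OrderPolytope poset using (Weak)

  module _ {α} (path : Path α) where
    open Path path

    pathIdeal : Fin d → ℕ
    pathIdeal p = χ (row p ℕ.≤? α (col p))

    pathIdeal-weak : Weak pathIdeal
    pathIdeal-weak p q p⋖q = go (cell p) (cell q) (cell-Cell p) (cell-Cell q) p⋖q
      where
      go : ∀ c c′ → Cell c → Cell c′ → Below c c′ →
        χ (proj₂ c ℕ.≤? α (proj₁ c)) ≤ χ (proj₂ c′ ℕ.≤? α (proj₁ c′))
      go (suc t , suc j) (_ , _) (t<T , _) _ (inj₁ (refl , refl)) =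
        χ-mono (suc j ℕ.≤? _) (j ℕ.≤? _) λ le → ℕ.s≤s⁻¹ (ℕₚ.≤-trans le (step t t<T))
      go (t , j) (_ , _) _ (t<T , _) (inj₂ (refl , refl)) =
        χ-mono (j ℕ.≤? _) (j ℕ.≤? _) λ le → ℕₚ.≤-trans le (mono t t<T)

    grid-path : ∀ t j → t ≤ T → grid (+_ ∘ pathIdeal) 1ℤ t j ≡ + χ (j ℕ.≤? α t)
    grid-path t j t≤T with cell? (t , j)
    ... | yes c rewrite cell-at c = refl
    ... | no ¬c with j ℕ.≤? l t
    ...   | yes j≤l = cong +_ (sym (χ-yes (j ℕ.≤? α t) (ℕₚ.≤-trans j≤l (lower t t≤T))))
    ...   | no j≰l = cong +_ (sym (χ-no (j ℕ.≤? α t)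
      λ j≤α → ¬c (t≤T , ℕₚ.≰⇒> j≰l , ℕₚ.≤-trans j≤α (upper t t≤T))))

  module _ {f : Fin d → ℕ} (weak : Weak f) (f≤1 : ∀ p → f p ≤ 1) where

    gridℕ : ℕ → ℕ → ℕ
    gridℕ t j with cell? (t , j)
    ... | yes c = f (at c)
    ... | no _ = χ (j ℕ.≤? l t)

    grid-gridℕ : ∀ t j → grid (+_ ∘ f) 1ℤ t j ≡ + gridℕ t j
    grid-gridℕ t j with cell? (t , j)
    ... | yes c = refl
    ... | no _ with j ℕ.≤? l t
    ...   | yes _ = refl
    ...   | no  _ = refl

    gridℕ-≤1 : ∀ t j → gridℕ t j ≤ 1
    gridℕ-≤1 t j with cell? (t , j)
    ... | yes c = f≤1 (at c)
    ... | no _ = χ-≤1 (j ℕ.≤? l t)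

    weak-at : ∀ {c c′} (cc : Cell c) (cc′ : Cell c′) → Below c c′ → f (at cc) ≤ f (at cc′)
    weak-at cc cc′ below = weak _ _ (subst₂ Below (sym (cell-at cc)) (sym (cell-at cc′)) below)

    gridℕ-diagonal : ∀ t j → t < T → gridℕ (suc t) (suc j) ≤ gridℕ t j
    gridℕ-diagonal t j t<T with cell? (suc t , suc j) | cell? (t , j)
    ... | yes c | yes c′ = weak-at c c′ (inj₁ (refl , refl))
    ... | yes c@(_ , _ , j<u) | no ¬c′ = ℕₚ.≤-trans (f≤1 (at c)) (ℕₚ.≤-reflexive (sym (χ-yes (j ℕ.≤? l t)
      (ℕₚ.≮⇒≥ λ l<j → ¬c′ (ℕₚ.<⇒≤ t<T , l<j , ℕ.s≤s⁻¹ (ℕₚ.≤-trans j<u (u-step t)))))))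
    ... | no _ | no _ = χ-mono (suc j ℕ.≤? _) (j ℕ.≤? _) λ le → ℕ.s≤s⁻¹ (ℕₚ.≤-trans le (l-step t))
    ... | no _ | yes (_ , l<j , _) = ℕₚ.≤-trans (ℕₚ.≤-reflexive (χ-no (suc j ℕ.≤? l (suc t))
      λ le → ℕₚ.<⇒≱ l<j (ℕ.s≤s⁻¹ (ℕₚ.≤-trans le (l-step t))))) z≤n

    gridℕ-horizontal : ∀ t j → t < T → gridℕ t j ≤ gridℕ (suc t) j
    gridℕ-horizontal t j t<T with cell? (t , j) | cell? (suc t , j)
    ... | yes c | yes c′ = weak-at c c′ (inj₂ (refl , refl))
    ... | yes c@(_ , _ , j≤u) | no ¬c′ = ℕₚ.≤-trans (f≤1 (at c)) (ℕₚ.≤-reflexive (sym (χ-yes (j ℕ.≤? l (suc t))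
      (ℕₚ.≮⇒≥ λ l<j → ¬c′ (t<T , l<j , ℕₚ.≤-trans j≤u (u-mono t))))))
    ... | no _ | no _ = χ-mono (j ℕ.≤? _) (j ℕ.≤? _) λ le → ℕₚ.≤-trans le (l-mono t)
    ... | no _ | yes (_ , l<j , _) = ℕₚ.≤-trans (ℕₚ.≤-reflexive (χ-no (j ℕ.≤? l t)
      λ le → ℕₚ.<⇒≱ l<j (ℕₚ.≤-trans le (l-mono t)))) z≤n

    -- A diagonal comparison followed by a horizontal one, through row j of the previous column.
    -- Column 0 contains no cell, as u 0 ≤ 0.
    gridℕ-antitone : ∀ t → t ≤ T → ∀ j → gridℕ t (suc j) ≤ gridℕ t j
    gridℕ-antitone zero _ j with cell? (0 , suc j) | cell? (0 , j)
    ... | yes (_ , _ , j<u) | _ = contradiction (ℕₚ.≤-trans j<u (u≤ 0)) λ ()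
    ... | no _ | yes (_ , l<j , j≤u) = contradiction (ℕₚ.≤-trans l<j (ℕₚ.≤-trans j≤u (u≤ 0))) λ ()
    ... | no _ | no _ = χ-mono (suc j ℕ.≤? _) (j ℕ.≤? _) ℕₚ.<⇒≤
    gridℕ-antitone (suc t) t<T j = ℕₚ.≤-trans (gridℕ-diagonal t j t<T) (gridℕ-horizontal t j t<T)

    gridℕ-low : ∀ t j → j ≤ l t → gridℕ t j ≡ 1
    gridℕ-low t j j≤l = ℤₚ.+-injective (trans (sym (grid-gridℕ t j)) (grid-low _ _ t j j≤l))

    gridℕ-high : ∀ t j → l t < j → u t < j → gridℕ t j ≡ 0
    gridℕ-high t j l<j u<j = ℤₚ.+-injective (trans (sym (grid-gridℕ t j)) (grid-high _ _ t j l<j u<j))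

    heights : ℕ → ℕ
    heights t = threshold (gridℕ t) (u t)

    gridℕ-heights : ∀ t j → t ≤ T → gridℕ t j ≡ χ (j ℕ.≤? heights t)
    gridℕ-heights t j t≤T = threshold-χ (gridℕ t) (u t) (gridℕ-antitone t t≤T) (gridℕ-≤1 t)
      (gridℕ-low t 0 z≤n) (λ j u<j → gridℕ-high t j (ℕₚ.≤-<-trans (l≤u t t≤T) u<j) u<j) j

    grid-heights : ∀ t j → t ≤ T → grid (+_ ∘ f) 1ℤ t j ≡ + χ (j ℕ.≤? heights t)
    grid-heights t j t≤T = trans (grid-gridℕ t j) (cong +_ (gridℕ-heights t j t≤T))

    heights-path : Path heights
    heights-path = record
      { lower = λ t t≤T → χ⁻ (l t ℕ.≤? heights t) (trans (sym (gridℕ-heights t (l t) t≤T)) (gridℕ-low t (l t) ℕₚ.≤-refl))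
      ; upper = λ t t≤T → ℕₚ.≮⇒≥ λ u<α → case trans (sym (χ-yes (heights t ℕ.≤? heights t) ℕₚ.≤-refl))
          (trans (sym (gridℕ-heights t (heights t) t≤T))
            (gridℕ-high t (heights t) (ℕₚ.≤-<-trans (l≤u t t≤T) u<α) u<α)) of λ ()
      ; mono = λ t t<T → χ-mono⁻ (heights t ℕ.≤? heights t) (heights t ℕ.≤? heights (suc t))
          (subst₂ _≤_ (gridℕ-heights t _ (ℕₚ.<⇒≤ t<T)) (gridℕ-heights (suc t) _ t<T)
            (gridℕ-horizontal t (heights t) t<T)) ℕₚ.≤-refl
      ; step = λ t t<T → ℕₚ.≮⇒≥ λ lt → ℕₚ.<-irrefl refl
          (χ-mono⁻ (suc (suc (heights t)) ℕ.≤? heights (suc t)) (suc (heights t) ℕ.≤? heights t)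
            (subst₂ _≤_ (gridℕ-heights (suc t) _ t<T) (gridℕ-heights t _ (ℕₚ.<⇒≤ t<T))
              (gridℕ-diagonal t (suc (heights t)) t<T)) lt)
      }
      where
      χ⁻ : ∀ {A : Set} (a? : Dec A) → χ a? ≡ 1 → A
      χ⁻ (yes a) _ = a

-- Permutations as functions on ℕ

module PermValues {n : ℕ} (σ : Perm n) where

  -- The junk value 0 is taken at the arguments ≥ n.
  val : ℕ → ℕ
  val k with k ℕ.<? n
  ... | yes k<n = toℕ (σ at fromℕ< k<n)
  ... | no  _   = 0

  val-toℕ : ∀ i → val (toℕ i) ≡ toℕ (σ at i)
  val-toℕ i with toℕ i ℕ.<? n
  ... | yes i<n = cong (λ j → toℕ (σ at j)) (Finₚ.fromℕ<-toℕ i i<n)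
  ... | no i≮n  = contradiction (Finₚ.toℕ<n i) i≮n

  val-fromℕ< : ∀ {k} (k<n : k < n) → val k ≡ toℕ (σ at fromℕ< k<n)
  val-fromℕ< k<n = trans (cong val (sym (Finₚ.toℕ-fromℕ< k<n))) (val-toℕ (fromℕ< k<n))

  val-< : ∀ {k} → k < n → val k < n
  val-< k<n = subst (_< n) (sym (val-fromℕ< k<n)) (Finₚ.toℕ<n _)

  val-injective : ∀ {i j} → i < n → j < n → val i ≡ val j → i ≡ j
  val-injective {i} {j} i<n j<n eq = begin
    i                  ≡⟨ Finₚ.toℕ-fromℕ< i<n ⟨
    toℕ (fromℕ< i<n)   ≡⟨ cong toℕ (proj₂ σ (Finₚ.toℕ-injective
                            (trans (sym (val-fromℕ< i<n)) (trans eq (val-fromℕ< j<n))))) ⟩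
    toℕ (fromℕ< j<n)   ≡⟨ Finₚ.toℕ-fromℕ< j<n ⟩
    j                  ∎
    where open ≡-Reasoning

  -- Punching out a missed value would give an injection of `Fin (suc n)` into `Fin n`.
  injective⇒surjective : ∀ {n} {f : Fin n → Fin n} → Injective _≡_ _≡_ f → ∀ w → ∃[ i ] f i ≡ w
  injective⇒surjective {suc n} {f} inj w with any? (λ i → f i Finₚ.≟ w)
  ... | yes found = found
  ... | no none = contradiction
    (Finₚ.injective⇒≤ {f = λ i → punchOut {i = w} {f i} λ eq → none (i , sym eq)}
      λ {x} {y} eq → inj (Finₚ.punchOut-injective (λ e → none (x , sym e)) (λ e → none (y , sym e)) eq)) (ℕₚ.<⇒≱ (ℕₚ.n<1+n n))

  val-surjective : ∀ {w} → w < n → ∃[ i ] (i < n × val i ≡ w)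
  val-surjective w<n with i , eq ← injective⇒surjective (proj₂ σ) (fromℕ< w<n) =
    toℕ i , Finₚ.toℕ<n i , trans (val-toℕ i) (trans (cong toℕ eq) (Finₚ.toℕ-fromℕ< w<n))

  permMatrix-χ : ∀ i j → permMatrix σ i j ≡ + χ (val (toℕ i) ℕ.≟ toℕ j)
  permMatrix-χ i j with (σ at i) Finₚ.≟ j
  ... | yes eq = cong +_ (sym (χ-yes (val (toℕ i) ℕ.≟ toℕ j) (trans (val-toℕ i) (cong toℕ eq))))
  ... | no neq = cong +_ (sym (χ-no (val (toℕ i) ℕ.≟ toℕ j)
    λ eq → neq (Finₚ.toℕ-injective (trans (sym (val-toℕ i)) eq))))

  val-<-fromℕ< : ∀ {i j} (i<n : i < n) (j<n : j < n) → val i < val j →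
    toℕ (σ at fromℕ< i<n) < toℕ (σ at fromℕ< j<n)
  val-<-fromℕ< i<n j<n = subst₂ _<_ (val-fromℕ< i<n) (val-fromℕ< j<n)

  fromℕ<-mono : ∀ {i j} (i<n : i < n) (j<n : j < n) → i < j → toℕ (fromℕ< i<n) < toℕ (fromℕ< j<n)
  fromℕ<-mono i<n j<n = subst₂ _<_ (sym (Finₚ.toℕ-fromℕ< i<n)) (sym (Finₚ.toℕ-fromℕ< j<n))

  module _ {i j k} (i<j : i < j) (j<k : j < k) (k<n : k < n) where
    private
      j<n = ℕₚ.<-trans j<k k<n
      i<n = ℕₚ.<-trans i<j j<n

    contains132 : val i < val k → val k < val j → Contains132 σ
    contains132 a b = _ , _ , _ , fromℕ<-mono i<n j<n i<j , fromℕ<-mono j<n k<n j<k ,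
      val-<-fromℕ< i<n k<n a , val-<-fromℕ< k<n j<n b

    contains312 : val j < val k → val k < val i → Contains312 σ
    contains312 a b = _ , _ , _ , fromℕ<-mono i<n j<n i<j , fromℕ<-mono j<n k<n j<k ,
      val-<-fromℕ< j<n k<n a , val-<-fromℕ< k<n i<n b

    contains123 : val i < val j → val j < val k → Contains123 σ
    contains123 a b = _ , _ , _ , fromℕ<-mono i<n j<n i<j , fromℕ<-mono j<n k<n j<k ,
      val-<-fromℕ< i<n j<n a , val-<-fromℕ< j<n k<n b

module MakePerm {n : ℕ} (s : ℕ → ℕ) (s-< : ∀ {k} → k < n → s k < n)
  (s-injective : ∀ {i j} → i < n → j < n → s i ≡ s j → i ≡ j) where

  perm : Perm n
  perm = (λ i → fromℕ< (s-< (Finₚ.toℕ<n i))) ,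
    λ {i} {j} eq → Finₚ.toℕ-injective (s-injective (Finₚ.toℕ<n i) (Finₚ.toℕ<n j)
      (trans (sym (Finₚ.toℕ-fromℕ< _)) (trans (cong toℕ eq) (Finₚ.toℕ-fromℕ< _))))

  perm-at : ∀ i → toℕ (perm at i) ≡ s (toℕ i)
  perm-at i = Finₚ.toℕ-fromℕ< _

  perm-<⁻ : ∀ {i j} → toℕ (perm at i) < toℕ (perm at j) → s (toℕ i) < s (toℕ j)
  perm-<⁻ {i} {j} = subst₂ _<_ (perm-at i) (perm-at j)

  perm-<⁺ : ∀ {i j} → s (toℕ i) < s (toℕ j) → toℕ (perm at i) < toℕ (perm at j)
  perm-<⁺ {i} {j} = subst₂ _<_ (sym (perm-at i)) (sym (perm-at j))

  permMatrix-perm : ∀ i j → permMatrix perm i j ≡ + χ (s (toℕ i) ℕ.≟ toℕ j)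
  permMatrix-perm i j = trans (permMatrix-χ i j) (cong +_ (χ-cong (val (toℕ i) ℕ.≟ toℕ j) (s (toℕ i) ℕ.≟ toℕ j)
    (trans (sym (trans (val-toℕ i) (perm-at i)))) (trans (trans (val-toℕ i) (perm-at i)))))
    where open PermValues perm

  val-perm : ∀ {k} → k < n → PermValues.val perm k ≡ s k
  val-perm {k} k<n = trans (val-fromℕ< k<n) (trans (perm-at (fromℕ< k<n)) (cong s (Finₚ.toℕ-fromℕ< k<n)))
    where open PermValues perm

  s-surjective : ∀ {w} → w < n → ∃[ k ] (k < n × s k ≡ w)
  s-surjective w<n = case PermValues.val-surjective perm w<n of λ
    { (k , k<n , eq) → k , k<n , trans (sym (val-perm k<n)) eq }

Linear-minus : ∀ {d} {F G : (Fin d → ℤ) → ℤ → ℤ} → Linear F → Linear G → Linear (λ y m → F y m ℤ.- G y m)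
Linear-minus {F = F} {G} F-lin G-lin c {y} {y′} {m = m} {m′} y≡ m≡ =
  trans (cong₂ ℤ._-_ (F-lin c y≡ m≡) (G-lin c y≡ m≡)) (arith c (F y m) (F y′ m′) (G y m) (G y′ m′))
  where
  arith : ∀ c a b a′ b′ → (c ℤ.* a ℤ.+ b) ℤ.- (c ℤ.* a′ ℤ.+ b′) ≡ c ℤ.* (a ℤ.- a′) ℤ.+ (b ℤ.- b′)
  arith = solve-∀

emptyPoset : GradedPoset 0
emptyPoset = record
  { _⋖_ = λ () ; _⋖?_ = λ () ; rank = λ () ; height = 0 ; rank-⋖ = λ {} ; rank-pos = λ ()
  ; rank-≤ = λ () ; up = λ () ; down = λ () ; top = inj₁ refl }

-- The model for 132 and 312 is parametrised by T = n - 1; this is the remaining case n = 0, a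
-- single point.
emptyModel : {V : Perm 0 → Set} → (∀ σ → V σ) → OrderModel V emptyPoset
emptyModel all = record
  { matrix = λ () ; matrix-linear = λ () ; matrix-∣ = λ _ _ _ _ _ ()
  ; ideal  = λ σ _ → (λ ()) , ((λ ()) , λ ()) , λ ()
  ; vertex = λ f u → ((λ ()) , λ {}) , all _ , u , λ () }

∸-suc : ∀ {k T} → suc k ≤ T → T ∸ k ≡ suc (T ∸ suc k)
∸-suc {k} {suc T} (s≤s k≤T) = ℕₚ.+-∸-assoc 1 k≤T

-- Permutations avoiding 132 and 312

module Interval (T : ℕ) where

  private
    n : ℕ
    n = suc T

  region : Region
  region = record
    { T = T ; l = λ _ → 0 ; u = id
    ; u≤ = λ _ → ℕₚ.≤-refl ; l≤u = λ _ _ → z≤n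
    ; l-mono = λ _ → z≤n ; l-step = λ _ → z≤n ; u-mono = ℕₚ.n≤1+n ; u-step = λ _ → ℕₚ.≤-refl
    -- The rank t + T + 1 - 2j runs from 1 at the cell (T, T) to 2T - 1 at (T, 1); for T = 0 there
    -- is no cell and `pred` gives 0.
    ; offset = suc T ; height = ℕ.pred (T + T)
    ; offset-pos = λ {t} {j} (t≤T , _ , j≤t) → subst (j + j <_) (sym (ℕₚ.+-suc t T))
        (s≤s (ℕₚ.+-mono-≤ j≤t (ℕₚ.≤-trans j≤t t≤T)))
    ; height-bound = bound
    ; cell-up = up
    ; cell-down = down
    ; cell-top = top
    }
    where
    Cell′ : ℕ × ℕ → Set
    Cell′ (t , j) = t ≤ T × 0 < j × j ≤ t
    height≡ : 1 ≤ T → ℕ.pred (T + T) + 2 ≡ T + suc T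
    height≡ (s≤s {n = T′} _) = trans (ℕₚ.+-comm (T′ + suc T′) 2) (cong suc (sym (ℕₚ.+-suc T′ (suc T′))))
    bound : ∀ {t j} → Cell′ (t , j) → t + suc T ≤ ℕ.pred (T + T) + (j + j)
    bound {t} {suc j} (t≤T , _ , j≤t) = ℕₚ.≤-trans (ℕₚ.+-monoˡ-≤ (suc T) t≤T)
      (subst (_≤ ℕ.pred (T + T) + (suc j + suc j)) (height≡ (ℕₚ.≤-trans (s≤s z≤n) (ℕₚ.≤-trans j≤t t≤T)))
        (ℕₚ.+-monoʳ-≤ (ℕ.pred (T + T)) (ℕₚ.+-mono-≤ {1} {suc j} (s≤s z≤n) (s≤s z≤n))))
    up : ∀ {t j} → Cell′ (t , j) → t + suc T < ℕ.pred (T + T) + (j + j) → ∃[ c ] (Cell′ c × Below (t , j) c)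
    up {t} {j} (t≤T , 0<j , j≤t) lt with t ℕ.<? T
    ... | yes t<T = (suc t , j) , (t<T , 0<j , ℕₚ.m≤n⇒m≤1+n j≤t) , inj₂ (refl , refl)
    up {suc t} {suc zero} (t≤T , _ , _) lt | no t≮T with refl ← ℕₚ.≤-antisym t≤T (ℕₚ.≮⇒≥ t≮T) =
      contradiction (sym (height≡ (s≤s z≤n))) (ℕₚ.<⇒≢ lt)
    up {suc t} {suc (suc j)} (t≤T , _ , s≤s j≤t) lt | no _ =
      (t , suc j) , (ℕₚ.<⇒≤ t≤T , s≤s z≤n , j≤t) , inj₁ (refl , refl)
    down : ∀ {t j} → Cell′ (t , j) → suc (j + j) < t + suc T → ∃[ c ] (Cell′ c × Below c (t , j))
    down {t} {j} (t≤T , 0<j , j≤t) lt with t ℕ.<? T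
    ... | yes t<T = (suc t , suc j) , (t<T , s≤s z≤n , s≤s j≤t) , inj₁ (refl , refl)
    down {suc t} {j} (t≤T , 0<j , j≤t) lt | no t≮T with j ℕ.≤? t
    ... | yes j≤ = (t , j) , (ℕₚ.<⇒≤ t≤T , 0<j , j≤) , inj₂ (refl , refl)
    ... | no j≰ with refl ← ℕₚ.≤-antisym j≤t (ℕₚ.≰⇒> j≰) | refl ← ℕₚ.≤-antisym t≤T (ℕₚ.≮⇒≥ t≮T) =
      contradiction lt (ℕₚ.<-irrefl (sym (ℕₚ.+-suc (suc t) (suc t))))
    down {zero} {zero} (_ , () , _) lt | no _
    top : ℕ.pred (T + T) ≡ 0 ⊎
      (∃[ t ] ∃[ j ] (Cell′ (t , j) × t + suc T ≡ ℕ.pred (T + T) + (j + j)))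
    top with 1 ℕ.≤? T
    ... | yes 1≤T = inj₂ (T , 1 , (ℕₚ.≤-refl , s≤s z≤n , 1≤T) , sym (height≡ 1≤T))
    ... | no 1≰T = inj₁ (cong (λ k → ℕ.pred (k + k)) (ℕₚ.n<1⇒n≡0 (ℕₚ.≰⇒> 1≰T)))

  open RegionPoset region

  -- If g t j = [j ≤ α t], then [α t, α t + k] is the set of the values at the positions ≤ k = T - t,
  -- with indicator prefix g.
  prefix : (ℕ → ℕ → ℤ) → ℕ → ℕ → ℕ → ℤ
  prefix g t k v = g t (v ∸ k) ℤ.- g t (suc v)

  -- Row k of the permutation matrix is the prefix indicator for k minus that for k - 1, which
  -- belongs to t + 1. Writing `suc v ∸ k` for v - (k - 1) makes the second bracket vanish at k = 0,
  -- where no earlier prefix exists.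
  entry : (ℕ → ℕ → ℤ) → ℕ → ℕ → ℤ
  entry g k v = prefix g (T ∸ k) k v ℤ.- (g (suc (T ∸ k)) (suc v ∸ k) ℤ.- g (suc (T ∸ k)) (suc v))

  entry-linear : ∀ k v → Linear (λ y m → entry (grid y m) k v)
  entry-linear k v = Linear-minus (Linear-minus (grid-linear (T ∸ k) (v ∸ k)) (grid-linear (T ∸ k) (suc v)))
    (Linear-minus (grid-linear (suc (T ∸ k)) (suc v ∸ k)) (grid-linear (suc (T ∸ k)) (suc v)))

  module _ (N : ℤ) (y : Fin d → ℤ) (m : ℤ) (N∣m : N ∣ m)
    (N∣entry : ∀ (i j : Fin n) → N ∣ entry (grid y m) (toℕ i) (toℕ j)) where

    private
      g = grid y m

      N∣entryℕ : ∀ k v → k ≤ T → v ≤ T → N ∣ entry g k v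
      N∣entryℕ k v k≤T v≤T = subst₂ (λ k v → N ∣ entry g k v)
        (Finₚ.toℕ-fromℕ< (s≤s k≤T)) (Finₚ.toℕ-fromℕ< (s≤s v≤T)) (N∣entry (fromℕ< (s≤s k≤T)) (fromℕ< (s≤s v≤T)))

      N∣prefix : ∀ k v → k ≤ T → v ≤ T → N ∣ prefix g (T ∸ k) k v
      N∣prefix zero v k≤T v≤T = subst (N ∣_)
        (arith (prefix g T 0 v) (g (suc T) (suc v))) (N∣entryℕ 0 v k≤T v≤T)
        where
        arith : ∀ a b → a ℤ.- (b ℤ.- b) ≡ a
        arith = solve-∀
      N∣prefix (suc k) v k≤T v≤T = subst (N ∣_)
        (arith (prefix g (T ∸ suc k) (suc k) v) (prefix g (suc (T ∸ suc k)) k v))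
        (∣m∣n⇒∣m+n (N∣entryℕ (suc k) v k≤T v≤T)
          (subst (λ t → N ∣ prefix g t k v) (∸-suc k≤T) (N∣prefix k v (ℕₚ.<⇒≤ k≤T) v≤T)))
        where
        arith : ∀ a b → (a ℤ.- b) ℤ.+ b ≡ a
        arith = solve-∀

      -- The prefix is the difference of rows v ∸ k and v + 1, so the latter row follows from the
      -- former. The descent is not by single rows, hence the bound b; it ends at row 0, where the
      -- grid is m.
      N∣grid : ∀ k b j → k ≤ T → j ≤ b → b ≤ n → N ∣ g (T ∸ k) j
      N∣grid k b zero k≤T j≤b b≤n = subst (N ∣_) (sym (grid-low y m (T ∸ k) 0 z≤n)) N∣m
      N∣grid k (suc b) (suc v) k≤T (s≤s v≤b) (s≤s b≤T) = subst (N ∣_)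
        (arith (g (T ∸ k) (v ∸ k)) (g (T ∸ k) (suc v)))
        (∣m∣n⇒∣m-n (N∣grid k b (v ∸ k) k≤T (ℕₚ.≤-trans (ℕₚ.m∸n≤m v k) v≤b) (ℕₚ.m≤n⇒m≤1+n b≤T))
                   (N∣prefix k v k≤T (ℕₚ.≤-trans v≤b b≤T)))
        where
        arith : ∀ a b → a ℤ.- (a ℤ.- b) ≡ b
        arith = solve-∀

    N∣coordinates : ∀ p → N ∣ y p
    N∣coordinates p with t≤T , _ , j≤t ← cell-Cell p = subst (N ∣_)
      (trans (cong (λ t → g t (row p)) (ℕₚ.m∸[m∸n]≡n t≤T)) (grid-cell y m p))
      (N∣grid (T ∸ col p) n (row p) (ℕₚ.m∸n≤m T (col p)) (ℕₚ.m≤n⇒m≤1+n (ℕₚ.≤-trans j≤t t≤T)) ℕₚ.≤-refl)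

  -- The value at position k when the positions up to k carry [α t, α t + k]: it is the lower end if
  -- the remaining interval begins one higher, else the upper end. For k = 0 both ends agree.
  data Step (α : ℕ → ℕ) (t : ℕ) : ℕ → ℕ → Set where
    first : Step α t 0 (α t)
    down  : ∀ {k} → α (suc t) ≡ suc (α t) → Step α t (suc k) (α t)
    up    : ∀ {k} → α (suc t) ≡ α t → Step α t (suc k) (α t + suc k)

  Follows : (ℕ → ℕ) → (ℕ → ℕ) → Set
  Follows s α = ∀ k t → k + t ≡ T → Step α t k (s k)

  -- Passing to the shorter prefix removes one end of the interval, so the difference of the two
  -- indicators reduces to a single `χ-diff`.
  entry-step : ∀ {α} g → (∀ t j → t ≤ T → g t j ≡ + χ (j ℕ.≤? α t)) →
    ∀ {s} → Follows s α → ∀ k v → k ≤ T → + χ (s k ℕ.≟ v) ≡ entry g k v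
  entry-step {α} g g≡ {s} follows k v k≤T =
    go k (T ∸ k) (s k) (follows k (T ∸ k) (ℕₚ.m+[n∸m]≡n k≤T)) (ℕₚ.m∸n≤m T k)
       (suc-≤ k≤T)
    where
    suc-≤ : ∀ {k k′} → k ≤ T → k ≡ suc k′ → suc (T ∸ k) ≤ T
    suc-≤ {k′ = k} k≤T refl = subst (_≤ T) (∸-suc k≤T) (ℕₚ.m∸n≤m T k)
    cancel : ∀ a b c → a ℤ.- b ≡ (a ℤ.- c) ℤ.- (b ℤ.- c)
    cancel = solve-∀
    go : ∀ k t w → Step α t k w → t ≤ T → (∀ {k′} → k ≡ suc k′ → suc t ≤ T) →
      + χ (w ℕ.≟ v) ≡ prefix g t k v ℤ.- (g (suc t) (suc v ∸ k) ℤ.- g (suc t) (suc v))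
    go zero t _ first t≤T _ rewrite g≡ t v t≤T | g≡ t (suc v) t≤T =
      trans (sym (χ-diff (α t) v)) (arith (+ χ (v ℕ.≤? α t)) (+ χ (suc v ℕ.≤? α t)) (g (suc t) (suc v)))
      where
      arith : ∀ a b c → a ℤ.- b ≡ (a ℤ.- b) ℤ.- (c ℤ.- c)
      arith = solve-∀
    go (suc k) t _ (up eq) t≤T t<T
      rewrite g≡ t (v ∸ suc k) t≤T | g≡ t (suc v) t≤T | g≡ (suc t) (v ∸ k) (t<T refl)
            | g≡ (suc t) (suc v) (t<T refl) | eq | χ-∸ (α t) (suc k) v | χ-∸ (α t) (suc k) (suc v) =
      trans (sym (χ-diff (α t + suc k) v)) (cancel (+ χ (v ℕ.≤? α t + suc k)) (+ χ (suc v ℕ.≤? α t + suc k)) (+ χ (suc v ℕ.≤? α t)))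
    go (suc k) t _ (down eq) t≤T t<T
      rewrite g≡ t (v ∸ suc k) t≤T | g≡ t (suc v) t≤T | g≡ (suc t) (v ∸ k) (t<T refl)
            | g≡ (suc t) (suc v) (t<T refl) | eq | χ-∸ (α t) (suc k) v | χ-∸ (suc (α t)) k v | ℕₚ.+-suc (α t) k
            | χ-cong (suc v ℕ.≤? suc (α t)) (v ℕ.≤? α t) ℕ.s≤s⁻¹ s≤s =
      trans (sym (χ-diff (α t) v))
        (arith (+ χ (v ℕ.≤? suc (α t + k))) (+ χ (suc v ℕ.≤? α t)) (+ χ (v ℕ.≤? α t)))
      where
      arith : ∀ a b c → c ℤ.- b ≡ (a ℤ.- b) ℤ.- (a ℤ.- c)
      arith = solve-∀

  module OfPerm (σ : Perm n) (avoids : Av132-312 σ) where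
    open PermValues σ

    -- Counts, among the last t positions, those whose value is the least up to there; this is the
    -- least value left after removing them.
    α : ℕ → ℕ
    α zero    = 0
    α (suc t) = α t + χ (val (T ∸ t) ℕ.≟ α t)

    record Interval (k a : ℕ) : Set where
      field
        range    : ∀ p → p ≤ k → a ≤ val p × val p ≤ a + k
        attained : ∀ w → a ≤ w → w ≤ a + k → ∃[ p ] (p ≤ k × val p ≡ w)
    open Interval

    -- If the last value were neither end of the interval, both ends would occur earlier, and with
    -- it they would form 132 or 312 according to their order.
    extreme : ∀ k a → suc k ≤ T → Interval (suc k) a → val (suc k) ≡ a ⊎ val (suc k) ≡ a + suc k
    extreme k a k<T I with val (suc k) ℕ.≟ a | val (suc k) ℕ.≟ a + suc k
    ... | yes eq | _ = inj₁ eq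
    ... | no _   | yes eq = inj₂ eq
    ... | no ≢lo | no ≢hi
      with i , i≤ , val-i ← attained I a ℕₚ.≤-refl (ℕₚ.m≤m+n a (suc k))
      with j , j≤ , val-j ← attained I (a + suc k) (ℕₚ.m≤m+n a (suc k)) ℕₚ.≤-refl =
      ⊥-elim (pattern-at (ℕₚ.<-cmp i j))
      where
      i<k : i < suc k
      i<k = ℕₚ.≤∧≢⇒< i≤ λ { refl → ≢lo val-i }
      j<k : j < suc k
      j<k = ℕₚ.≤∧≢⇒< j≤ λ { refl → ≢hi val-j }
      lo< : val i < val (suc k)
      lo< = subst (_< val (suc k)) (sym val-i) (ℕₚ.≤∧≢⇒< (proj₁ (range I (suc k) ℕₚ.≤-refl)) (≢lo ∘ sym))
      <hi : val (suc k) < val j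
      <hi = subst (val (suc k) <_) (sym val-j) (ℕₚ.≤∧≢⇒< (proj₂ (range I (suc k) ℕₚ.≤-refl)) ≢hi)
      pattern-at : Tri (i < j) (i ≡ j) (j < i) → _
      pattern-at (tri< i<j _ _) = proj₁ avoids (contains132 i<j j<k (s≤s k<T) lo< <hi)
      pattern-at (tri≈ _ refl _) = ℕₚ.<-asym lo< <hi
      pattern-at (tri> _ _ j<i) = proj₂ avoids (contains312 j<i i<k (s≤s k<T) lo< <hi)

    drop-down : ∀ k a → suc k ≤ T → Interval (suc k) a → val (suc k) ≡ a → Interval k (suc a)
    drop-down k a k<T I eq = record
      { range = λ p p≤k → ℕₚ.≤∧≢⇒< (proj₁ (range I p (ℕₚ.m≤n⇒m≤1+n p≤k)))
            (λ a≡ → ℕₚ.<⇒≢ (s≤s p≤k) (val-injective (s≤s (ℕₚ.≤-trans p≤k (ℕₚ.<⇒≤ k<T))) (s≤s k<T) (trans (sym a≡) (sym eq))))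
          , subst (val p ≤_) (ℕₚ.+-suc a k) (proj₂ (range I p (ℕₚ.m≤n⇒m≤1+n p≤k)))
      ; attained = λ w a<w w≤ → case attained I w (ℕₚ.<⇒≤ a<w) (subst (w ≤_) (sym (ℕₚ.+-suc a k)) w≤) of λ
          { (p , p≤ , val-p) → p , ℕ.s≤s⁻¹ (ℕₚ.≤∧≢⇒< p≤ λ { refl → ℕₚ.<⇒≢ a<w (trans (sym eq) val-p) }) , val-p } }

    drop-up : ∀ k a → suc k ≤ T → Interval (suc k) a → val (suc k) ≡ a + suc k → Interval k a
    drop-up k a k<T I eq = record
      { range = λ p p≤k → proj₁ (range I p (ℕₚ.m≤n⇒m≤1+n p≤k)) ,
          ℕ.s≤s⁻¹ (subst (val p <_) (ℕₚ.+-suc a k) (ℕₚ.≤∧≢⇒< (proj₂ (range I p (ℕₚ.m≤n⇒m≤1+n p≤k)))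
            (λ ≡a+ → ℕₚ.<⇒≢ (s≤s p≤k) (val-injective (s≤s (ℕₚ.≤-trans p≤k (ℕₚ.<⇒≤ k<T))) (s≤s k<T) (trans ≡a+ (sym eq))))))
      ; attained = λ w a≤w w≤ → case attained I w a≤w (ℕₚ.≤-trans w≤ (ℕₚ.+-monoʳ-≤ a (ℕₚ.n≤1+n k))) of λ
          { (p , p≤ , val-p) → p , ℕ.s≤s⁻¹ (ℕₚ.≤∧≢⇒< p≤ λ { refl →
              ℕₚ.<⇒≱ (ℕₚ.+-monoʳ-< a (ℕₚ.n<1+n k)) (subst (_≤ a + k) (trans (sym val-p) eq) w≤) }) , val-p } }

    at-position : ∀ k t → k + t ≡ T → T ∸ t ≡ k
    at-position k t eq = trans (cong (_∸ t) (sym eq)) (ℕₚ.m+n∸n≡m k t)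

    α-down : ∀ k t → k + t ≡ T → val k ≡ α t → α (suc t) ≡ suc (α t)
    α-down k t eq val≡ = trans (cong (α t ℕ.+_) (χ-yes (val (T ∸ t) ℕ.≟ α t) (trans (cong val (at-position k t eq)) val≡)))
                             (ℕₚ.+-comm (α t) 1)

    α-up : ∀ k t → k + t ≡ T → val k ≢ α t → α (suc t) ≡ α t
    α-up k t eq val≢ = trans (cong (α t ℕ.+_) (χ-no (val (T ∸ t) ℕ.≟ α t)
      (val≢ ∘ trans (cong val (sym (at-position k t eq)))))) (ℕₚ.+-identityʳ (α t))

    ≤-complement : ∀ {k t} → k + t ≡ T → k ≤ T
    ≤-complement {k} {t} eq = subst (k ≤_) eq (ℕₚ.m≤m+n k t)

    interval : ∀ t k → k + t ≡ T → Interval k (α t)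
    interval zero k eq with refl ← trans (sym (ℕₚ.+-identityʳ k)) eq = record
      { range = λ p p≤T → z≤n , ℕ.s≤s⁻¹ (val-< (s≤s p≤T))
      ; attained = λ w _ w≤T → case val-surjective (s≤s w≤T) of λ { (p , s≤s p≤T , val-p) → p , p≤T , val-p } }
    interval (suc t) k eq with eq′ ← trans (sym (ℕₚ.+-suc k t)) eq =
      case val (suc k) ℕ.≟ α t of λ
        { (yes val≡) → subst (Interval k) (sym (α-down (suc k) t eq′ val≡)) (drop-down k (α t) (≤-complement eq′) I val≡)
        ; (no val≢)  → subst (Interval k) (sym (α-up (suc k) t eq′ val≢)) (drop-up k (α t) (≤-complement eq′) I
            (case extreme k (α t) (≤-complement eq′) I of λ
              { (inj₁ val≡) → contradiction val≡ val≢ ; (inj₂ val≡) → val≡ })) }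
      where I = interval t (suc k) (trans (sym (ℕₚ.+-suc k t)) eq)

    follows : Follows val α
    follows zero t eq with lo , hi ← range (interval t 0 eq) 0 z≤n =
      subst (Step α t 0) (ℕₚ.≤-antisym lo (subst (val 0 ≤_) (ℕₚ.+-identityʳ (α t)) hi)) first
    follows (suc k) t eq with val (suc k) ℕ.≟ α t
    ... | yes val≡ = subst (Step α t (suc k)) (sym val≡) (down (α-down (suc k) t eq val≡))
    ... | no val≢ with extreme k (α t) (≤-complement eq) (interval t (suc k) eq)
    ...   | inj₁ val≡ = contradiction val≡ val≢
    ...   | inj₂ val≡ = subst (Step α t (suc k)) (sym val≡) (up (α-up (suc k) t eq val≢))

    path : Path α
    path = record
      { lower = λ _ _ → z≤n
      ; upper = λ t _ → α-≤ t
      ; mono  = λ t _ → ℕₚ.m≤m+n (α t) _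
      ; step  = λ t _ → ℕₚ.≤-trans (ℕₚ.+-monoʳ-≤ (α t) (χ-≤1 (val (T ∸ t) ℕ.≟ α t))) (ℕₚ.≤-reflexive (ℕₚ.+-comm (α t) 1)) }
      where
      α-≤ : ∀ t → α t ≤ t
      α-≤ zero    = z≤n
      α-≤ (suc t) = ℕₚ.≤-trans (ℕₚ.+-mono-≤ (α-≤ t) (χ-≤1 (val (T ∸ t) ℕ.≟ α t))) (ℕₚ.≤-reflexive (ℕₚ.+-comm t 1))

  module OfPath {α : ℕ → ℕ} (path : Path α) where
    open Path path

    s : ℕ → ℕ
    s k with α (suc (T ∸ k)) ℕ.≟ suc (α (T ∸ k))
    ... | yes _ = α (T ∸ k)
    ... | no _  = α (T ∸ k) + k

    follows : Follows s α
    follows k t eq with refl ← trans (cong (_∸ k) (sym eq)) (ℕₚ.m+n∸m≡n k t) = go k eq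
      where
      go : ∀ k → k + (T ∸ k) ≡ T → Step α (T ∸ k) k (s k)
      go k eq with α (suc (T ∸ k)) ℕ.≟ suc (α (T ∸ k))
      -- α (T + 1) lies beyond the path and is arbitrary, but at k = 0 both branches give α T.
      go zero eq | yes _ = first
      go zero eq | no _ = subst (Step α T 0) (sym (ℕₚ.+-identityʳ (α T))) first
      go (suc k) eq | yes is-down = down is-down
      go (suc k) eq | no not-down = up (ℕₚ.≤-antisym
        (ℕ.s≤s⁻¹ (ℕₚ.≤∧≢⇒< (step _ t<T) not-down)) (mono _ t<T))
        where
        t<T : T ∸ suc k < T
        t<T = subst (suc (T ∸ suc k) ≤_) eq (s≤s (ℕₚ.m≤n+m (T ∸ suc k) k))

    next : ∀ {k t} → suc k + t ≡ T → k + suc t ≡ T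
    next {k} {t} eq = trans (ℕₚ.+-suc k t) eq

    t<T : ∀ {k t} → suc k + t ≡ T → t < T
    t<T {k} {t} eq = subst (suc t ≤_) eq (s≤s (ℕₚ.m≤n+m t k))

    range : ∀ k t → k + t ≡ T → ∀ i → i ≤ k → α t ≤ s i × s i ≤ α t + k
    range zero t eq zero z≤n with s 0 | follows 0 t eq
    ... | _ | first = ℕₚ.≤-refl , ℕₚ.m≤m+n (α t) 0
    range (suc k) t eq i i≤ with i ℕ.≤? k
    ... | yes i≤k with lo , hi ← range k (suc t) (next eq) i i≤k =
      ℕₚ.≤-trans (mono t (t<T eq)) lo ,
      ℕₚ.≤-trans hi (ℕₚ.≤-trans (ℕₚ.+-monoˡ-≤ k (step t (t<T eq))) (ℕₚ.≤-reflexive (sym (ℕₚ.+-suc (α t) k))))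
    ... | no i≰k with refl ← ℕₚ.≤-antisym i≤ (ℕₚ.≰⇒> i≰k) with s (suc k) | follows (suc k) t eq
    ...   | _ | down _ = ℕₚ.≤-refl , ℕₚ.m≤m+n (α t) (suc k)
    ...   | _ | up _   = ℕₚ.m≤m+n (α t) (suc k) , ℕₚ.≤-refl

    extremal : ∀ k → suc k ≤ T → (∀ i → i ≤ k → s (suc k) < s i) ⊎ (∀ i → i ≤ k → s i < s (suc k))
    extremal k k<T with eq ← ℕₚ.m+[n∸m]≡n k<T with s (suc k) | follows (suc k) (T ∸ suc k) eq
    ... | _ | down is-down = inj₁ λ i i≤k → subst (_≤ s i) is-down (proj₁ (range k _ (next eq) i i≤k))
    ... | _ | up is-up = inj₂ λ i i≤k → subst (s i <_) (sym (ℕₚ.+-suc _ k))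
      (s≤s (subst (λ a → s i ≤ a + k) is-up (proj₂ (range k _ (next eq) i i≤k))))

    s-< : ∀ {k} → k < n → s k < n
    s-< {k} (s≤s k≤T) with eq ← ℕₚ.m+[n∸m]≡n k≤T = s≤s (ℕₚ.≤-trans (proj₂ (range k (T ∸ k) eq k ℕₚ.≤-refl))
      (subst (α (T ∸ k) + k ≤_) (trans (ℕₚ.+-comm _ k) eq) (ℕₚ.+-monoˡ-≤ k (upper (T ∸ k) (ℕₚ.m∸n≤m T k)))))

    s-≢ : ∀ {i j} → i < j → j < n → s i ≢ s j
    s-≢ {i} {suc j} (s≤s i≤j) (s≤s j<T) eq with extremal j j<T
    ... | inj₁ below = ℕₚ.<⇒≢ (below i i≤j) (sym eq)
    ... | inj₂ above = ℕₚ.<⇒≢ (above i i≤j) eq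

    s-injective : ∀ {i j} → i < n → j < n → s i ≡ s j → i ≡ j
    s-injective {i} {j} i<n j<n eq = ℕₚ.≤-antisym
      (ℕₚ.≮⇒≥ λ j<i → s-≢ j<i i<n (sym eq)) (ℕₚ.≮⇒≥ λ i<j → s-≢ i<j j<n eq)

    open MakePerm s s-< s-injective public

    -- 132 and 312 are the two patterns whose last value lies between the other two.
    not-between : ∀ {i j k} → i < k → j < k → k < n → ¬ (s i < s k × s k < s j)
    not-between {k = suc k} (s≤s i≤k) (s≤s j≤k) (s≤s k<T) (lo , hi) with extremal k k<T
    ... | inj₁ below = ℕₚ.<-asym lo (below _ i≤k)
    ... | inj₂ above = ℕₚ.<-asym hi (above _ j≤k)

    avoids : Av132-312 perm
    avoids = (λ { (i , j , k , i<j , j<k , a , b) →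
                 not-between (ℕₚ.<-trans i<j j<k) j<k (Finₚ.toℕ<n k) (perm-<⁻ a , perm-<⁻ b) })
           , (λ { (i , j , k , i<j , j<k , a , b) →
                 not-between j<k (ℕₚ.<-trans i<j j<k) (Finₚ.toℕ<n k) (perm-<⁻ a , perm-<⁻ b) })

  model : OrderModel (Av132-312 {n}) poset
  model = record
    { matrix        = λ i j y m → entry (grid y m) (toℕ i) (toℕ j)
    ; matrix-linear = λ i j → entry-linear (toℕ i) (toℕ j)
    ; matrix-∣      = N∣coordinates
    ; ideal         = λ σ av → let open OfPerm σ av in
        pathIdeal path , (pathIdeal-weak path , λ p → χ-≤1 (row p ℕ.≤? α (col p))) ,
        λ i j → trans (PermValues.permMatrix-χ σ i j)
          (entry-step (grid (+_ ∘ pathIdeal path) 1ℤ) (grid-path path) follows (toℕ i) (toℕ j) (ℕ.s≤s⁻¹ (Finₚ.toℕ<n i)))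
    ; vertex        = λ f (weak , f≤1) → let open OfPath (heights-path weak f≤1) in
        perm , avoids , (weak , f≤1) ,
        λ i j → trans (permMatrix-perm i j)
          (entry-step (grid (+_ ∘ f) 1ℤ) (grid-heights weak f≤1) follows (toℕ i) (toℕ j) (ℕ.s≤s⁻¹ (Finₚ.toℕ<n i)))
    }

Av132-312-palindromic : ∀ n → HStarPalindromic (Av132-312 {n})
Av132-312-palindromic zero    = ModelProperties.h*-palindromic (emptyModel λ σ → (λ { (() , _) }) , λ { (() , _) })
Av132-312-palindromic (suc T) = ModelProperties.h*-palindromic (Interval.model T)

-- Alternating permutations avoiding 123

Even? : ∀ p → Dec (Even p)
Even? zero          = yes tt
Even? (suc zero)    = no id
Even? (suc (suc p)) = Even? p

even-suc : ∀ p → Even p → ¬ Even (suc p)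
even-suc (suc (suc p)) e = even-suc p e

odd-suc : ∀ p → ¬ Even p → Even (suc p)
odd-suc zero          o = contradiction tt o
odd-suc (suc zero)    o = tt
odd-suc (suc (suc p)) o = odd-suc p o

⌊1+odd/2⌋ : ∀ p → ¬ Even p → ⌊ suc p /2⌋ ≡ suc ⌊ p /2⌋
⌊1+odd/2⌋ zero          o = contradiction tt o
⌊1+odd/2⌋ (suc zero)    o = refl
⌊1+odd/2⌋ (suc (suc p)) o = cong suc (⌊1+odd/2⌋ p o)

⌊1+even/2⌋ : ∀ p → Even p → ⌊ suc p /2⌋ ≡ ⌊ p /2⌋
⌊1+even/2⌋ zero          e = refl
⌊1+even/2⌋ (suc (suc p)) e = cong suc (⌊1+even/2⌋ p e)

Even-double : ∀ i → Even (i + i)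
Even-double zero    = tt
Even-double (suc i) = subst (Even ∘ suc) (sym (ℕₚ.+-suc i i)) (Even-double i)

⌈n/2⌉+⌈n/2⌉≤1+n : ∀ n → ⌈ n /2⌉ + ⌈ n /2⌉ ≤ suc n
⌈n/2⌉+⌈n/2⌉≤1+n zero          = z≤n
⌈n/2⌉+⌈n/2⌉≤1+n (suc zero)    = ℕₚ.≤-refl
⌈n/2⌉+⌈n/2⌉≤1+n (suc (suc n)) =
  s≤s (subst (_≤ suc (suc n)) (sym (ℕₚ.+-suc ⌈ n /2⌉ ⌈ n /2⌉)) (s≤s (⌈n/2⌉+⌈n/2⌉≤1+n n)))

n≤⌈n/2⌉+⌈n/2⌉ : ∀ n → n ≤ ⌈ n /2⌉ + ⌈ n /2⌉
n≤⌈n/2⌉+⌈n/2⌉ n = subst (_≤ ⌈ n /2⌉ + ⌈ n /2⌉) (ℕₚ.⌊n/2⌋+⌈n/2⌉≡n n)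
  (ℕₚ.+-monoˡ-≤ ⌈ n /2⌉ (ℕₚ.⌊n/2⌋≤⌈n/2⌉ n))

⌈/2⌉-<⁻ : ∀ t {j} → ⌈ t /2⌉ < j → suc (suc t) ≤ j + j
⌈/2⌉-<⁻ t lt = ℕₚ.≤-trans (s≤s (subst (suc t ≤_) (sym (ℕₚ.+-suc ⌈ t /2⌉ ⌈ t /2⌉)) (s≤s (n≤⌈n/2⌉+⌈n/2⌉ t))))
  (ℕₚ.+-mono-≤ lt lt)

⌈/2⌉-≤ : ∀ t {j} → t ≤ j + j → ⌈ t /2⌉ ≤ j
⌈/2⌉-≤ t {j} le = subst (⌈ t /2⌉ ≤_) (sym (ℕₚ.n≡⌈n+n/2⌉ j)) (ℕₚ.⌈n/2⌉-mono le)

module AlternatingRegion (n : ℕ) where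

  -- The number of positions of type `A`: the odd ones and, for odd n, the last.
  h : ℕ
  h = ⌈ n /2⌉

  region : Region
  region = record
    -- Among the t greatest values there are at most t and at most h of the a's, and at least t/2,
    -- because each b is exceeded by the a of the same index.
    { T = n ; l = ⌈_/2⌉ ; u = ℕ._⊓ h
    ; u≤ = λ t → ℕₚ.m⊓n≤m t h
    ; l≤u = λ t t≤n → ℕₚ.⊓-glb (ℕₚ.⌈n/2⌉≤n t) (ℕₚ.⌈n/2⌉-mono t≤n)
    ; l-mono = λ t → ℕₚ.⌈n/2⌉-mono (ℕₚ.n≤1+n t) ; l-step = λ t → s≤s (ℕₚ.⌊n/2⌋≤⌈n/2⌉ t)
    ; u-mono = λ t → ℕₚ.⊓-monoˡ-≤ h (ℕₚ.n≤1+n t)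
    ; u-step = λ t → ℕₚ.⊓-monoʳ-≤ (suc t) (ℕₚ.n≤1+n h)
    -- In the rank t + h + 1 - 2j, the bounds j ≤ t and j ≤ h make it positive, and t + 2 ≤ 2j keeps
    -- it at most h - 1.
    ; offset = suc h ; height = ℕ.pred h
    ; offset-pos = λ {t} {j} (_ , _ , j≤) → subst (j + j <_) (sym (ℕₚ.+-suc t h))
        (s≤s (ℕₚ.+-mono-≤ (ℕₚ.≤-trans j≤ (ℕₚ.m⊓n≤m t h)) (ℕₚ.≤-trans j≤ (ℕₚ.m⊓n≤n t h))))
    ; height-bound = λ {t} {j} c@(_ , l<j , _) → subst (_≤ ℕ.pred h + (j + j)) (shift t (h-pos c))
        (ℕₚ.+-monoʳ-≤ (ℕ.pred h) (⌈/2⌉-<⁻ t l<j))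
    ; cell-up = up
    ; cell-down = down
    ; cell-top = top h refl
    }
    where
    Cell′ : ℕ × ℕ → Set
    Cell′ (t , j) = t ≤ n × ⌈ t /2⌉ < j × j ≤ t ℕ.⊓ h
    h-pos : ∀ {t j} → Cell′ (t , j) → 1 ≤ h
    h-pos {t} (_ , l<j , j≤) = ℕₚ.≤-trans (s≤s z≤n) (ℕₚ.≤-trans l<j (ℕₚ.≤-trans j≤ (ℕₚ.m⊓n≤n t h)))
    shift : ∀ t → 1 ≤ h → ℕ.pred h + suc (suc t) ≡ t + suc h
    shift t 1≤h = trans (arith (ℕ.pred h) t)
      (cong (λ k → t + suc k) (ℕₚ.suc-pred h {{ℕ.>-nonZero 1≤h}}))
      where
      arith : ∀ a t → a + suc (suc t) ≡ t + suc (suc a)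
      arith = ℕ-Solver.solve-∀
    up : ∀ {t j} → Cell′ (t , j) → t + suc h < ℕ.pred h + (j + j) → ∃[ c ] (Cell′ c × Below (t , j) c)
    up {t} {j} c@(t≤n , l<j , j≤) lt =
      (suc t , j) ,
      (ℕₚ.≤-pred (ℕₚ.≤-trans (ℕₚ.n≤1+n _) (ℕₚ.≤-trans 3+t≤2j (ℕₚ.≤-trans
          (ℕₚ.+-mono-≤ j≤h j≤h) (⌈n/2⌉+⌈n/2⌉≤1+n n)))) ,
       subst (suc ⌈ suc t /2⌉ ≤_) (sym (ℕₚ.n≡⌈n+n/2⌉ j)) (ℕₚ.⌈n/2⌉-mono 3+t≤2j) ,
       ℕₚ.⊓-glb (ℕₚ.m≤n⇒m≤1+n (ℕₚ.≤-trans j≤ (ℕₚ.m⊓n≤m t h))) j≤h) ,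
      inj₂ (refl , refl)
      where
      j≤h = ℕₚ.≤-trans j≤ (ℕₚ.m⊓n≤n t h)
      3+t≤2j : suc (suc (suc t)) ≤ j + j
      3+t≤2j = ℕₚ.+-cancelˡ-< (ℕ.pred h) _ _ (subst (_< ℕ.pred h + (j + j)) (sym (shift t (h-pos c))) lt)
    down : ∀ {t j} → Cell′ (t , j) → suc (j + j) < t + suc h → ∃[ c ] (Cell′ c × Below c (t , j))
    down {t} {j} (t≤n , l<j , j≤) lt with t ℕ.≤? j
    ... | yes t≤j with refl ← ℕₚ.≤-antisym t≤j (ℕₚ.≤-trans j≤ (ℕₚ.m⊓n≤m t h)) =
      (suc t , suc t) ,
      (ℕₚ.≤-trans t<h (ℕₚ.⌈n/2⌉≤n n) ,
       s≤s (ℕₚ.≤-trans (s≤s (ℕₚ.⌊n/2⌋≤⌈n/2⌉ t)) l<j) ,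
       ℕₚ.⊓-glb ℕₚ.≤-refl t<h) ,
      inj₁ (refl , refl)
      where
      t<h : t < h
      t<h = ℕₚ.+-cancelˡ-< t t h (ℕ.s≤s⁻¹ (subst (suc (t + t) <_) (ℕₚ.+-suc t h) lt))
    down {zero} {j} _ _ | no t≰j = contradiction z≤n t≰j
    down {suc t} {j} (t<n , l<j , j≤) lt | no t≰j =
      (t , j) ,
      (ℕₚ.<⇒≤ t<n , ℕₚ.≤-<-trans (ℕₚ.⌈n/2⌉-mono (ℕₚ.n≤1+n t)) l<j ,
       ℕₚ.⊓-glb (ℕ.s≤s⁻¹ (ℕₚ.≰⇒> t≰j)) (ℕₚ.≤-trans j≤ (ℕₚ.m⊓n≤n (suc t) h))) ,
      inj₂ (refl , refl)
    top : ∀ k → h ≡ k → ℕ.pred h ≡ 0 ⊎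
      (∃[ t ] ∃[ j ] (Cell′ (t , j) × t + suc h ≡ ℕ.pred h + (j + j)))
    top zero          eq = inj₁ (cong ℕ.pred eq)
    top (suc zero)    eq = inj₁ (cong ℕ.pred eq)
    -- The cell (2h - 2, h) attains t + 2 = 2j; here 2h - 2 = k + h.
    top (suc (suc k)) eq = inj₂ (k + h , h ,
      (ℕₚ.≤-trans (ℕₚ.n≤1+n _) (ℕ.s≤s⁻¹ (subst (_≤ suc n) double (⌈n/2⌉+⌈n/2⌉≤1+n n))) ,
       subst (suc ⌈ k + h /2⌉ ≤_) (trans (cong ⌈_/2⌉ (sym double)) (sym (ℕₚ.n≡⌈n+n/2⌉ h))) ℕₚ.≤-refl ,
       ℕₚ.⊓-glb (ℕₚ.m≤n+m h k) ℕₚ.≤-refl) ,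
      trans (arith k h) (cong (λ a → ℕ.pred a + (h + h)) (sym eq)))
      where
      double : h + h ≡ suc (suc (k + h))
      double = cong (_+ h) eq
      arith : ∀ k h → k + h + suc h ≡ suc k + (h + h)
      arith = ℕ-Solver.solve-∀

  open RegionPoset region public

  -- The peaks together with a final valley at an even position; B are the other valleys. Both
  -- subsequences are decreasing and each a_i exceeds the preceding b_i, where i = ⌊ p /2⌋.
  A B : ℕ → Set
  A p = ¬ Even p ⊎ suc p ≡ n
  B p = Even p × suc p ≢ n

  role : ∀ p → A p ⊎ B p
  role p with Even? p | suc p ℕ.≟ n
  ... | no odd   | _        = inj₁ (inj₁ odd)
  ... | yes _    | yes last = inj₁ (inj₂ last)
  ... | yes even | no ¬last = inj₂ (even , ¬last)

  A∩B : ∀ {p} → A p → ¬ B p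
  A∩B (inj₁ odd)  (even , _)  = odd even
  A∩B (inj₂ last) (_ , ¬last) = ¬last last

  B-< : ∀ {p} → B p → p < n → suc p < n
  B-< (_ , ¬last) p<n = ℕₚ.≤∧≢⇒< p<n ¬last

  A-odd : ∀ {p q} → A p → p < q → q < n → ¬ Even p
  A-odd (inj₁ odd)  p<q q<n = odd
  A-odd (inj₂ refl) p<q q<n = contradiction q<n (ℕₚ.≤⇒≯ p<q)

  A-half-< : ∀ {p q} → A p → p < q → q < n → ⌊ p /2⌋ < ⌊ q /2⌋
  A-half-< {p} a p<q q<n = subst (_≤ _) (⌊1+odd/2⌋ p (A-odd a p<q q<n)) (ℕₚ.⌊n/2⌋-mono p<q)

  B-half-< : ∀ {p q} → B q → p < q → ⌊ p /2⌋ < ⌊ q /2⌋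
  B-half-< {p} {suc q} (even , _) (s≤s p≤q) =
    subst (suc ⌊ p /2⌋ ≤_) (sym (⌊1+odd/2⌋ q (λ e → even-suc q e even))) (s≤s (ℕₚ.⌊n/2⌋-mono p≤q))

  half-<⁻ : ∀ {p q} → ⌊ p /2⌋ < ⌊ q /2⌋ → p < q
  half-<⁻ lt = ℕₚ.≰⇒> λ q≤p → ℕₚ.<⇒≱ lt (ℕₚ.⌊n/2⌋-mono q≤p)

  A-injective : ∀ {p q} → A p → A q → p < n → q < n → ⌊ p /2⌋ ≡ ⌊ q /2⌋ → p ≡ q
  A-injective a a′ p<n q<n eq = ℕₚ.≤-antisym
    (ℕₚ.≮⇒≥ λ q<p → ℕₚ.<⇒≢ (A-half-< a′ q<p p<n) (sym eq)) (ℕₚ.≮⇒≥ λ p<q → ℕₚ.<⇒≢ (A-half-< a p<q q<n) eq)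

  B-injective : ∀ {p q} → B p → B q → ⌊ p /2⌋ ≡ ⌊ q /2⌋ → p ≡ q
  B-injective b b′ eq = ℕₚ.≤-antisym
    (ℕₚ.≮⇒≥ λ q<p → ℕₚ.<⇒≢ (B-half-< b q<p) (sym eq)) (ℕₚ.≮⇒≥ λ p<q → ℕₚ.<⇒≢ (B-half-< b′ p<q) eq)

  half-< : ∀ {p} → p < n → ⌊ p /2⌋ < h
  half-< p<n = ℕₚ.⌊n/2⌋-mono (s≤s p<n)

  A-position : ∀ i → i < h → ∃[ p ] (p < n × A p × ⌊ p /2⌋ ≡ i)
  A-position i i<h with suc (i + i) ℕ.<? n
  ... | yes lt = suc (i + i) , lt , inj₁ (even-suc (i + i) (Even-double i)) , sym (ℕₚ.n≡⌈n+n/2⌉ i)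
  -- From 2i + 2 ≤ 2h ≤ n + 1 the position 2i exists, so if 2i + 1 does not, then 2i is the last
  -- one.
  ... | no ≮ = i + i , 2i<n , inj₂ (ℕₚ.≤-antisym 2i<n (ℕₚ.≮⇒≥ ≮)) , sym (ℕₚ.n≡⌊n+n/2⌋ i)
    where
    2i<n : i + i < n
    2i<n = ℕ.s≤s⁻¹ (ℕₚ.≤-trans (subst (_≤ h + h) (cong suc (ℕₚ.+-suc i i)) (ℕₚ.+-mono-≤ i<h i<h))
                                (⌈n/2⌉+⌈n/2⌉≤1+n n))

  B-position : ∀ i → suc i + suc i ≤ n → ∃[ p ] (p < n × B p × ⌊ p /2⌋ ≡ i)
  B-position i le = i + i , ℕₚ.<⇒≤ lt , (Even-double i , ℕₚ.<⇒≢ lt) , sym (ℕₚ.n≡⌊n+n/2⌋ i)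
    where
    lt : suc (i + i) < n
    lt = subst (_≤ n) (cong suc (ℕₚ.+-suc i i)) le

  -- With g t j = [j ≤ α t], α t counts the a's among the top t values, so the t-th largest value (at
  -- t ∸ 1 = n ∸ suc w) is a_i exactly when α rises from i to suc i; dually for the b's and t ∸ α t.
  entryAt : (ℕ → ℕ → ℤ) → ∀ p → A p ⊎ B p → ℕ → ℤ
  entryAt g p (inj₁ _) t = g (suc t) (suc ⌊ p /2⌋) ℤ.- g t (suc ⌊ p /2⌋)
  entryAt g p (inj₂ _) t = g t (t ∸ ⌊ p /2⌋) ℤ.- g (suc t) (suc t ∸ ⌊ p /2⌋)

  entry : (ℕ → ℕ → ℤ) → ℕ → ℕ → ℤ
  entry g p w = entryAt g p (role p) (n ∸ suc w)

  entryAt-linear : ∀ p r t → Linear (λ y m → entryAt (grid y m) p r t)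
  entryAt-linear p (inj₁ _) t = Linear-minus (grid-linear (suc t) (suc ⌊ p /2⌋)) (grid-linear t (suc ⌊ p /2⌋))
  entryAt-linear p (inj₂ _) t = Linear-minus (grid-linear t (t ∸ ⌊ p /2⌋)) (grid-linear (suc t) (suc t ∸ ⌊ p /2⌋))

  module _ (N : ℤ) (y : Fin d → ℤ) (m : ℤ) (N∣m : N ∣ m)
    (N∣entry : ∀ (i j : Fin n) → N ∣ entry (grid y m) (toℕ i) (toℕ j)) where

    private
      g = grid y m

      N∣entryℕ : ∀ {p w} → p < n → w < n → N ∣ entry g p w
      N∣entryℕ p<n w<n = subst₂ (λ p w → N ∣ entry g p w)
        (Finₚ.toℕ-fromℕ< p<n) (Finₚ.toℕ-fromℕ< w<n) (N∣entry (fromℕ< p<n) (fromℕ< w<n))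

      N∣difference : ∀ i t → i < h → t < n → N ∣ g (suc t) (suc i) ℤ.- g t (suc i)
      N∣difference i t i<h t<n with p , p<n , a , refl ← A-position i i<h =
        subst (λ t → N ∣ g (suc t) (suc ⌊ p /2⌋) ℤ.- g t (suc ⌊ p /2⌋)) (complement t<n)
          (at-role (role p) (N∣entryℕ p<n w<n))
        where
        w<n : n ∸ suc t < n
        w<n = ℕₚ.∸-monoʳ-< (s≤s z≤n) t<n
        complement : ∀ {t} → t < n → n ∸ suc (n ∸ suc t) ≡ t
        complement {t} t<n = trans (cong (n ∸_) (sym (∸-suc t<n))) (ℕₚ.m∸[m∸n]≡n (ℕₚ.<⇒≤ t<n))
        -- The proof inside `role p` may differ from a, but `entryAt` looks only at the side.
        at-role : ∀ r → N ∣ entryAt g p r (n ∸ suc (n ∸ suc t)) → N ∣ entryAt g p (inj₁ a) (n ∸ suc (n ∸ suc t))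
        at-role (inj₁ _) div = div
        at-role (inj₂ b) _   = contradiction b (A∩B a)

      -- The entries in the row of a_i telescope along t, starting from column 0, where the grid
      -- vanishes in positive rows.
      N∣grid : ∀ i t → i < h → t ≤ n → N ∣ g t (suc i)
      N∣grid i zero i<h t≤n = subst (N ∣_) (sym (grid-high y m 0 (suc i) (s≤s z≤n) (s≤s z≤n)))
        (divides 0ℤ refl)
      N∣grid i (suc t) i<h t<n = subst (N ∣_) (arith (g (suc t) (suc i)) (g t (suc i)))
        (∣m∣n⇒∣m+n (N∣difference i t i<h t<n) (N∣grid i t i<h (ℕₚ.<⇒≤ t<n)))
        where
        arith : ∀ a b → (a ℤ.- b) ℤ.+ b ≡ a
        arith = solve-∀

    N∣coordinates : ∀ p → N ∣ y p
    N∣coordinates p = subst (N ∣_) (grid-cell y m p) (go (cell p) (cell-Cell p))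
      where
      go : ∀ c → Region.Cell region c → N ∣ g (proj₁ c) (proj₂ c)
      go (t , suc j) (t≤n , _ , j≤) = N∣grid j t (ℕₚ.≤-trans j≤ (ℕₚ.m⊓n≤n t h)) t≤n

module AlternatingModel (n : ℕ) where
  open AlternatingRegion n

  -- Both subsequences decrease, so after the t greatest values the next one is the a of index α t
  -- or the b of index t - α t; p is its position.
  data Step (α : ℕ → ℕ) (t p : ℕ) : Set where
    rise : A p → ⌊ p /2⌋ ≡ α t → α (suc t) ≡ suc (α t) → Step α t p
    flat : B p → ⌊ p /2⌋ ≡ t ∸ α t → α (suc t) ≡ α t → Step α t p

  A-step : ∀ {α t p} → A p → Step α t p → ⌊ p /2⌋ ≡ α t × α (suc t) ≡ suc (α t)
  A-step a (rise _ half eq) = half , eq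
  A-step a (flat b _ _)     = contradiction b (A∩B a)

  B-step : ∀ {α t p} → B p → Step α t p → ⌊ p /2⌋ ≡ t ∸ α t × α (suc t) ≡ α t
  B-step b (flat _ half eq) = half , eq
  B-step b (rise a _ _)     = contradiction b (A∩B a)

  record Follows (s α : ℕ → ℕ) : Set where
    field
      s-step       : ∀ t p → p < n → s p + suc t ≡ n → Step α t p
      s-injective  : ∀ {p q} → p < n → q < n → s p ≡ s q → p ≡ q
      s-surjective : ∀ {w} → w < n → ∃[ p ] (p < n × s p ≡ w)

  -- With q the position of w, s p = w means p = q. For p and q of the same role this is equality of
  -- their indices, which `χ-diff` detects; for different roles the two grid values cancel.
  entry-step : ∀ {α} → Path α → ∀ g → (∀ t j → t ≤ n → g t j ≡ + χ (j ℕ.≤? α t)) →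
    ∀ {s} → Follows s α → ∀ p w → p < n → w < n → + χ (s p ℕ.≟ w) ≡ entry g p w
  entry-step {α} path g g≡ {s} follows p w p<n w<n with q , q<n , sq≡w ← Follows.s-surjective follows w<n =
    go (role p) (s-step t q q<n (trans (cong (_+ suc t) sq≡w) (trans (ℕₚ.+-suc w t) (ℕₚ.m+[n∸m]≡n w<n))))
    where
    open Follows follows
    t = n ∸ suc w
    i = ⌊ p /2⌋
    t<n : t < n
    t<n = ℕₚ.∸-monoʳ-< (s≤s z≤n) w<n
    a≤t : α t ≤ t
    a≤t = ℕₚ.≤-trans (Path.upper path t (ℕₚ.<⇒≤ t<n)) (ℕₚ.m⊓n≤m t h)
    p≡q : s p ≡ w → p ≡ q
    p≡q sp≡w = s-injective p<n q<n (trans sp≡w (sym sq≡w))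
    vanish : p ≢ q → ∀ a → + χ (s p ℕ.≟ w) ≡ a ℤ.- a
    vanish p≢q a = trans (cong +_ (χ-no (s p ℕ.≟ w) (p≢q ∘ p≡q))) (sym (ℤₚ.+-inverseʳ a))
    go : ∀ r → Step α t q → + χ (s p ℕ.≟ w) ≡ entryAt g p r t
    go (inj₁ a) (rise a′ half eq)
      rewrite g≡ (suc t) (suc i) t<n | g≡ t (suc i) (ℕₚ.<⇒≤ t<n) | eq
            | χ-cong (suc i ℕ.≤? suc (α t)) (i ℕ.≤? α t) ℕ.s≤s⁻¹ s≤s =
      trans (cong +_ (χ-cong (s p ℕ.≟ w) (α t ℕ.≟ i)
        (λ sp≡w → trans (sym half) (cong ⌊_/2⌋ (sym (p≡q sp≡w))))
        (λ a≡i → trans (cong s (A-injective a a′ p<n q<n (trans (sym a≡i) (sym half)))) sq≡w)))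
      (sym (χ-diff (α t) i))
    go (inj₁ a) (flat b half eq)
      rewrite g≡ (suc t) (suc i) t<n | g≡ t (suc i) (ℕₚ.<⇒≤ t<n) | eq =
      vanish (λ { refl → A∩B a b }) (+ χ (suc i ℕ.≤? α t))
    go (inj₂ b) (rise a half eq)
      rewrite g≡ (suc t) (suc t ∸ i) t<n | g≡ t (t ∸ i) (ℕₚ.<⇒≤ t<n) | eq
            | χ-∸ (α t) i t | χ-∸ (suc (α t)) i (suc t)
            | χ-cong (suc t ℕ.≤? suc (α t) + i) (t ℕ.≤? α t + i) ℕ.s≤s⁻¹ s≤s =
      vanish (λ { refl → A∩B a b }) (+ χ (t ℕ.≤? α t + i))
    go (inj₂ b) (flat b′ half eq)
      rewrite g≡ (suc t) (suc t ∸ i) t<n | g≡ t (t ∸ i) (ℕₚ.<⇒≤ t<n) | eq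
            | χ-∸ (α t) i t | χ-∸ (α t) i (suc t) =
      trans (cong +_ (χ-cong (s p ℕ.≟ w) (α t + i ℕ.≟ t)
        (λ sp≡w → trans (cong (α t ℕ.+_) (trans (cong ⌊_/2⌋ (p≡q sp≡w)) half)) (ℕₚ.m+[n∸m]≡n a≤t))
        (λ a+i≡t → trans (cong s (B-injective b b′ (trans (sym (ℕₚ.m+n∸m≡n (α t) i))
          (trans (cong (_∸ α t) a+i≡t) (sym half))))) sq≡w)))
      (sym (χ-diff (α t + i) t))

  module OfPerm (σ : Perm n) (alternating : Alternating σ) (avoids : ¬ Contains123 σ) where
    open PermValues σ

    even-< : ∀ {p} → Even p → suc p < n → val p < val (suc p)
    even-< {p} even 1+p<n = subst₂ _<_ (sym (val-fromℕ< p<n)) (sym (val-fromℕ< 1+p<n))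
      (proj₁ (alternating (fromℕ< p<n) (fromℕ< 1+p<n)
        (trans (Finₚ.toℕ-fromℕ< 1+p<n) (cong suc (sym (Finₚ.toℕ-fromℕ< p<n)))))
        (subst Even (sym (Finₚ.toℕ-fromℕ< p<n)) even))
      where p<n = ℕₚ.<-trans (ℕₚ.n<1+n p) 1+p<n

    decreasing : ∀ {p q} → p < q → q < n → (val p < val q → Contains123 σ) → val q < val p
    decreasing p<q q<n pattern′ = ℕₚ.≤∧≢⇒< (ℕₚ.≮⇒≥ (avoids ∘ pattern′))
      λ eq → ℕₚ.<⇒≢ p<q (val-injective (ℕₚ.<-trans p<q q<n) q<n (sym eq))

    -- The valley before the peak p is smaller, so a greater value after p would complete 123.
    A-decreasing : ∀ {p q} → A p → p < q → q < n → val q < val p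
    A-decreasing {zero} a p<q q<n = contradiction tt (A-odd a p<q q<n)
    A-decreasing {suc p} a p<q q<n = decreasing p<q q<n λ lt → contains123 (ℕₚ.n<1+n p) p<q q<n
      (even-< (even-p (Even? p)) (ℕₚ.<-trans p<q q<n)) lt
      where
      even-p : Dec (Even p) → Even p
      even-p (yes even) = even
      even-p (no odd)   = contradiction (odd-suc p odd) (A-odd a p<q q<n)

    -- The peak after the valley q is greater, so a smaller value before q would complete 123.
    B-decreasing : ∀ {p q} → B q → p < q → q < n → val q < val p
    B-decreasing {q = q} b p<q q<n = decreasing p<q q<n λ lt →
      contains123 p<q (ℕₚ.n<1+n q) (B-< b q<n) lt (even-< (proj₁ b) (B-< b q<n))

    Top : ℕ → ℕ → Set
    Top t p = n ≤ val p + t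

    -- The t greatest values are exactly the first a of the a's and the first t - a of the b's.
    record Invariant (t a : ℕ) : Set where
      field
        a≤t    : a ≤ t
        a≤h    : a ≤ h
        ballot : t ≤ a + a
        A⇒ : ∀ {p} → p < n → A p → ⌊ p /2⌋ < a → Top t p
        A⇐ : ∀ {p} → p < n → A p → Top t p → ⌊ p /2⌋ < a
        B⇒ : ∀ {p} → p < n → B p → a + ⌊ p /2⌋ < t → Top t p
        B⇐ : ∀ {p} → p < n → B p → Top t p → a + ⌊ p /2⌋ < t
    open Invariant

    invariant-0 : Invariant 0 0
    invariant-0 = record
      { a≤t = z≤n ; a≤h = z≤n ; ballot = z≤n
      ; A⇒ = λ _ _ () ; A⇐ = λ p<n _ top → contradiction top (not-top p<n)
      ; B⇒ = λ _ _ () ; B⇐ = λ p<n _ top → contradiction top (not-top p<n) }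
      where
      not-top : ∀ {p} → p < n → ¬ Top 0 p
      not-top {p} p<n top = ℕₚ.<⇒≱ (val-< p<n) (subst (n ≤_) (ℕₚ.+-identityʳ (val p)) top)

    isA : ∀ {p} → A p ⊎ B p → ℕ
    isA (inj₁ _) = 1
    isA (inj₂ _) = 0

    isA≤1 : ∀ {p} (r : A p ⊎ B p) → isA r ≤ 1
    isA≤1 (inj₁ _) = ℕₚ.≤-refl
    isA≤1 (inj₂ _) = z≤n

    module _ {t a q : ℕ} (q<n : q < n) (val-q : val q + suc t ≡ n) (inv : Invariant t a) where

      q-not-top : ¬ Top t q
      q-not-top top = ℕₚ.<⇒≱ (subst (val q + t <_) val-q (ℕₚ.+-monoʳ-< (val q) (ℕₚ.n<1+n t))) top

      above-q-top : ∀ {p} → val q < val p → Top t p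
      above-q-top {p} lt = subst (_≤ val p + t) (trans (sym (ℕₚ.+-suc (val q) t)) val-q) (ℕₚ.+-monoˡ-≤ t lt)

      top-suc : ∀ {p} → Top t p → Top (suc t) p
      top-suc {p} top = ℕₚ.≤-trans top (ℕₚ.+-monoʳ-≤ (val p) (ℕₚ.n≤1+n t))

      top-q : ∀ {p} → p ≡ q → Top (suc t) p
      top-q refl = ℕₚ.≤-reflexive (sym val-q)

      top-suc⁻ : ∀ {p} → p < n → Top (suc t) p → Top t p ⊎ p ≡ q
      top-suc⁻ {p} p<n top with n ℕ.≤? val p + t
      ... | yes top′ = inj₁ top′
      ... | no ¬top′ = inj₂ (val-injective p<n q<n (ℕₚ.+-cancelʳ-≡ (suc t) (val p) (val q)
        (trans (ℕₚ.≤-antisym (subst (_≤ n) (sym (ℕₚ.+-suc (val p) t)) (ℕₚ.≰⇒> ¬top′)) top) (sym val-q))))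

      -- An a of smaller index is already among the top values. If the index were larger, the a of
      -- index a would exceed q and be among them, against the invariant.
      A-half : A q → ⌊ q /2⌋ ≡ a
      A-half aq = ℕₚ.≤-antisym (ℕₚ.≮⇒≥ not-later) (ℕₚ.≮⇒≥ λ lt → q-not-top (A⇒ inv q<n aq lt))
        where
        not-later : ¬ (a < ⌊ q /2⌋)
        not-later lt with p , p<n , ap , refl ← A-position a (ℕₚ.<-trans lt (half-< q<n)) =
          ℕₚ.<-irrefl refl (A⇐ inv p<n ap (above-q-top (A-decreasing ap (half-<⁻ lt) q<n)))

      B-half : B q → a + ⌊ q /2⌋ ≡ t
      B-half bq = ℕₚ.≤-antisym (ℕₚ.≮⇒≥ not-later) (ℕₚ.≮⇒≥ λ lt → q-not-top (B⇒ inv q<n bq lt))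
        where
        b = t ∸ a
        a+b≡t : a + b ≡ t
        a+b≡t = ℕₚ.m+[n∸m]≡n (a≤t inv)
        not-later : ¬ (t < a + ⌊ q /2⌋)
        not-later lt with b<half ← ℕₚ.+-cancelˡ-< a b ⌊ q /2⌋ (subst (_< a + ⌊ q /2⌋) (sym a+b≡t) lt)
          with p , p<n , bp , half ← B-position b (ℕₚ.≤-trans (ℕₚ.+-mono-≤ b<half b<half)
            (ℕₚ.≤-trans (ℕₚ.+-monoʳ-≤ ⌊ q /2⌋ (ℕₚ.⌊n/2⌋≤⌈n/2⌉ q))
              (ℕₚ.≤-trans (ℕₚ.≤-reflexive (ℕₚ.⌊n/2⌋+⌈n/2⌉≡n q)) (ℕₚ.<⇒≤ q<n)))) =
          ℕₚ.<-irrefl (trans (cong (a ℕ.+_) half) a+b≡t) (B⇐ inv p<n bp (above-q-top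
            (B-decreasing bq (half-<⁻ (subst (_< ⌊ q /2⌋) (sym half) b<half)) q<n)))

      -- The peak right after the valley q is greater, so it is already among the top values, and it
      -- has the same index.
      B-ballot : B q → ⌊ q /2⌋ < a
      B-ballot bq = subst (_< a) (⌊1+even/2⌋ q (proj₁ bq))
        (A⇐ inv (B-< bq q<n) (inj₁ (even-suc q (proj₁ bq))) (above-q-top (even-< (proj₁ bq) (B-< bq q<n))))

      advance : (r : A q ⊎ B q) → Invariant (suc t) (a + isA r)
      advance (inj₁ aq) rewrite ℕₚ.+-comm a 1 = record
        { a≤t = s≤s (a≤t inv)
        ; a≤h = subst (_< h) (A-half aq) (half-< q<n)
        ; ballot = s≤s (ℕₚ.≤-trans (ballot inv) (ℕₚ.+-monoʳ-≤ a (ℕₚ.n≤1+n a)))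
        ; A⇒ = λ p<n ap lt → case ℕₚ.m<1+n⇒m<n∨m≡n lt of λ
            { (inj₁ <a) → top-suc (A⇒ inv p<n ap <a)
            ; (inj₂ ≡a) → top-q (A-injective ap aq p<n q<n (trans ≡a (sym (A-half aq)))) }
        ; A⇐ = λ p<n ap top → case top-suc⁻ p<n top of λ
            { (inj₁ top′) → ℕₚ.m<n⇒m<1+n (A⇐ inv p<n ap top′)
            ; (inj₂ refl) → s≤s (ℕₚ.≤-reflexive (A-half aq)) }
        ; B⇒ = λ p<n bp lt → top-suc (B⇒ inv p<n bp (ℕ.s≤s⁻¹ lt))
        ; B⇐ = λ p<n bp top → case top-suc⁻ p<n top of λ
            { (inj₁ top′) → s≤s (B⇐ inv p<n bp top′)
            ; (inj₂ refl) → contradiction bp (A∩B aq) }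
        }
      advance (inj₂ bq) rewrite ℕₚ.+-identityʳ a = record
        { a≤t = ℕₚ.m≤n⇒m≤1+n (a≤t inv)
        ; a≤h = a≤h inv
        -- Here t = a + ⌊ q /2⌋ < a + a, so a need not grow.
        ; ballot = subst (λ t → suc t ≤ a + a) (B-half bq) (ℕₚ.+-monoʳ-< a (B-ballot bq))
        ; A⇒ = λ p<n ap lt → top-suc (A⇒ inv p<n ap lt)
        ; A⇐ = λ p<n ap top → case top-suc⁻ p<n top of λ
            { (inj₁ top′) → A⇐ inv p<n ap top′
            ; (inj₂ refl) → contradiction bq (A∩B ap) }
        ; B⇒ = λ p<n bp lt → case ℕₚ.m<1+n⇒m<n∨m≡n lt of λ
            { (inj₁ <t) → top-suc (B⇒ inv p<n bp <t)
            ; (inj₂ ≡t) → top-q (B-injective bp bq (ℕₚ.+-cancelˡ-≡ a _ _ (trans ≡t (sym (B-half bq))))) }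
        ; B⇐ = λ p<n bp top → case top-suc⁻ p<n top of λ
            { (inj₁ top′) → ℕₚ.m<n⇒m<1+n (B⇐ inv p<n bp top′)
            ; (inj₂ refl) → s≤s (ℕₚ.≤-reflexive (B-half bq)) }
        }

    position : ∀ t → t < n → ∃[ p ] (p < n × val p + suc t ≡ n)
    position t t<n = case val-surjective (ℕₚ.∸-monoʳ-< (s≤s z≤n) t<n) of λ
      { (p , p<n , eq) → p , p<n , trans (cong (_+ suc t) eq) (ℕₚ.m∸n+n≡m t<n) }

    pos : ℕ → ℕ
    pos t with t ℕ.<? n
    ... | yes t<n = proj₁ (position t t<n)
    ... | no _    = 0

    pos-spec : ∀ {t} → t < n → pos t < n × val (pos t) + suc t ≡ n
    pos-spec {t} t<n with t ℕ.<? n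
    ... | yes t<n′ = proj₂ (position t t<n′)
    ... | no t≮n   = contradiction t<n t≮n

    α : ℕ → ℕ
    α zero    = 0
    α (suc t) = α t + isA (role (pos t))

    invariant : ∀ t → t ≤ n → Invariant t (α t)
    invariant zero    _   = invariant-0
    invariant (suc t) t<n =
      advance (proj₁ (pos-spec t<n)) (proj₂ (pos-spec t<n)) (invariant t (ℕₚ.<⇒≤ t<n)) (role (pos t))

    path : Path α
    path = record
      { lower = λ t t≤n → ⌈/2⌉-≤ t (ballot (invariant t t≤n))
      ; upper = λ t t≤n → ℕₚ.⊓-glb (a≤t (invariant t t≤n)) (a≤h (invariant t t≤n))
      ; mono  = λ t _ → ℕₚ.m≤m+n (α t) _
      ; step  = λ t _ → ℕₚ.≤-trans (ℕₚ.+-monoʳ-≤ (α t) (isA≤1 (role (pos t)))) (ℕₚ.≤-reflexive (ℕₚ.+-comm (α t) 1))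
      }

    step-pos : ∀ t → t < n → Step α t (pos t)
    step-pos t t<n = go (role (pos t)) refl
      where
      inv = invariant t (ℕₚ.<⇒≤ t<n)
      go : ∀ r → α (suc t) ≡ α t + isA r → Step α t (pos t)
      go (inj₁ a) eq = rise a (A-half (proj₁ (pos-spec t<n)) (proj₂ (pos-spec t<n)) inv a)
                              (trans eq (ℕₚ.+-comm (α t) 1))
      go (inj₂ b) eq = flat b
        (trans (sym (ℕₚ.m+n∸m≡n (α t) ⌊ pos t /2⌋))
          (cong (_∸ α t) (B-half (proj₁ (pos-spec t<n)) (proj₂ (pos-spec t<n)) inv b)))
        (trans eq (ℕₚ.+-identityʳ (α t)))

    follows : Follows val α
    follows = record
      { s-step = λ t p p<n eq → let t<n = subst (suc t ≤_) eq (ℕₚ.m≤n+m (suc t) (val p)) in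
          subst (Step α t) (val-injective (proj₁ (pos-spec t<n)) p<n
            (ℕₚ.+-cancelʳ-≡ (suc t) _ _ (trans (proj₂ (pos-spec t<n)) (sym eq)))) (step-pos t t<n)
      ; s-injective  = val-injective
      ; s-surjective = val-surjective }

  module OfPath {α : ℕ → ℕ} (path : Path α) where
    open Path path

    α-≤t : ∀ {t} → t ≤ n → α t ≤ t
    α-≤t {t} t≤n = ℕₚ.≤-trans (upper t t≤n) (ℕₚ.m⊓n≤m t h)

    α-≤h : ∀ {t} → t ≤ n → α t ≤ h
    α-≤h {t} t≤n = ℕₚ.≤-trans (upper t t≤n) (ℕₚ.m⊓n≤n t h)

    α-growth : ∀ k t → k + t ≤ n → α t ≤ α (k + t) × α (k + t) ≤ k + α t
    α-growth zero    t le = ℕₚ.≤-refl , ℕₚ.≤-refl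
    α-growth (suc k) t lt with lo , hi ← α-growth k t (ℕₚ.<⇒≤ lt) =
      ℕₚ.≤-trans lo (mono (k + t) lt) , ℕₚ.≤-trans (step (k + t) lt) (s≤s hi)

    α-mono : ∀ {t t′} → t ≤ t′ → t′ ≤ n → α t ≤ α t′
    α-mono {t} {t′} t≤t′ t′≤n = subst (λ k → α t ≤ α k) (ℕₚ.m∸n+n≡m t≤t′)
      (proj₁ (α-growth (t′ ∸ t) t (subst (_≤ n) (sym (ℕₚ.m∸n+n≡m t≤t′)) t′≤n)))

    α-growth-≤ : ∀ {t t′} → t ≤ t′ → t′ ≤ n → t + α t′ ≤ t′ + α t
    α-growth-≤ {t} {t′} t≤t′ t′≤n = ℕₚ.≤-trans
      (ℕₚ.+-monoʳ-≤ t (subst (λ k → α k ≤ t′ ∸ t + α t) (ℕₚ.m∸n+n≡m t≤t′)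
        (proj₂ (α-growth (t′ ∸ t) t (subst (_≤ n) (sym (ℕₚ.m∸n+n≡m t≤t′)) t′≤n)))))
      (ℕₚ.≤-reflexive (trans (sym (ℕₚ.+-assoc t (t′ ∸ t) (α t))) (cong (_+ α t) (ℕₚ.m+[n∸m]≡n t≤t′))))

    -- The number of b's among the t greatest values.
    β : ℕ → ℕ
    β t = t ∸ α t

    β-mono : ∀ {t t′} → t ≤ t′ → t′ ≤ n → β t ≤ β t′
    β-mono {t} {t′} t≤t′ t′≤n = ℕₚ.m≤n+o⇒m∸n≤o t (α t) (ℕₚ.+-cancelʳ-≤ (α t′) t (α t + β t′)
      (ℕₚ.≤-trans (α-growth-≤ t≤t′ t′≤n) (ℕₚ.≤-reflexive (begin
        t′ + α t             ≡⟨ cong (_+ α t) (ℕₚ.m∸n+n≡m (α-≤t t′≤n)) ⟨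
        β t′ + α t′ + α t    ≡⟨ arith (β t′) (α t′) (α t) ⟩
        α t + β t′ + α t′    ∎))))
      where
      open ≡-Reasoning
      arith : ∀ a b c → a + b + c ≡ c + a + b
      arith = ℕ-Solver.solve-∀

    β-suc : ∀ {t} → t < n → α (suc t) ≡ α t → β (suc t) ≡ suc (β t)
    β-suc {t} t<n eq = trans (cong (suc t ∸_) eq) (ℕₚ.+-∸-assoc 1 (α-≤t (ℕₚ.<⇒≤ t<n)))

    -- At most ⌊ n /2⌋ of the values go to B, since α ends at h.
    flat-room : ∀ {t} → t < n → α (suc t) ≡ α t → suc (β t) + suc (β t) ≤ n
    flat-room {t} t<n eq = ℕₚ.≤-trans (ℕₚ.+-mono-≤ le le)
      (ℕₚ.≤-trans (ℕₚ.+-monoʳ-≤ ⌊ n /2⌋ (ℕₚ.⌊n/2⌋≤⌈n/2⌉ n)) (ℕₚ.≤-reflexive (ℕₚ.⌊n/2⌋+⌈n/2⌉≡n n)))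
      where
      open ℕₚ.≤-Reasoning
      le : suc (β t) ≤ ⌊ n /2⌋
      le = begin
        suc (β t)              ≡⟨ β-suc t<n eq ⟨
        β (suc t)              ≤⟨ β-mono t<n ℕₚ.≤-refl ⟩
        n ∸ α n                ≤⟨ ℕₚ.∸-monoʳ-≤ n (lower n ℕₚ.≤-refl) ⟩
        n ∸ h                  ≡⟨ cong (_∸ h) (ℕₚ.⌊n/2⌋+⌈n/2⌉≡n n) ⟨
        ⌊ n /2⌋ + h ∸ h        ≡⟨ ℕₚ.m+n∸n≡m ⌊ n /2⌋ h ⟩
        ⌊ n /2⌋                ∎

    position : ∀ t → t < n → ∃[ p ] (p < n × Step α t p)
    position t t<n with α (suc t) ℕ.≟ suc (α t)
    ... | yes eq = case A-position (α t) (subst (_≤ h) eq (α-≤h t<n)) of λ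
      { (p , p<n , a , half) → p , p<n , rise a half eq }
    ... | no neq = case B-position (β t) (flat-room t<n eq) of λ
      { (p , p<n , b , half) → p , p<n , flat b half eq }
      where
      eq : α (suc t) ≡ α t
      eq = ℕₚ.≤-antisym (ℕ.s≤s⁻¹ (ℕₚ.≤∧≢⇒< (step t t<n) neq)) (mono t t<n)

    σ⁻¹ : ℕ → ℕ
    σ⁻¹ t with t ℕ.<? n
    ... | yes t<n = proj₁ (position t t<n)
    ... | no _    = 0

    σ⁻¹-spec : ∀ {t} → t < n → σ⁻¹ t < n × Step α t (σ⁻¹ t)
    σ⁻¹-spec {t} t<n with t ℕ.<? n
    ... | yes t<n′ = proj₂ (position t t<n′)
    ... | no t≮n   = contradiction t<n t≮n

    -- A rise at t lifts α above the index of p for good, and a flat step does the same with β, so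
    -- the index cannot be due again.
    step-unique : ∀ {t t′ p} → t < t′ → t′ < n → Step α t p → ¬ Step α t′ p
    step-unique {t′ = t′} t<t′ t′<n (rise _ half eq) (rise _ half′ _) =
      ℕₚ.<⇒≱ (subst (_≤ α t′) eq (α-mono t<t′ (ℕₚ.<⇒≤ t′<n))) (ℕₚ.≤-reflexive (trans (sym half′) half))
    step-unique {t′ = t′} t<t′ t′<n (flat _ half eq) (flat _ half′ _) =
      ℕₚ.<⇒≱ (subst (_≤ β t′) (β-suc (ℕₚ.<-trans t<t′ t′<n) eq) (β-mono t<t′ (ℕₚ.<⇒≤ t′<n)))
              (ℕₚ.≤-reflexive (trans (sym half′) half))
    step-unique _ _ (rise a _ _) (flat b _ _) = A∩B a b
    step-unique _ _ (flat b _ _) (rise a _ _) = A∩B a b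

    σ⁻¹-injective : ∀ {t t′} → t < n → t′ < n → σ⁻¹ t ≡ σ⁻¹ t′ → t ≡ t′
    σ⁻¹-injective {t} {t′} t<n t′<n eq = ℕₚ.≤-antisym
      (ℕₚ.≮⇒≥ λ t′<t → step-unique t′<t t<n (subst (Step α t′) (sym eq) (proj₂ (σ⁻¹-spec t′<n))) (proj₂ (σ⁻¹-spec t<n)))
      (ℕₚ.≮⇒≥ λ t<t′ → step-unique t<t′ t′<n (subst (Step α t) eq (proj₂ (σ⁻¹-spec t<n))) (proj₂ (σ⁻¹-spec t′<n)))

    -- The path lists positions by decreasing value; made into a permutation, this list is
    -- surjective and can be inverted to `time`.
    module Inverse = MakePerm σ⁻¹ (proj₁ ∘ σ⁻¹-spec) σ⁻¹-injective

    time : ℕ → ℕ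
    time p with p ℕ.<? n
    ... | yes p<n = proj₁ (Inverse.s-surjective p<n)
    ... | no _    = 0

    time-spec : ∀ {p} → p < n → time p < n × σ⁻¹ (time p) ≡ p
    time-spec {p} p<n with p ℕ.<? n
    ... | yes p<n′ = proj₂ (Inverse.s-surjective p<n′)
    ... | no p≮n   = contradiction p<n p≮n

    time-< : ∀ {p} → p < n → time p < n
    time-< = proj₁ ∘ time-spec

    time-step : ∀ {p} → p < n → Step α (time p) p
    time-step p<n = subst (Step α _) (proj₂ (time-spec p<n)) (proj₂ (σ⁻¹-spec (time-< p<n)))

    s : ℕ → ℕ
    s p = n ∸ suc (time p)

    s-< : ∀ {p} → p < n → s p < n
    s-< p<n = ℕₚ.∸-monoʳ-< (s≤s z≤n) (time-< p<n)

    s-time : ∀ {p} → p < n → s p + suc (time p) ≡ n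
    s-time p<n = ℕₚ.m∸n+n≡m (time-< p<n)

    s-injective : ∀ {p q} → p < n → q < n → s p ≡ s q → p ≡ q
    s-injective {p} {q} p<n q<n eq = begin
      p               ≡⟨ proj₂ (time-spec p<n) ⟨
      σ⁻¹ (time p)    ≡⟨ cong σ⁻¹ (ℕₚ.suc-injective (ℕₚ.+-cancelˡ-≡ (s p) _ _
                           (trans (s-time p<n) (sym (trans (cong (_+ suc (time q)) eq) (s-time q<n)))))) ⟩
      σ⁻¹ (time q)    ≡⟨ proj₂ (time-spec q<n) ⟩
      q               ∎
      where open ≡-Reasoning

    open MakePerm s s-< s-injective public

    follows : Follows s α
    follows = record
      { s-step = λ t p p<n eq → subst (λ t → Step α t p)
          (ℕₚ.suc-injective (ℕₚ.+-cancelˡ-≡ (s p) _ _ (trans (s-time p<n) (sym eq)))) (time-step p<n)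
      ; s-injective  = s-injective
      ; s-surjective = s-surjective }

    s-anti : ∀ {p q} → p < n → time q < time p → s p < s q
    s-anti p<n lt = ℕₚ.∸-monoʳ-< (s≤s lt) (time-< p<n)

    A-decreasing : ∀ {p q} → A p → A q → p < q → q < n → s q < s p
    A-decreasing {p} {q} a a′ p<q q<n = s-anti q<n (ℕₚ.≰⇒> λ le → ℕₚ.<⇒≱ (A-half-< a p<q q<n)
      (subst₂ _≤_ (sym (proj₁ (A-step a′ (time-step q<n)))) (sym (proj₁ (A-step a (time-step p<n))))
        (α-mono le (ℕₚ.<⇒≤ (time-< p<n)))))
      where p<n = ℕₚ.<-trans p<q q<n

    B-decreasing : ∀ {p q} → B p → B q → p < q → q < n → s q < s p
    B-decreasing {p} {q} b b′ p<q q<n = s-anti q<n (ℕₚ.≰⇒> λ le → ℕₚ.<⇒≱ (B-half-< b′ p<q)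
      (subst₂ _≤_ (sym (proj₁ (B-step b′ (time-step q<n)))) (sym (proj₁ (B-step b (time-step p<n))))
        (β-mono le (ℕₚ.<⇒≤ (time-< p<n)))))
      where p<n = ℕₚ.<-trans p<q q<n

    -- A flat step at t together with the lower boundary at t + 1 forces β t < α t. So when the
    -- valley of index β t is placed, the peak of that index has been placed before and is greater.
    even-< : ∀ {p} → Even p → suc p < n → s p < s (suc p)
    even-< {p} even 1+p<n = s-anti p<n (ℕₚ.≰⇒> λ le → ℕₚ.<⇒≱ β<α
      (ℕₚ.≤-trans (α-mono le (ℕₚ.<⇒≤ (time-< 1+p<n))) (ℕₚ.≤-reflexive
        (trans (sym (proj₁ (A-step (inj₁ (even-suc p even)) (time-step 1+p<n))))
          (trans (⌊1+even/2⌋ p even) (proj₁ at-p))))))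
      where
      p<n = ℕₚ.<-trans (ℕₚ.n<1+n p) 1+p<n
      t = time p
      at-p : ⌊ p /2⌋ ≡ β t × α (suc t) ≡ α t
      at-p = B-step (even , ℕₚ.<⇒≢ 1+p<n) (time-step p<n)
      ballot : ⌈ suc t /2⌉ ≤ α t
      ballot = subst (⌈ suc t /2⌉ ≤_) (proj₂ at-p) (lower (suc t) (time-< p<n))
      β<α : β t < α t
      β<α = ℕₚ.+-cancelʳ-< (α t) (β t) (α t)
        (subst (_< α t + α t) (sym (ℕₚ.m∸n+n≡m (α-≤t (ℕₚ.<⇒≤ (time-< p<n)))))
          (ℕₚ.≤-trans (n≤⌈n/2⌉+⌈n/2⌉ (suc t)) (ℕₚ.+-mono-≤ ballot ballot)))

    -- If the next position is a valley in `B`, its value is below the preceding valley, which is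
    -- below the peak between them.
    odd-> : ∀ {p} → ¬ Even p → suc p < n → s (suc p) < s p
    odd-> {zero}  odd 1+p<n = contradiction tt odd
    odd-> {suc p} odd 1+p<n with role (suc (suc p))
    ... | inj₁ a = A-decreasing (inj₁ odd) a (ℕₚ.n<1+n _) 1+p<n
    ... | inj₂ b@(even , _) = ℕₚ.<-trans
      (B-decreasing (even , ℕₚ.<⇒≢ p<n) b (ℕₚ.m<n⇒m<1+n (ℕₚ.n<1+n p)) 1+p<n) (even-< even p<n)
      where p<n = ℕₚ.<-trans (ℕₚ.n<1+n (suc p)) 1+p<n

    alternating : Alternating perm
    alternating i j eq =
      (λ even → perm-<⁺ (subst (λ q → s (toℕ i) < s q) (sym eq) (even-< even 1+i<n))) ,
      (λ odd → perm-<⁺ (subst (λ q → s q < s (toℕ i)) (sym eq) (odd-> odd 1+i<n)))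
      where
      1+i<n : suc (toℕ i) < n
      1+i<n = subst (_< n) eq (Finₚ.toℕ<n j)

    -- Two of three positions have the same role.
    avoids-123 : ¬ Contains123 perm
    avoids-123 (i , j , k , i<j , j<k , a , b) =
      go (role (toℕ i)) (role (toℕ j)) (role (toℕ k))
      where
      k<n = Finₚ.toℕ<n k
      si<sj = perm-<⁻ a
      sj<sk = perm-<⁻ b
      i<k = ℕₚ.<-trans i<j j<k
      j<n = ℕₚ.<-trans j<k k<n
      si<sk = ℕₚ.<-trans si<sj sj<sk
      go : A (toℕ i) ⊎ B (toℕ i) → A (toℕ j) ⊎ B (toℕ j) → A (toℕ k) ⊎ B (toℕ k) → _
      go (inj₁ x) (inj₁ y) _        = ℕₚ.<-asym si<sj (A-decreasing x y i<j j<n)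
      go (inj₂ x) (inj₂ y) _        = ℕₚ.<-asym si<sj (B-decreasing x y i<j j<n)
      go (inj₁ x) (inj₂ _) (inj₁ z) = ℕₚ.<-asym si<sk (A-decreasing x z i<k k<n)
      go (inj₂ x) (inj₁ _) (inj₂ z) = ℕₚ.<-asym si<sk (B-decreasing x z i<k k<n)
      go (inj₁ _) (inj₂ y) (inj₂ z) = ℕₚ.<-asym sj<sk (B-decreasing y z j<k k<n)
      go (inj₂ _) (inj₁ y) (inj₁ z) = ℕₚ.<-asym sj<sk (A-decreasing y z j<k k<n)

  model : OrderModel (AltAv123 {n}) poset
  model = record
    { matrix        = λ i j y m → entry (grid y m) (toℕ i) (toℕ j)
    ; matrix-linear = λ i j → entryAt-linear (toℕ i) (role (toℕ i)) (n ∸ suc (toℕ j))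
    ; matrix-∣      = N∣coordinates
    ; ideal         = λ σ (alt , av) → let open OfPerm σ alt av in
        pathIdeal path , (pathIdeal-weak path , λ p → χ-≤1 (row p ℕ.≤? α (col p))) ,
        λ i j → trans (PermValues.permMatrix-χ σ i j)
          (entry-step path (grid (+_ ∘ pathIdeal path) 1ℤ) (grid-path path) follows
            (toℕ i) (toℕ j) (Finₚ.toℕ<n i) (Finₚ.toℕ<n j))
    ; vertex        = λ f (weak , f≤1) → let open OfPath (heights-path weak f≤1) in
        perm , (alternating , avoids-123) , (weak , f≤1) ,
        λ i j → trans (permMatrix-perm i j)
          (entry-step (heights-path weak f≤1) (grid (+_ ∘ f) 1ℤ) (grid-heights weak f≤1) follows
            (toℕ i) (toℕ j) (Finₚ.toℕ<n i) (Finₚ.toℕ<n j))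
    }

theorem6p8 : ∀ (n : ℕ) → HStarPalindromic (Av132-312 {n}) × HStarPalindromic (AltAv123 {n})
theorem6p8 n = Av132-312-palindromic n , ModelProperties.h*-palindromic (AlternatingModel.model n)
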